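{- Let $G=(V,E)$ be a finite undirected graph with edge signs $\Xi$ and signed transition operator $\overline K$. Given $\epsilon$ with $\rho(\overline K)<\epsilon<\pi_*^{ -1/2}$, take $$\ell=\left\lceil\frac14\,\frac{\log(\epsilon^2\pi_*)}{\log(\rho(\overline K)/\epsilon)}\right\rceil,\qquad k=\left\lceil(1/\epsilon)^{2\ell}\right\rceil,\qquad R=k\ell+1.$$ Then the $R$-local, degree-$2$ SOS proof system can deduce the bound "$\rho(\overline K)\le\frac52\epsilon$", i.e. it derives the two inequalities $$-\tfrac52\epsilon\,\langle X,X\rangle_\pi\le\langle X,\overline KX\rangle_\pi\le\tfrac52\epsilon\,\langle X,X\rangle_\pi.$$ In particular, regarding $(G,\Xi)$ as a 2-XOR CSP, the $R$-round Sherali--Adams proof system can deduce the bound $\mathrm{OBJ}(X)\le\frac12+\frac54\epsilon$.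
   Context: $G=(V,E)$ is a finite undirected graph, with parallel edges and self-loops allowed (a self-loop counts as half an edge and contributes $1$ to its vertex's degree) and no isolated vertices. $K$ is the transition operator of the standard random walk on $G$: $K_{uv}$ is the $(u,v)$ adjacency-matrix entry divided by $\deg(u)$. $\pi(v)=\deg(v)/(2|E|)$ and $\pi_*=\min_v\pi(v)$. For each pair $(u,v)$ joined by an edge there is a sign $\xi_{uv}=\xi_{vu}\in\{\pm1\}$ (parallel edges share the same sign); $\Xi=(\xi_{uv})$, with entry $0$ for non-edges. The signed transition operator is the entrywise product $\overline K=\Xi\circ K$; it is self-adjoint for $\langle f,g\rangle_\pi=\sum_u\pi(u)f(u)g(u)$, and $\rho(\overline K)$ is its spectral radius. For indeterminates $X=(X_v)_{v\in V}$, $\langle X,MX\rangle_\pi=\sum_{u,v}\pi(u)M_{uv}X_uX_v$. The 2-XOR CSP defined by $(G,\Xi)$ asks to maximize over $x\in\{\pm1\}^V$ the fraction of edges $(u,v)$ with $x_ux_v=\xi_{uv}$; its objective polynomial is $\mathrm{OBJ}(X)=\frac12+\frac12\langle X,\overline KX\rangle_\pi$. $R$-local, degree-$2$ (static) SOS proof system (no Boolean equalities): lines are real polynomial inequalities in $X$; the axioms are all inequalities $p(X)^2\ge0$ with $p$ a real polynomial of degree at most $1$ in at most $R$ of the indeterminates; one may derive any nonnegative linear combination of previous lines. $R$-round Sherali--Adams: the axioms are all $p(X)^2\ge0$ with $p$ (of any degree) depending on at most $R$ indeterminates, together with all $(X_u^2-1)s(X)\ge0$ and $(X_u^2-1)s(X)\le0$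 where $(X_u^2-1)s(X)$ depends on at most $R$ indeterminates; again one derives nonnegative linear combinations. An inequality $p\le q$ is derived if the line $q-p\ge0$ is derived. -}

module Defs where

open import Algebra.Bundles using (CommutativeRing; CommutativeSemiring)
open import Algebra.Structures using (IsCommutativeRing)
import Algebra.Definitions.RawMonoid as RawMonoidDefs
import Algebra.Definitions.RawSemiring as RawSemiringDefs
open import Data.Fin using (Fin)
open import Data.Fin.Subset using (Subset; ∣_∣; _∈_)
import Data.List as List
import Data.List.Extrema as Extrema
open import Data.Nat as ℕ using (ℕ)
open import Data.Nat.Base using (+-0-rawMonoid)
open import Data.Product using (_×_; _,_; ∃; ∃₂)
open import Data.Sign using (Sign)
open import Level using (0ℓ)
open import Relation.Binary.Bundles using (DecTotalOrder; TotalOrder)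
open import Relation.Binary.Core using (Rel)
open import Relation.Binary.PropositionalEquality using (_≡_)
open import Relation.Binary.Structures using (IsDecTotalOrder; IsEquivalence)
import Relation.Binary.Construct.NonStrictToStrict as NonStrictToStrict
open import Relation.Nullary using (¬_)

-- The real numbers, taken axiomatically: a complete ordered field (unique up
-- to isomorphism), with the classically valid decidability of the order.
record CompleteOrderedField : Set₁ where
  infix  4 _≤_
  infix  8 _⁻¹
  field
    commutativeRing : CommutativeRing 0ℓ 0ℓ

  open CommutativeRing commutativeRing public

  field
    _≤_             : Rel Carrier 0ℓ
    isDecTotalOrder : IsDecTotalOrder _≈_ _≤_
    +-monoʳ-≤       : ∀ x {y z} → y ≤ z → x + y ≤ x + z
    *-nonneg        : ∀ {x y} → 0# ≤ x → 0# ≤ y → 0# ≤ x * y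
    1≉0             : ¬ (1# ≈ 0#)
    -- The value of 0# ⁻¹ is unspecified.
    _⁻¹             : Carrier → Carrier
    ⁻¹-cong         : ∀ {x y} → x ≈ y → x ⁻¹ ≈ y ⁻¹
    *-inverseʳ      : ∀ {x} → ¬ (x ≈ 0#) → x * x ⁻¹ ≈ 1#
    supremum        : (P : Carrier → Set) → ∃ P →
                      (∃ λ b → ∀ x → P x → x ≤ b) →
                      ∃ λ s → (∀ x → P x → x ≤ s) ×
                              (∀ b → (∀ x → P x → x ≤ b) → s ≤ b)

  decTotalOrder : DecTotalOrder 0ℓ 0ℓ 0ℓ
  decTotalOrder = record { isDecTotalOrder = isDecTotalOrder }

  totalOrder : TotalOrder 0ℓ 0ℓ 0ℓ
  totalOrder = DecTotalOrder.totalOrder decTotalOrder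

  open NonStrictToStrict _≈_ _≤_ public using (_<_)

-- `mult u v` is the number of parallel edges joining u and v; for u = v it is
-- the number of self-loops at u.  So `mult` is the adjacency matrix, and a
-- self-loop contributes 1 to the degree.
record Multigraph (n : ℕ) : Set where
  field
    mult     : Fin n → Fin n → ℕ
    mult-sym : ∀ u v → mult u v ≡ mult v u

  private module Σℕ = RawMonoidDefs +-0-rawMonoid

  deg : Fin n → ℕ
  deg u = Σℕ.sum (mult u)

  -- 2|E|: an edge between distinct vertices is counted from both of its
  -- endpoints, a self-loop, being half an edge, only once.
  twice∣E∣ : ℕ
  twice∣E∣ = Σℕ.sum λ u → Σℕ.sum λ v → mult u v

  NoIsolatedVertices : Set
  NoIsolatedVertices = ∀ u → 0 ℕ.< deg u

-- The value of `sign` on pairs not joined by an edge is never used.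
record Signing {n : ℕ} (G : Multigraph n) : Set where
  open Multigraph G
  field
    sign     : Fin n → Fin n → Sign
    sign-sym : ∀ u v → 0 ℕ.< mult u v → sign u v ≡ sign v u

module OverReals (ℝ : CompleteOrderedField) where
  open CompleteOrderedField ℝ
  open CommutativeSemiring commutativeSemiring using (rawSemiring)
  open RawSemiringDefs rawSemiring public using (sum; _^_)

  infixl 7 _/_

  fromℕ : ℕ → Carrier
  fromℕ m = RawSemiringDefs._×_ rawSemiring m 1#

  _/_ : Carrier → Carrier → Carrier
  x / y = x * y ⁻¹

  -- m = ⌈x⌉, for those x whose ceiling is a natural number.
  IsCeiling : Carrier → ℕ → Set
  IsCeiling x m = x ≤ fromℕ m × fromℕ m < x + 1#

  -- s = x^(-1/2).
  IsInverseSqrt : Carrier → Carrier → Set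
  IsInverseSqrt x s = 0# < s × s * s * x ≈ 1#

  -- On the positive reals, log is the logarithm to some base b > 1: these are
  -- exactly the strictly increasing homomorphisms from (ℝ>0, *) to (ℝ, +).
  record IsLogarithm (log : Carrier → Carrier) : Set where
    field
      log-cong : ∀ {x y} → 0# < x → x ≈ y → log x ≈ log y
      log-*    : ∀ {x y} → 0# < x → 0# < y → log (x * y) ≈ log x + log y
      log-mono : ∀ {x y} → 0# < x → x < y → log x < log y

  Matrix : ℕ → Set
  Matrix n = Fin n → Fin n → Carrier

  _·_ : ∀ {n} → Matrix n → (Fin n → Carrier) → (Fin n → Carrier)
  (M · f) u = sum λ v → M u v * f v

  -- a + bi is an eigenvalue of M acting on ℂⁿ, with eigenvector f + gi.
  IsEigenvalue : ∀ {n} → Matrix n → Carrier → Carrier → Set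
  IsEigenvalue {n} M a b = ∃₂ λ (f g : Fin n → Carrier) →
    (∃ λ v → ¬ (f v ≈ 0# × g v ≈ 0#)) ×
    (∀ u → (M · f) u ≈ a * f u - b * g u) ×
    (∀ u → (M · g) u ≈ b * f u + a * g u)

  -- ρ is the largest modulus of a complex eigenvalue of M.
  record IsSpectralRadius {n} (M : Matrix n) (ρ : Carrier) : Set where
    field
      nonneg   : 0# ≤ ρ
      bound    : ∀ a b → IsEigenvalue M a b → a * a + b * b ≤ ρ * ρ
      attained : ∃₂ λ a b → IsEigenvalue M a b × a * a + b * b ≈ ρ * ρ

  ⟦_⟧ : Sign → Carrier
  ⟦ Sign.+ ⟧ = 1#
  ⟦ Sign.- ⟧ = - 1#

  signEntry : ℕ → Sign → Carrier
  signEntry ℕ.zero    s = 0#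
  signEntry (ℕ.suc _) s = ⟦ s ⟧

  module _ {n} (G : Multigraph n) where
    open Multigraph G

    π : Fin n → Carrier
    π v = fromℕ (deg v) / fromℕ twice∣E∣

    K : Matrix n
    K u v = fromℕ (mult u v) / fromℕ (deg u)

    Ξ : Signing G → Matrix n
    Ξ ξ u v = signEntry (mult u v) (Signing.sign ξ u v)

    K̄ : Signing G → Matrix n
    K̄ ξ u v = Ξ ξ u v * K u v

  π⋆ : ∀ {n} → Multigraph (ℕ.suc n) → Carrier
  π⋆ {n} G = Extrema.min totalOrder (π G Fin.zero) (List.map (π G) (List.allFin (ℕ.suc n)))

  -- ℝ[X₀, …, Xₙ₋₁], presented as the free commutative ℝ-algebra on Fin n:
  -- expressions modulo the congruence generated by the algebra laws.
  infixl 6 _⊕_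
  infixl 7 _⊗_
  infix  4 _≋_

  data Poly (n : ℕ) : Set where
    con     : Carrier → Poly n
    X       : Fin n → Poly n
    _⊕_ _⊗_ : Poly n → Poly n → Poly n

  data _≋_ {n} : Poly n → Poly n → Set where
    ≋-refl  : ∀ {p} → p ≋ p
    ≋-sym   : ∀ {p q} → p ≋ q → q ≋ p
    ≋-trans : ∀ {p q r} → p ≋ q → q ≋ r → p ≋ r

    con-cong : ∀ {a b} → a ≈ b → con a ≋ con b
    con-+    : ∀ a b → con (a + b) ≋ con a ⊕ con b
    con-*    : ∀ a b → con (a * b) ≋ con a ⊗ con b

    ⊕-cong      : ∀ {p p′ q q′} → p ≋ p′ → q ≋ q′ → p ⊕ q ≋ p′ ⊕ q′
    ⊕-assoc     : ∀ p q r → (p ⊕ q) ⊕ r ≋ p ⊕ (q ⊕ r)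
    ⊕-comm      : ∀ p q → p ⊕ q ≋ q ⊕ p
    ⊕-identityˡ : ∀ p → con 0# ⊕ p ≋ p

    ⊗-cong      : ∀ {p p′ q q′} → p ≋ p′ → q ≋ q′ → p ⊗ q ≋ p′ ⊗ q′
    ⊗-assoc     : ∀ p q r → (p ⊗ q) ⊗ r ≋ p ⊗ (q ⊗ r)
    ⊗-comm      : ∀ p q → p ⊗ q ≋ q ⊗ p
    ⊗-identityˡ : ∀ p → con 1# ⊗ p ≋ p
    ⊗-zeroˡ     : ∀ p → con 0# ⊗ p ≋ con 0#

    ⊗-distribʳ-⊕ : ∀ p q r → (q ⊕ r) ⊗ p ≋ (q ⊗ p) ⊕ (r ⊗ p)

  ⊝_ : ∀ {n} → Poly n → Poly n
  ⊝ p = con (- 1#) ⊗ p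

  polyIsCommutativeRing : ∀ n →
    IsCommutativeRing (_≋_ {n}) _⊕_ _⊗_ ⊝_ (con 0#) (con 1#)
  polyIsCommutativeRing n = record
    { isRing = record
      { +-isAbelianGroup = record
        { isGroup = record
          { isMonoid = record
            { isSemigroup = record
              { isMagma = record
                { isEquivalence = ≋-isEquivalence ; ∙-cong = ⊕-cong }
              ; assoc = ⊕-assoc
              }
            ; identity = ⊕-identityˡ , λ p → ≋-trans (⊕-comm p _) (⊕-identityˡ p)
            }
          ; inverse = inverseˡ , λ p → ≋-trans (⊕-comm p _) (inverseˡ p)
          ; ⁻¹-cong = ⊗-cong ≋-refl
          }
        ; comm = ⊕-comm
        }
      ; *-cong     = ⊗-cong
      ; *-assoc    = ⊗-assoc
      ; *-identity = ⊗-identityˡ , λ p → ≋-trans (⊗-comm p _) (⊗-identityˡ p)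
      ; distrib    = distribˡ′ , ⊗-distribʳ-⊕
      }
    ; *-comm = ⊗-comm
    }
    where
    ≋-isEquivalence : IsEquivalence (_≋_ {n})
    ≋-isEquivalence = record { refl = ≋-refl ; sym = ≋-sym ; trans = ≋-trans }

    inverseˡ : ∀ p → ⊝ p ⊕ p ≋ con 0#
    inverseˡ p =
      ≋-trans (⊕-cong ≋-refl (≋-sym (⊗-identityˡ p)))
      (≋-trans (≋-sym (⊗-distribʳ-⊕ p _ _))
      (≋-trans (⊗-cong (≋-trans (≋-sym (con-+ _ _)) (con-cong (-‿inverseˡ 1#))) ≋-refl)
      (⊗-zeroˡ p)))

    distribˡ′ : ∀ p q r → p ⊗ (q ⊕ r) ≋ (p ⊗ q) ⊕ (p ⊗ r)
    distribˡ′ p q r = ≋-trans (⊗-comm p _) (≋-trans (⊗-distribʳ-⊕ p q r)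
      (⊕-cong (⊗-comm q p) (⊗-comm r p)))

  polyCommutativeRing : ℕ → CommutativeRing 0ℓ 0ℓ
  polyCommutativeRing n = record { isCommutativeRing = polyIsCommutativeRing n }

  sumPoly : ∀ {n m} → (Fin m → Poly n) → Poly n
  sumPoly {n} = RawMonoidDefs.sum (CommutativeRing.+-rawMonoid (polyCommutativeRing n))

  infixl 6 _⊖_
  _⊖_ : ∀ {n} → Poly n → Poly n → Poly n
  p ⊖ q = p ⊕ ⊝ q

  -- Closure under ≋ makes the next two notions properties of the polynomial
  -- rather than of the expression: p is equal to some expression of formal
  -- degree at most d, respectively to one mentioning only indeterminates in S.
  data Degree≤ {n} : ℕ → Poly n → Set where
    con  : ∀ {d} a → Degree≤ d (con a)
    X    : ∀ {d} u → Degree≤ (ℕ.suc d) (X u)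
    _⊕_  : ∀ {d p q} → Degree≤ d p → Degree≤ d q → Degree≤ d (p ⊕ q)
    _⊗_  : ∀ {d e p q} → Degree≤ d p → Degree≤ e q → Degree≤ (d ℕ.+ e) (p ⊗ q)
    resp : ∀ {d p q} → p ≋ q → Degree≤ d p → Degree≤ d q

  data DependsOnlyOn {n} (S : Subset n) : Poly n → Set where
    con  : ∀ a → DependsOnlyOn S (con a)
    X    : ∀ {u} → u ∈ S → DependsOnlyOn S (X u)
    _⊕_  : ∀ {p q} → DependsOnlyOn S p → DependsOnlyOn S q → DependsOnlyOn S (p ⊕ q)
    _⊗_  : ∀ {p q} → DependsOnlyOn S p → DependsOnlyOn S q → DependsOnlyOn S (p ⊗ q)
    resp : ∀ {p q} → p ≋ q → DependsOnlyOn S p → DependsOnlyOn S q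

  DependsOnAtMost : ∀ {n} → ℕ → Poly n → Set
  DependsOnAtMost R p = ∃ λ S → ∣ S ∣ ℕ.≤ R × DependsOnlyOn S p

  -- A polynomial p stands for the line p ≥ 0, and a line p ≤ 0 is (⊝ p) ≥ 0.
  data LocalSOS₂ {n} (R : ℕ) : Poly n → Set where
    square : ∀ p → Degree≤ 1 p → DependsOnAtMost R p → LocalSOS₂ R (p ⊗ p)

  data SheraliAdams {n} (R : ℕ) : Poly n → Set where
    square : ∀ p → DependsOnAtMost R p → SheraliAdams R (p ⊗ p)
    bool≥0 : ∀ u s → let q = (X u ⊗ X u ⊖ con 1#) ⊗ s in
             DependsOnAtMost R q → SheraliAdams R q
    bool≤0 : ∀ u s → let q = (X u ⊗ X u ⊖ con 1#) ⊗ s in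
             DependsOnAtMost R q → SheraliAdams R (⊝ q)

  data Derivable {n} (Axiom : Poly n → Set) : Poly n → Set where
    axiom       : ∀ {p} → Axiom p → Derivable Axiom p
    combination : ∀ {p} m (c : Fin m → Carrier) (q : Fin m → Poly n) →
                  (∀ i → 0# ≤ c i) → (∀ i → Derivable Axiom (q i)) →
                  p ≋ sumPoly (λ i → con (c i) ⊗ q i) → Derivable Axiom p

  infix 3 _⊢_≼_
  _⊢_≼_ : ∀ {n} → (Poly n → Set) → Poly n → Poly n → Set
  Axiom ⊢ p ≼ q = Derivable Axiom (q ⊖ p)

  module _ {n} (G : Multigraph n) where

    ⟨X,_X⟩π : Matrix n → Poly n
    ⟨X, M X⟩π = sumPoly λ u → sumPoly λ v → con (π G u * M u v) ⊗ (X u ⊗ X v)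

    ⟨X,X⟩π : Poly n
    ⟨X,X⟩π = sumPoly λ u → con (π G u) ⊗ (X u ⊗ X u)

    OBJ : Signing G → Poly n
    OBJ ξ = con (1# / fromℕ 2) ⊕ con (1# / fromℕ 2) ⊗ ⟨X, K̄ G ξ X⟩π

{-# OPTIONS --safe #-}

-- Quadratic forms are handled as real matrices: T i is the form ⟨X, K̄ⁱ X⟩π, and
-- the forms with a derivation make up a convex cone containing the square of
-- every linear form in at most R indeterminates.
--
-- From a vertex r drawn from π run k independent walks of length i and k of
-- length j. The expected square of c X r + a ∑ ± X vₛ + b ∑ ± X wₜ, over the signed
-- ends vₛ, wₜ of these walks, lies in the cone; the products of distinct samples
-- contribute T i, T j, T (2i), T (2j), T (i + j), and the diagonal contributes
-- only O(1/k) · T 0. So, up to errors of order 1/k, the sequence T 0, T 2, …, T 2ℓ,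
-- rescaled by powers of ε, is convex, and T 1 lies below the mean of T 0 and T 2.
-- The last term is small: by the spectral bound, the rows of K̄^2ℓ have ℓ¹ norm at
-- most ρ^2ℓ π⋆^-½ ≤ ε^(2ℓ+1), which two-variable squares turn into a derivation.
-- Descending the convex sequence from there bounds T 2, hence T 1. If ε ≥ 2/5 the
-- claim already follows from ± T 1 ≼ T 0.
module Submission where

-- The obstacle is locality. Inequalities such as `T (2i)` ≥ 0 hold because `T (2i)` is the mean
-- over r of the square of `(Q^i X) r`, a linear form that may involve every indeterminate.
-- Replacing it by k samples makes it local and costs a diagonal error. This dictates k. With x =
-- ε², the convexity inequality at i has to be divided by x^(i+2), which amplifies its error of
-- order 1/k to order x^(-ℓ)/k in the worst case; k near ε^(-2ℓ) keeps that bounded. The constant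
-- 5/2 comes from 2 ε T 1 ≼ ε² T 0 + T 2 together with a bound on T 2 by about 4 ε² T 0: one ε² from
-- the start of the sequence, three from the accumulated errors. That gives 1 + 1 + 3 = 5, halved by
-- the 2 on the left. The choice of ℓ says (ρ/ε)^(4ℓ) ≤ ε² π⋆. The exponent is 4ℓ because the
-- spectral estimate concerns squares of entries of the 2ℓ-th power. No diagonalisation takes place:
-- ρ enters only through the extremal Rayleigh quotients of ± T 1, which completeness and Gaussian
-- elimination show to be eigenvalues.

open import Defs
open import Data.Nat as ℕ using (ℕ; zero; suc)
open import Data.Product using (_×_; _,_; ∃; proj₁; proj₂)
open import Algebra.Bundles using (CommutativeRing)
import Algebra.Definitions.RawMonoid as RawMonoidDefs
import Algebra.Properties.AbelianGroup as AbelianGroupProperties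
import Algebra.Properties.Ring as RingProperties
import Algebra.Properties.Semiring.Mult as Mult
import Algebra.Properties.Semiring.Mult.TCOptimised as MultOpt
import Algebra.Properties.Semiring.Sum as SemiringSum
import Algebra.Solver.Ring
open import Algebra.Solver.Ring.AlmostCommutativeRing
  using (_-Raw-AlmostCommutative⟶_; fromCommutativeRing)
open import Data.Empty using (⊥; ⊥-elim)
open import Data.Fin using (Fin; zero; suc)
open import Data.Fin.Subset as Subset using (Subset; ∣_∣; _∉_; _∪_; ⁅_⁆)
import Data.Fin.Subset.Properties as Subset
open import Data.Integer as ℤ using (ℤ; +_; -[1+_]; +0)
import Data.Integer.Properties as ℤ
import Data.List as List
import Data.List.Extrema as Extrema
open import Data.List.Membership.Propositional.Properties using (∈-map⁺; ∈-allFin)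
import Data.List.Relation.Unary.All as All
open import Data.Maybe using (Maybe; just; nothing)
open import Data.Nat.Base using (+-0-rawMonoid)
import Data.Nat.Properties as ℕ
open import Data.Sign as Sign using (Sign)
open import Data.Sum using (_⊎_; inj₁; inj₂)
open import Data.Vec using ([]; _∷_)
open import Function using (_∘_)
open import Level using (0ℓ)
open import Relation.Binary.Bundles using (DecTotalOrder)
open import Relation.Binary.PropositionalEquality as ≡ using (_≡_)
open import Relation.Nullary using (¬_; yes; no; contradiction)

-- The ring solver with integer coefficients: coefficients taken in the ring
-- itself could not be compared, and so would never cancel.
module RingSolver (R : CommutativeRing 0ℓ 0ℓ) where
  open CommutativeRing R
  open RingProperties ring
  open AbelianGroupProperties +-abelianGroup using (⁻¹-∙-comm; ⁻¹-involutive)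
  open MultOpt semiring using (×-homo-+; ×1-homo-*) renaming (_×_ to _·_)
  open import Relation.Binary.Reasoning.Setoid setoid

  private
    ⟪_⟫ : ℤ → Carrier
    ⟪ + n ⟫      = n · 1#
    ⟪ -[1+ n ] ⟫ = - (suc n · 1#)

    ⟪_⟫ₛ : Sign → Carrier
    ⟪ Sign.+ ⟫ₛ = 1#
    ⟪ Sign.- ⟫ₛ = - 1#

    -0≈0 : - 0# ≈ 0#
    -0≈0 = trans (sym (+-identityˡ _)) (-‿inverseʳ 0#)

    neg-homo : ∀ i → ⟪ ℤ.- i ⟫ ≈ - ⟪ i ⟫
    neg-homo (+ zero)   = sym -0≈0
    neg-homo (+ suc n)  = refl
    neg-homo (-[1+ n ]) = sym (⁻¹-involutive _)

    ⊖-homo : ∀ m n → ⟪ m ℤ.⊖ n ⟫ ≈ m · 1# + - (n · 1#)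
    ⊖-homo m       zero    = sym (trans (+-congˡ -0≈0) (+-identityʳ _))
    ⊖-homo zero    (suc n) = sym (+-identityˡ _)
    ⊖-homo (suc m) (suc n) = begin
      ⟪ suc m ℤ.⊖ suc n ⟫                    ≡⟨ ≡.cong ⟪_⟫ (ℤ.[1+m]⊖[1+n]≡m⊖n m n) ⟩
      ⟪ m ℤ.⊖ n ⟫                            ≈⟨ ⊖-homo m n ⟩
      m · 1# + - (n · 1#)                    ≈⟨ +-congʳ (trans (+-congʳ (-‿inverseʳ 1#)) (+-identityˡ _)) ⟨
      (1# + - 1# + m · 1#) + - (n · 1#)      ≈⟨ +-congʳ (+-assoc _ _ _) ⟩
      (1# + (- 1# + m · 1#)) + - (n · 1#)    ≈⟨ +-congʳ (+-congˡ (+-comm _ _)) ⟩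
      (1# + (m · 1# + - 1#)) + - (n · 1#)    ≈⟨ +-congʳ (+-assoc _ _ _) ⟨
      (1# + m · 1# + - 1#) + - (n · 1#)      ≈⟨ +-assoc _ _ _ ⟩
      (1# + m · 1#) + (- 1# + - (n · 1#))    ≈⟨ +-cong (×-homo-+ 1# 1 m) (sym (⁻¹-∙-comm _ _)) ⟨
      suc m · 1# + - (1# + n · 1#)           ≈⟨ +-congˡ (-‿cong (×-homo-+ 1# 1 n)) ⟨
      suc m · 1# + - (suc n · 1#)            ∎

    +-homo : ∀ i j → ⟪ i ℤ.+ j ⟫ ≈ ⟪ i ⟫ + ⟪ j ⟫
    +-homo (+ m)      (+ n)      = ×-homo-+ 1# m n
    +-homo (+ m)      (-[1+ n ]) = ⊖-homo m (suc n)
    +-homo (-[1+ m ]) (+ n)      = trans (⊖-homo n (suc m)) (+-comm _ _)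
    +-homo (-[1+ m ]) (-[1+ n ]) = begin
      - (suc (suc (m ℕ.+ n)) · 1#)      ≡⟨ ≡.cong (λ k → - (suc k · 1#)) (≡.sym (ℕ.+-suc m n)) ⟩
      - ((suc m ℕ.+ suc n) · 1#)        ≈⟨ -‿cong (×-homo-+ 1# (suc m) (suc n)) ⟩
      - (suc m · 1# + suc n · 1#)       ≈⟨ ⁻¹-∙-comm _ _ ⟨
      - (suc m · 1#) + - (suc n · 1#)   ∎

    ◃-homo : ∀ s n → ⟪ s ℤ.◃ n ⟫ ≈ ⟪ s ⟫ₛ * (n · 1#)
    ◃-homo s      zero    = sym (zeroʳ _)
    ◃-homo Sign.+ (suc n) = sym (*-identityˡ _)
    ◃-homo Sign.- (suc n) = sym (-1*x≈-x _)

    sign-homo : ∀ s t → ⟪ s Sign.* t ⟫ₛ ≈ ⟪ s ⟫ₛ * ⟪ t ⟫ₛ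
    sign-homo Sign.+ t      = sym (*-identityˡ _)
    sign-homo Sign.- Sign.+ = sym (*-identityʳ _)
    sign-homo Sign.- Sign.- = sym (trans (-1*x≈-x _) (⁻¹-involutive 1#))

    sign-abs : ∀ i → ⟪ ℤ.sign i ⟫ₛ * (ℤ.∣ i ∣ · 1#) ≈ ⟪ i ⟫
    sign-abs (+ n)      = *-identityˡ _
    sign-abs (-[1+ n ]) = -1*x≈-x _

    -- Integer multiplication is defined through signs and absolute values, so each of the two is
    -- treated separately and then recombined.
    *-homo : ∀ i j → ⟪ i ℤ.* j ⟫ ≈ ⟪ i ⟫ * ⟪ j ⟫
    *-homo i j = begin
      ⟪ i ℤ.* j ⟫                             ≈⟨ ◃-homo (ℤ.sign i Sign.* ℤ.sign j) (ℤ.∣ i ∣ ℕ.* ℤ.∣ j ∣) ⟩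
      ⟪ ℤ.sign i Sign.* ℤ.sign j ⟫ₛ * ((ℤ.∣ i ∣ ℕ.* ℤ.∣ j ∣) · 1#)
        ≈⟨ *-cong (sign-homo (ℤ.sign i) (ℤ.sign j)) (×1-homo-* ℤ.∣ i ∣ ℤ.∣ j ∣) ⟩
      (s * t) * (a * b)                       ≈⟨ *-assoc s t _ ⟩
      s * (t * (a * b))                       ≈⟨ *-congˡ (*-assoc t a b) ⟨
      s * ((t * a) * b)                       ≈⟨ *-congˡ (*-congʳ (*-comm t a)) ⟩
      s * ((a * t) * b)                       ≈⟨ *-congˡ (*-assoc a t b) ⟩
      s * (a * (t * b))                       ≈⟨ *-assoc s a _ ⟨
      (s * a) * (t * b)                       ≈⟨ *-cong (sign-abs i) (sign-abs j) ⟩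
      ⟪ i ⟫ * ⟪ j ⟫                           ∎
      where
      s t a b : Carrier
      s = ⟪ ℤ.sign i ⟫ₛ
      t = ⟪ ℤ.sign j ⟫ₛ
      a = ℤ.∣ i ∣ · 1#
      b = ℤ.∣ j ∣ · 1#

    morphism : ℤ.+-*-rawRing -Raw-AlmostCommutative⟶ fromCommutativeRing R
    morphism = record
      { ⟦_⟧    = ⟪_⟫
      ; +-homo = +-homo
      ; *-homo = *-homo
      ; -‿homo = neg-homo
      ; 0-homo = refl
      ; 1-homo = refl
      }

    _≟′_ : ∀ i j → Maybe (⟪ i ⟫ ≈ ⟪ j ⟫)
    i ≟′ j with i ℤ.≟ j
    ... | yes ≡.refl = just refl
    ... | no  _      = nothing

  open Algebra.Solver.Ring ℤ.+-*-rawRing (fromCommutativeRing R) morphism _≟′_ public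
    using (Polynomial; solve; _:=_; _:+_; _:*_; _:-_; :-_)
    renaming (con to :con)

  :1 : ∀ {n} → Polynomial n
  :1 = :con (+ 1)

  :2 : ∀ {n} → Polynomial n
  :2 = :con (+ 2)

-- Arithmetic in an ordered field.

module OrderedField (ℝ : CompleteOrderedField) where
  open CompleteOrderedField ℝ public
    hiding (zero; decTotalOrder; totalOrder)
  open OverReals ℝ public
  open RingSolver commutativeRing public
  open DecTotalOrder (CompleteOrderedField.decTotalOrder ℝ) public
    using (_≤?_; _≟_)
    renaming (refl to ≤-refl; reflexive to ≤-reflexive; trans to ≤-trans;
              antisym to ≤-antisym; total to ≤-total; ≤-respˡ-≈ to ≤-respˡ; ≤-respʳ-≈ to ≤-respʳ)
  open RingProperties ring public using (-0#≈0#)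
  module ≈-Reasoning where
    open import Relation.Binary.Reasoning.Setoid setoid public

  ≤-diff : ∀ {x y d} → 0# ≤ d → d ≈ y - x → x ≤ y
  ≤-diff {x} {y} 0≤d d≈ = ≤-respˡ (+-identityʳ x)
    (≤-respʳ (solve 2 (λ x y → x :+ (y :- x) := y) refl x y) (+-monoʳ-≤ x (≤-respʳ d≈ 0≤d)))

  diff-nonneg : ∀ {x y} → x ≤ y → 0# ≤ y - x
  diff-nonneg {x} {y} x≤y = ≤-respˡ (-‿inverseˡ x) (≤-respʳ (+-comm (- x) y) (+-monoʳ-≤ (- x) x≤y))

  +-nonneg : ∀ {x y} → 0# ≤ x → 0# ≤ y → 0# ≤ x + y
  +-nonneg {x} 0≤x 0≤y = ≤-trans 0≤x (≤-respˡ (+-identityʳ x) (+-monoʳ-≤ x 0≤y))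

  neg-nonneg : ∀ {x} → x ≤ 0# → 0# ≤ - x
  neg-nonneg x≤0 = ≤-respʳ (+-identityˡ _) (diff-nonneg x≤0)

  square-nonneg : ∀ x → 0# ≤ x * x
  square-nonneg x with ≤-total 0# x
  ... | inj₁ 0≤x = *-nonneg 0≤x 0≤x
  ... | inj₂ x≤0 = ≤-respʳ (solve 1 (λ x → (:- x) :* (:- x) := x :* x) refl x)
                     (*-nonneg (neg-nonneg x≤0) (neg-nonneg x≤0))

  0≤1 : 0# ≤ 1#
  0≤1 = ≤-respʳ (*-identityˡ 1#) (square-nonneg 1#)

  *-monoʳ-≤ : ∀ {x y z} → 0# ≤ x → y ≤ z → x * y ≤ x * z
  *-monoʳ-≤ {x} {y} {z} 0≤x y≤z = ≤-diff (*-nonneg 0≤x (diff-nonneg y≤z))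
    (solve 3 (λ x y z → x :* (z :- y) := x :* z :- x :* y) refl x y z)

  *-monoˡ-≤ : ∀ {x y z} → 0# ≤ x → y ≤ z → y * x ≤ z * x
  *-monoˡ-≤ {x} {y} {z} 0≤x y≤z = ≤-respˡ (*-comm x y) (≤-respʳ (*-comm x z) (*-monoʳ-≤ 0≤x y≤z))

  ≰⇒> : ∀ {x y} → ¬ (x ≤ y) → y < x
  ≰⇒> {x} {y} x≰y with ≤-total x y
  ... | inj₁ x≤y = contradiction x≤y x≰y
  ... | inj₂ y≤x = y≤x , λ y≈x → x≰y (≤-reflexive (sym y≈x))

  <⇒≱ : ∀ {x y} → x < y → ¬ (y ≤ x)
  <⇒≱ (x≤y , x≉y) y≤x = x≉y (≤-antisym x≤y y≤x)

  <-≤-trans : ∀ {x y z} → x < y → y ≤ z → x < z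
  <-≤-trans (x≤y , x≉y) y≤z = ≤-trans x≤y y≤z , λ x≈z → x≉y (≤-antisym x≤y (≤-respʳ (sym x≈z) y≤z))

  ≤-<-trans : ∀ {x y z} → x ≤ y → y < z → x < z
  ≤-<-trans x≤y (y≤z , y≉z) = ≤-trans x≤y y≤z , λ x≈z → y≉z (≤-antisym y≤z (≤-respˡ x≈z x≤y))

  diff-pos : ∀ {x y} → x < y → 0# < y - x
  diff-pos {x} {y} (x≤y , x≉y) = diff-nonneg x≤y , λ 0≈y-x → x≉y
    (trans (sym (+-identityʳ x)) (trans (+-congˡ 0≈y-x)
      (solve 2 (λ x y → x :+ (y :- x) := y) refl x y)))

  0<1 : 0# < 1#
  0<1 = 0≤1 , λ 0≈1 → 1≉0 (sym 0≈1)

  *-cancelˡ-0 : ∀ {x y} → ¬ (x ≈ 0#) → x * y ≈ 0# → y ≈ 0#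
  *-cancelˡ-0 {x} {y} x≉0 xy≈0 = begin
    y                ≈⟨ *-identityˡ y ⟨
    1# * y           ≈⟨ *-congʳ (*-inverseʳ x≉0) ⟨
    (x * x ⁻¹) * y   ≈⟨ solve 3 (λ x i y → (x :* i) :* y := i :* (x :* y)) refl x (x ⁻¹) y ⟩
    x ⁻¹ * (x * y)   ≈⟨ *-congˡ xy≈0 ⟩
    x ⁻¹ * 0#        ≈⟨ zeroʳ _ ⟩
    0#               ∎
    where open ≈-Reasoning

  pos⇒≉0 : ∀ {x} → 0# < x → ¬ (x ≈ 0#)
  pos⇒≉0 (_ , 0≉x) x≈0 = 0≉x (sym x≈0)

  *-pos : ∀ {x y} → 0# < x → 0# < y → 0# < x * y
  *-pos 0<x 0<y = *-nonneg (proj₁ 0<x) (proj₁ 0<y) ,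
    λ 0≈xy → pos⇒≉0 0<y (*-cancelˡ-0 (pos⇒≉0 0<x) (sym 0≈xy))

  +-pos : ∀ {x y} → 0# < x → 0# ≤ y → 0# < x + y
  +-pos {x} {y} 0<x 0≤y = <-≤-trans 0<x (≤-diff 0≤y (solve 2 (λ x y → y := x :+ y :- x) refl x y))

  *-inversePos : ∀ {x} → 0# < x → x * x ⁻¹ ≈ 1#
  *-inversePos 0<x = *-inverseʳ (pos⇒≉0 0<x)

  ⁻¹-pos : ∀ {x} → 0# < x → 0# < x ⁻¹
  ⁻¹-pos {x} 0<x = ≰⇒> λ x⁻¹≤0 → <⇒≱ 0<1
    (≤-diff (*-nonneg (proj₁ 0<x) (neg-nonneg x⁻¹≤0))
      (trans (solve 2 (λ x i → x :* (:- i) := :con +0 :- x :* i) refl x (x ⁻¹))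
             (+-congˡ (-‿cong (*-inversePos 0<x)))))

  *-cancelˡ-nonneg : ∀ {x y} → 0# < x → 0# ≤ x * y → 0# ≤ y
  *-cancelˡ-nonneg {x} {y} 0<x 0≤xy = ≤-respʳ eq (*-nonneg (proj₁ (⁻¹-pos 0<x)) 0≤xy)
    where
    eq : x ⁻¹ * (x * y) ≈ y
    eq = trans (solve 3 (λ i x y → i :* (x :* y) := x :* i :* y) refl (x ⁻¹) x y)
               (trans (*-congʳ (*-inversePos 0<x)) (*-identityˡ y))

  *-cancelˡ-≤ : ∀ {x y z} → 0# < x → x * y ≤ x * z → y ≤ z
  *-cancelˡ-≤ {x} {y} {z} 0<x xy≤xz = ≤-diff
    (*-cancelˡ-nonneg 0<x (≤-respʳ (solve 3 (λ x y z → x :* z :- x :* y := x :* (z :- y)) refl x y z)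
      (diff-nonneg xy≤xz))) refl

  ^-nonneg : ∀ {x} n → 0# ≤ x → 0# ≤ x ^ n
  ^-nonneg zero    0≤x = 0≤1
  ^-nonneg (suc n) 0≤x = *-nonneg 0≤x (^-nonneg n 0≤x)

  ^-pos : ∀ {x} n → 0# < x → 0# < x ^ n
  ^-pos zero    0<x = 0<1
  ^-pos (suc n) 0<x = *-pos 0<x (^-pos n 0<x)

  ^-+ : ∀ x m n → x ^ (m ℕ.+ n) ≈ x ^ m * x ^ n
  ^-+ x zero    n = sym (*-identityˡ _)
  ^-+ x (suc m) n = trans (*-congˡ (^-+ x m n)) (sym (*-assoc x _ _))

  ^-congˡ : ∀ {x y} n → x ≈ y → x ^ n ≈ y ^ n
  ^-congˡ zero    x≈y = refl
  ^-congˡ (suc n) x≈y = *-cong x≈y (^-congˡ n x≈y)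

  *-^ : ∀ x y n → (x * y) ^ n ≈ x ^ n * y ^ n
  *-^ x y zero    = sym (*-identityˡ _)
  *-^ x y (suc n) = trans (*-congˡ (*-^ x y n))
    (solve 4 (λ x y a b → x :* y :* (a :* b) := x :* a :* (y :* b)) refl x y (x ^ n) (y ^ n))

  1^ : ∀ n → 1# ^ n ≈ 1#
  1^ zero    = refl
  1^ (suc n) = trans (*-identityˡ _) (1^ n)

  ^-double : ∀ x n → x ^ (2 ℕ.* n) ≈ (x * x) ^ n
  ^-double x n = trans (reflexive (≡.cong (λ m → x ^ (n ℕ.+ m)) (ℕ.+-identityʳ n)))
    (trans (^-+ x n n) (sym (*-^ x x n)))

  fromℕ-nonneg : ∀ m → 0# ≤ fromℕ m
  fromℕ-nonneg zero    = ≤-refl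
  fromℕ-nonneg (suc m) = +-nonneg 0≤1 (fromℕ-nonneg m)

  fromℕ-pos : ∀ m → 0# < fromℕ (suc m)
  fromℕ-pos m = +-pos 0<1 (fromℕ-nonneg m)

  fromℕ-+ : ∀ m n → fromℕ (m ℕ.+ n) ≈ fromℕ m + fromℕ n
  fromℕ-+ m n = Mult.×-homo-+ semiring 1# m n

  fromℕ-cong : ∀ {m n} → m ≡ n → fromℕ m ≈ fromℕ n
  fromℕ-cong = λ { ≡.refl → refl }

  module Sum where
    open import Algebra.Properties.Semiring.Sum semiring public
      using (sum-replicate-zero; ∑-distrib-+; ∑-comm; *-distribˡ-sum; *-distribʳ-sum)
      renaming (sum-cong-≋ to sum-cong)
  open Sum public

-- Finite sums, Kronecker deltas and quadratic forms.

module FiniteSums (ℝ : CompleteOrderedField) where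
  open OrderedField ℝ

  sum-nonneg : ∀ {m} {f : Fin m → Carrier} → (∀ i → 0# ≤ f i) → 0# ≤ sum f
  sum-nonneg {zero}  0≤f = ≤-refl
  sum-nonneg {suc m} 0≤f = +-nonneg (0≤f zero) (sum-nonneg (0≤f ∘ suc))

  sum-linear : ∀ {m} a b (f g : Fin m → Carrier) →
               sum (λ i → a * f i + b * g i) ≈ a * sum f + b * sum g
  sum-linear a b f g = trans (∑-distrib-+ (λ i → a * f i) (λ i → b * g i))
    (+-cong (sym (*-distribˡ-sum a f)) (sym (*-distribˡ-sum b g)))

  sum-0 : ∀ {m} {f : Fin m → Carrier} → (∀ i → f i ≈ 0#) → sum f ≈ 0#
  sum-0 {m} f≈0 = trans (sum-cong f≈0) (sum-replicate-zero m)

  sum-diff : ∀ {m} (f g : Fin m → Carrier) → sum (λ i → f i - g i) ≈ sum f - sum g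
  sum-diff f g = begin
    sum (λ i → f i - g i)               ≈⟨ sum-cong (λ i → solve 2 (λ x y → x :- y := :1 :* x :+ (:- :1) :* y) refl (f i) (g i)) ⟩
    sum (λ i → 1# * f i + (- 1#) * g i) ≈⟨ sum-linear 1# (- 1#) f g ⟩
    1# * sum f + (- 1#) * sum g         ≈⟨ solve 2 (λ x y → :1 :* x :+ (:- :1) :* y := x :- y) refl (sum f) (sum g) ⟩
    sum f - sum g                       ∎
    where open ≈-Reasoning

  sum-mono : ∀ {m} {f g : Fin m → Carrier} → (∀ i → f i ≤ g i) → sum f ≤ sum g
  sum-mono {f = f} {g} f≤g = ≤-diff (sum-nonneg (λ i → diff-nonneg (f≤g i))) (sum-diff g f)

  term≤sum : ∀ {m} {f : Fin m → Carrier} → (∀ i → 0# ≤ f i) → ∀ i → f i ≤ sum f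
  term≤sum {suc m} {f} 0≤f zero    = ≤-diff (sum-nonneg (0≤f ∘ suc))
    (solve 2 (λ x y → y := x :+ y :- x) refl (f zero) (sum (f ∘ suc)))
  term≤sum {suc m} {f} 0≤f (suc i) = ≤-trans (term≤sum (0≤f ∘ suc) i) (≤-diff (0≤f zero)
    (solve 2 (λ x y → x := x :+ y :- y) refl (f zero) (sum (f ∘ suc))))

  -- Defined by recursion, not by deciding equality, so that it reduces in step with `sum`.
  δ : ∀ {m} → Fin m → Fin m → Carrier
  δ zero    zero    = 1#
  δ zero    (suc v) = 0#
  δ (suc u) zero    = 0#
  δ (suc u) (suc v) = δ u v

  δ-sym : ∀ {m} (u v : Fin m) → δ u v ≈ δ v u
  δ-sym zero    zero    = refl
  δ-sym zero    (suc v) = refl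
  δ-sym (suc u) zero    = refl
  δ-sym (suc u) (suc v) = δ-sym u v

  δ-refl : ∀ {m} (u : Fin m) → δ u u ≈ 1#
  δ-refl zero    = refl
  δ-refl (suc u) = δ-refl u

  δ-≢ : ∀ {m} {u v : Fin m} → ¬ (u ≡ v) → δ u v ≈ 0#
  δ-≢ {u = zero}  {zero}  u≢v = contradiction ≡.refl u≢v
  δ-≢ {u = zero}  {suc v} u≢v = refl
  δ-≢ {u = suc u} {zero}  u≢v = refl
  δ-≢ {u = suc u} {suc v} u≢v = δ-≢ (u≢v ∘ ≡.cong suc)

  sum-δ : ∀ {m} (u : Fin m) (f : Fin m → Carrier) → sum (λ v → δ u v * f v) ≈ f u
  sum-δ zero    f = trans (+-cong (*-identityˡ _) (sum-0 {f = λ v → 0# * f (suc v)} (λ v → zeroˡ (f (suc v))))) (+-identityʳ _)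
  sum-δ (suc u) f = trans (+-cong (zeroˡ _) (sum-δ u (f ∘ suc))) (+-identityˡ _)

  sum-δˡ : ∀ {m} (u : Fin m) (f : Fin m → Carrier) → sum (λ v → δ v u * f v) ≈ f u
  sum-δˡ u f = trans (sum-cong (λ v → *-congʳ (δ-sym v u))) (sum-δ u f)

  δ-subst : ∀ {m} (u v : Fin m) (f : Fin m → Carrier) → δ u v * f v ≈ δ u v * f u
  δ-subst zero    zero    f = refl
  δ-subst zero    (suc v) f = trans (zeroˡ _) (sym (zeroˡ _))
  δ-subst (suc u) zero    f = trans (zeroˡ _) (sym (zeroˡ _))
  δ-subst (suc u) (suc v) f = δ-subst u v (f ∘ suc)

  infix 8 ⟨_,_⟩
  ⟨_,_⟩ : ∀ {m} → (Fin m → Carrier) → (Fin m → Carrier) → Carrier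
  ⟨ f , g ⟩ = sum λ u → f u * g u

  ⟨⟩-cong : ∀ {m} {f f′ g g′ : Fin m → Carrier} → (∀ u → f u ≈ f′ u) → (∀ u → g u ≈ g′ u) →
            ⟨ f , g ⟩ ≈ ⟨ f′ , g′ ⟩
  ⟨⟩-cong f≈ g≈ = sum-cong (λ u → *-cong (f≈ u) (g≈ u))

  ⟨⟩-comm : ∀ {m} (f g : Fin m → Carrier) → ⟨ f , g ⟩ ≈ ⟨ g , f ⟩
  ⟨⟩-comm f g = sum-cong (λ u → *-comm (f u) (g u))

  ⟨⟩-linearʳ : ∀ {m} a b (h f g : Fin m → Carrier) →
               ⟨ h , (λ u → a * f u + b * g u) ⟩ ≈ a * ⟨ h , f ⟩ + b * ⟨ h , g ⟩
  ⟨⟩-linearʳ a b h f g = trans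
    (sum-cong (λ u → solve 5 (λ a b h f g → h :* (a :* f :+ b :* g) := a :* (h :* f) :+ b :* (h :* g)) refl a b (h u) (f u) (g u)))
    (sum-linear a b (λ u → h u * f u) (λ u → h u * g u))

  ⟨⟩-linearˡ : ∀ {m} a b (f g h : Fin m → Carrier) →
               ⟨ (λ u → a * f u + b * g u) , h ⟩ ≈ a * ⟨ f , h ⟩ + b * ⟨ g , h ⟩
  ⟨⟩-linearˡ a b f g h = trans (⟨⟩-comm _ h) (trans (⟨⟩-linearʳ a b h f g)
    (+-cong (*-congˡ (⟨⟩-comm h f)) (*-congˡ (⟨⟩-comm h g))))

  ⟨⟩-nonneg : ∀ {m} (f : Fin m → Carrier) → 0# ≤ ⟨ f , f ⟩
  ⟨⟩-nonneg f = sum-nonneg (λ u → square-nonneg (f u))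

  square-zero : ∀ {x} → x * x ≤ 0# → x ≈ 0#
  square-zero {x} xx≤0 with x ≟ 0#
  ... | yes x≈0 = x≈0
  ... | no  x≉0 = *-cancelˡ-0 x≉0 (≤-antisym xx≤0 (square-nonneg x))

  ⟨⟩-zero : ∀ {m} (f : Fin m → Carrier) → ⟨ f , f ⟩ ≤ 0# → ∀ u → f u ≈ 0#
  ⟨⟩-zero f ff≤0 u = square-zero (≤-trans (term≤sum (λ v → square-nonneg (f v)) u) ff≤0)

  quad : ∀ {m} → Matrix m → (Fin m → Carrier) → Carrier
  quad A f = ⟨ f , A · f ⟩

  ·-linear : ∀ {m} (A : Matrix m) a b f g u →
             (A · (λ v → a * f v + b * g v)) u ≈ a * (A · f) u + b * (A · g) u
  ·-linear A a b f g u = ⟨⟩-linearʳ a b (A u) f g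

  Symmetric : ∀ {m} → Matrix m → Set
  Symmetric A = ∀ u v → A u v ≈ A v u

  ⟨⟩-selfAdjoint : ∀ {m} {A : Matrix m} → Symmetric A → ∀ f g → ⟨ f , A · g ⟩ ≈ ⟨ g , A · f ⟩
  ⟨⟩-selfAdjoint {A = A} A-sym f g = begin
    sum (λ u → f u * sum (λ v → A u v * g v))     ≈⟨ sum-cong (λ u → *-distribˡ-sum (f u) (λ v → A u v * g v)) ⟩
    sum (λ u → sum (λ v → f u * (A u v * g v)))   ≈⟨ ∑-comm (λ u v → f u * (A u v * g v)) ⟩
    sum (λ v → sum (λ u → f u * (A u v * g v)))   ≈⟨ sum-cong (λ v → sum-cong (λ u → step u v)) ⟩
    sum (λ v → sum (λ u → g v * (A v u * f u)))   ≈⟨ sum-cong (λ v → *-distribˡ-sum (g v) (λ u → A v u * f u)) ⟨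
    sum (λ v → g v * sum (λ u → A v u * f u))     ∎
    where
    open ≈-Reasoning
    step : ∀ u v → f u * (A u v * g v) ≈ g v * (A v u * f u)
    step u v = trans (*-congˡ (*-congʳ (A-sym u v)))
      (solve 3 (λ f a g → f :* (a :* g) := g :* (a :* f)) refl (f u) (A v u) (g v))

  quad-linear : ∀ {m} {A : Matrix m} → Symmetric A → ∀ a b f g →
                quad A (λ u → a * f u + b * g u) ≈
                a * a * quad A f + (1# + 1#) * (a * b) * ⟨ g , A · f ⟩ + b * b * quad A g
  quad-linear {A = A} A-sym a b f g = begin
    quad A (λ u → a * f u + b * g u)
      ≈⟨ ⟨⟩-cong {f = λ u → a * f u + b * g u} (λ u → refl) (·-linear A a b f g) ⟩
    ⟨ (λ u → a * f u + b * g u) , (λ u → a * (A · f) u + b * (A · g) u) ⟩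
      ≈⟨ ⟨⟩-linearˡ a b f g _ ⟩
    a * ⟨ f , (λ u → a * (A · f) u + b * (A · g) u) ⟩ + b * ⟨ g , (λ u → a * (A · f) u + b * (A · g) u) ⟩
      ≈⟨ +-cong (*-congˡ (⟨⟩-linearʳ a b f (A · f) (A · g))) (*-congˡ (⟨⟩-linearʳ a b g (A · f) (A · g))) ⟩
    a * (a * quad A f + b * ⟨ f , A · g ⟩) + b * (a * ⟨ g , A · f ⟩ + b * quad A g)
      ≈⟨ +-congʳ (*-congˡ (+-congˡ (*-congˡ (⟨⟩-selfAdjoint A-sym f g)))) ⟩
    a * (a * quad A f + b * ⟨ g , A · f ⟩) + b * (a * ⟨ g , A · f ⟩ + b * quad A g)
      ≈⟨ solve 5 (λ a b p x q → a :* (a :* p :+ b :* x) :+ b :* (a :* x :+ b :* q) :=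
                                a :* a :* p :+ :2 :* (a :* b) :* x :+ b :* b :* q) refl
           a b (quad A f) ⟨ g , A · f ⟩ (quad A g) ⟩
    a * a * quad A f + (1# + 1#) * (a * b) * ⟨ g , A · f ⟩ + b * b * quad A g ∎
    where open ≈-Reasoning

-- Deciding positive definiteness of a symmetric matrix.

module SpectralBound (ℝ : CompleteOrderedField) where
  open OrderedField ℝ
  open FiniteSums ℝ

  Nonzero : ∀ {m} → (Fin m → Carrier) → Set
  Nonzero f = ∃ λ v → ¬ (f v ≈ 0#)

  -- Cauchy-Schwarz with an unspecified constant, which is all that elimination asks for: one
  -- coordinate is peeled off at a time by (p + s)² ≤ 2 p² + 2 s².
  ⟨⟩²-bound : ∀ {m} (b : Fin m → Carrier) →
              ∃ λ L → 0# ≤ L × (∀ y → ⟨ b , y ⟩ * ⟨ b , y ⟩ ≤ L * ⟨ y , y ⟩)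
  ⟨⟩²-bound {zero}  b = 0# , ≤-refl , λ y → ≤-reflexive (trans (zeroˡ _) (sym (zeroˡ _)))
  ⟨⟩²-bound {suc m} b with ⟨⟩²-bound (b ∘ suc)
  ... | L , 0≤L , bound = (1# + 1#) * (b zero * b zero) + (1# + 1#) * L ,
    +-nonneg (*-nonneg 0≤2 (square-nonneg _)) (*-nonneg 0≤2 0≤L) , λ y →
    let s = ⟨ b ∘ suc , y ∘ suc ⟩ ; q = ⟨ y ∘ suc , y ∘ suc ⟩ in
    ≤-diff (+-nonneg (+-nonneg (square-nonneg (b zero * y zero - s)) (*-nonneg 0≤2 (diff-nonneg (bound (y ∘ suc)))))
                     (*-nonneg 0≤2 (+-nonneg (*-nonneg (square-nonneg (b zero)) (⟨⟩-nonneg (y ∘ suc)))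
                                             (*-nonneg 0≤L (square-nonneg (y zero))))))
      (solve 5 (λ b y s q L →
        (b :* y :- s) :* (b :* y :- s) :+ :2 :* (L :* q :- s :* s) :+ :2 :* (b :* b :* q :+ L :* (y :* y)) :=
        (:2 :* (b :* b) :+ :2 :* L) :* (y :* y :+ q) :- (b :* y :+ s) :* (b :* y :+ s))
        refl (b zero) (y zero) s q L)
    where
    0≤2 : 0# ≤ 1# + 1#
    0≤2 = +-nonneg 0≤1 0≤1

  -- The positive alternative carries a uniform coercivity constant, the one that compactness of the
  -- unit sphere would supply. Uniformity in `f` is what later opens a gap below a supremum.
  Definite : ∀ {m} → Matrix m → Set
  Definite A = (∃ λ f → Nonzero f × quad A f ≤ 0#) ⊎
               (∃ λ c → 0# < c × (∀ f → ⟨ f , f ⟩ ≤ c * quad A f))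

  module Schur {m} (A : Matrix (suc m)) (A-sym : Symmetric A) (0<a : 0# < A zero zero) where
    a : Carrier
    a = A zero zero

    l : Fin m → Carrier
    l i = a ⁻¹ * A zero (suc i)

    A′ S : Matrix m
    A′ i j = A (suc i) (suc j)
    S i j = A′ i j - a * (l i * l j)

    S-sym : Symmetric S
    S-sym i j = +-cong (A-sym _ _) (-‿cong (*-congˡ (*-comm (l i) (l j))))

    al≈ : ∀ j → A zero (suc j) ≈ a * l j
    al≈ j = sym (trans (sym (*-assoc a _ _)) (trans (*-congʳ (*-inversePos 0<a)) (*-identityˡ _)))

    row : ∀ y → ⟨ (λ j → A zero (suc j)) , y ⟩ ≈ a * ⟨ l , y ⟩
    row y = trans (sum-cong (λ j → trans (*-congʳ (al≈ j)) (*-assoc a _ _))) (sym (*-distribˡ-sum a (λ j → l j * y j)))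

    quad-S : ∀ y → quad A′ y ≈ quad S y + a * (⟨ l , y ⟩ * ⟨ l , y ⟩)
    quad-S y = begin
      ⟨ y , A′ · y ⟩                                          ≈⟨ ⟨⟩-cong {f = y} (λ _ → refl) split ⟩
      ⟨ y , (λ i → 1# * (S · y) i + (a * ⟨ l , y ⟩) * l i) ⟩  ≈⟨ ⟨⟩-linearʳ 1# _ y (S · y) l ⟩
      1# * quad S y + (a * ⟨ l , y ⟩) * ⟨ y , l ⟩             ≈⟨ +-cong (*-identityˡ _) (*-congˡ (⟨⟩-comm y l)) ⟩
      quad S y + (a * ⟨ l , y ⟩) * ⟨ l , y ⟩                  ≈⟨ +-congˡ (*-assoc a _ _) ⟩
      quad S y + a * (⟨ l , y ⟩ * ⟨ l , y ⟩)                  ∎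
      where
      open ≈-Reasoning
      split : ∀ i → (A′ · y) i ≈ 1# * (S · y) i + (a * ⟨ l , y ⟩) * l i
      split i = begin
        sum (λ j → A′ i j * y j)                               ≈⟨ sum-cong (λ j → solve 5 (λ A a li lj y →
                                                                    A :* y := :1 :* ((A :- a :* (li :* lj)) :* y) :+ (a :* li) :* (lj :* y)) refl
                                                                    (A′ i j) a (l i) (l j) (y j)) ⟩
        sum (λ j → 1# * (S i j * y j) + (a * l i) * (l j * y j)) ≈⟨ sum-linear 1# (a * l i) (λ j → S i j * y j) (λ j → l j * y j) ⟩
        1# * (S · y) i + (a * l i) * ⟨ l , y ⟩                 ≈⟨ +-congˡ (solve 3 (λ a l s → a :* l :* s := a :* s :* l) refl a (l i) ⟨ l , y ⟩) ⟩
        1# * (S · y) i + (a * ⟨ l , y ⟩) * l i                 ∎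

    quad-split : ∀ f → let z = f zero + ⟨ l , f ∘ suc ⟩ in
                 quad A f ≈ a * (z * z) + quad S (f ∘ suc)
    quad-split f = begin
      x * (a * x + ⟨ (λ j → A zero (suc j)) , y ⟩) + ⟨ y , (λ i → A (suc i) zero * x + (A′ · y) i) ⟩
        ≈⟨ +-cong (*-congˡ (+-congˡ (row y)))
             (trans (⟨⟩-cong {f = y} (λ _ → refl) (λ i → +-cong (trans (*-congʳ (A-sym (suc i) zero)) (*-comm _ x)) (sym (*-identityˡ _))))
                    (⟨⟩-linearʳ x 1# y (λ j → A zero (suc j)) (A′ · y))) ⟩
      x * (a * x + a * λy) + (x * ⟨ y , (λ j → A zero (suc j)) ⟩ + 1# * quad A′ y)
        ≈⟨ +-congˡ (+-cong (*-congˡ (trans (⟨⟩-comm y _) (row y))) (trans (*-identityˡ _) (quad-S y))) ⟩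
      x * (a * x + a * λy) + (x * (a * λy) + (quad S y + a * (λy * λy)))
        ≈⟨ solve 4 (λ x a s q → x :* (a :* x :+ a :* s) :+ (x :* (a :* s) :+ (q :+ a :* (s :* s))) :=
                                a :* ((x :+ s) :* (x :+ s)) :+ q) refl x a λy (quad S y) ⟩
      a * ((x + λy) * (x + λy)) + quad S y ∎
      where
      open ≈-Reasoning
      x = f zero
      y = f ∘ suc
      λy = ⟨ l , y ⟩

  -- Symmetric Gaussian elimination: complete the square in the first variable.
  definite? : ∀ {m} (A : Matrix m) → Symmetric A → Definite A
  definite? {zero}  A A-sym = inj₂ (1# , 0<1 , λ f → ≤-reflexive (sym (zeroʳ 1#)))
  definite? {suc m} A A-sym with A zero zero ≤? 0#
  ... | yes a≤0 = inj₁ (δ zero , (zero , 1≉0) , ≤-respˡ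
    (sym (trans (sum-δ zero (A · δ zero)) (trans (sum-cong (λ v → *-comm (A zero v) (δ zero v))) (sum-δ zero (A zero))))) a≤0)
  ... | no a≰0 with definite? (Schur.S A A-sym (≰⇒> a≰0)) (Schur.S-sym A A-sym (≰⇒> a≰0))
  ...   | inj₁ (y , (v , yv≉0) , Sy≤0) = inj₁ (f , (suc v , yv≉0) , ≤-respˡ (sym eq) Sy≤0)
    where
    open Schur A A-sym (≰⇒> a≰0)
    f : Fin (suc m) → Carrier
    -- This choice makes the completed square vanish, so that only the Schur complement contributes.
    f zero    = - ⟨ l , y ⟩
    f (suc i) = y i
    eq : quad A f ≈ quad S y
    eq = trans (quad-split f) (solve 3 (λ a s q → a :* ((:- s :+ s) :* (:- s :+ s)) :+ q := q) refl a ⟨ l , y ⟩ (quad S y))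
  ...   | inj₂ (c , 0<c , bound) with ⟨⟩²-bound (Schur.l A A-sym (≰⇒> a≰0))
  ...     | L , 0≤L , boundₗ = inj₂ (c′ , +-pos (*-pos 0<2 (⁻¹-pos 0<a)) (*-nonneg 0≤2L+1 (proj₁ 0<c)) , λ f →
      let y = f ∘ suc ; s = ⟨ l , y ⟩ ; z = f zero + s ; q = quad S y ; yy = ⟨ y , y ⟩ in
      ≤-diff (+-nonneg (+-nonneg (+-nonneg
          (*-nonneg (proj₁ (*-pos 0<2 (⁻¹-pos 0<a))) (*-cancelˡ-nonneg 0<c (≤-trans (⟨⟩-nonneg y) (bound y))))
          (*-nonneg (*-nonneg 0≤2L+1 (proj₁ 0<c)) (*-nonneg (proj₁ 0<a) (square-nonneg z))))
          (+-nonneg (*-nonneg 0≤2L+1 (diff-nonneg (bound y))) (*-nonneg (proj₁ 0<2) (diff-nonneg (boundₗ y)))))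
          (square-nonneg (z + s)))
        (begin
          (1# + 1#) * a ⁻¹ * q + ((1# + 1#) * L + 1#) * c * (a * (z * z)) +
            (((1# + 1#) * L + 1#) * (c * q - yy) + (1# + 1#) * (L * yy - s * s)) + (z + s) * (z + s)
            ≈⟨ solve 8 (λ x s a i q L c yy → let z = x :+ s in
                 :2 :* i :* q :+ (:2 :* L :+ :1) :* c :* (a :* (z :* z)) :+
                   ((:2 :* L :+ :1) :* (c :* q :- yy) :+ :2 :* (L :* yy :- s :* s)) :+ (z :+ s) :* (z :+ s)
                 := (:2 :* i :+ (:2 :* L :+ :1) :* c) :* (a :* (z :* z) :+ q) :- (x :* x :+ yy)
                    :+ (:2 :* (z :* z)) :* (:1 :- a :* i)) refl
                 (f zero) s a (a ⁻¹) q L c yy ⟩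
          c′ * (a * (z * z) + q) - ⟨ f , f ⟩ + ((1# + 1#) * (z * z)) * (1# - a * a ⁻¹)
            ≈⟨ +-congˡ (trans (*-congˡ (trans (+-congˡ (-‿cong (*-inversePos 0<a))) (-‿inverseʳ 1#))) (zeroʳ _)) ⟩
          c′ * (a * (z * z) + q) - ⟨ f , f ⟩ + 0#
            ≈⟨ +-identityʳ _ ⟩
          c′ * (a * (z * z) + q) - ⟨ f , f ⟩
            ≈⟨ +-congʳ (*-congˡ (quad-split f)) ⟨
          c′ * quad A f - ⟨ f , f ⟩ ∎))
    where
    open ≈-Reasoning
    0<a = ≰⇒> a≰0
    open Schur A A-sym 0<a
    0<2 : 0# < 1# + 1#
    0<2 = +-pos 0<1 0≤1
    0≤2L+1 : 0# ≤ (1# + 1#) * L + 1#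
    0≤2L+1 = +-nonneg (*-nonneg (proj₁ 0<2) 0≤L) 0≤1
    -- From x = z - s: x² + |y|² ≤ 2 z² + 2 s² + |y|² ≤ 2 z² + (2 L + 1) |y|². The first summand of
    -- `c′` pays for z² out of a z², the second for |y|² through the constant `c` of the Schur
    -- complement.
    c′ : Carrier
    c′ = (1# + 1#) * a ⁻¹ + ((1# + 1#) * L + 1#) * c

  -- As the form vanishes at `f`, along the line `g + t f` with `g = A · f` it is affine in t with
  -- slope 2 ⟨ g , g ⟩. A nonzero slope would make it negative somewhere.
  null-vector : ∀ {m} {A : Matrix m} → Symmetric A → (∀ f → 0# ≤ quad A f) →
                ∀ f → quad A f ≤ 0# → ∀ u → (A · f) u ≈ 0#
  null-vector {A = A} A-sym psd f Af≤0 = ⟨⟩-zero g h≤0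
    where
    g = A · f
    h = ⟨ g , g ⟩
    Q = quad A g
    Af≈0 : quad A f ≈ 0#
    Af≈0 = ≤-antisym Af≤0 (psd f)
    h≤0 : h ≤ 0#
    h≤0 with h ≤? 0#
    ... | yes p = p
    ... | no  p = ⊥-elim (<⇒≱ 0<1 (≤-diff (+-nonneg (psd g) (+-nonneg 0≤Q″ 0≤1)) eq))
      where
      0<h = ≰⇒> p
      -- At this t the form takes the value Q - 2 (Q + 1) = - Q - 2, which is negative since Q ≥ 0.
      t = - ((Q + 1#) * h ⁻¹)
      Q″ = quad A (λ u → t * f u + 1# * g u)
      0≤Q″ : 0# ≤ Q″
      0≤Q″ = psd _
      open ≈-Reasoning
      eq : Q + (Q″ + 1#) ≈ 0# - 1#
      eq = begin
        Q + (Q″ + 1#) ≈⟨ +-congˡ (+-congʳ (quad-linear A-sym t 1# f g)) ⟩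
        Q + (t * t * quad A f + (1# + 1#) * (t * 1#) * h + 1# * 1# * Q + 1#)
          ≈⟨ +-congˡ (+-congʳ (+-congʳ (+-congʳ (trans (*-congˡ Af≈0) (zeroʳ _))))) ⟩
        Q + (0# + (1# + 1#) * (t * 1#) * h + 1# * 1# * Q + 1#)
          ≈⟨ solve 3 (λ Q h i → Q :+ (:con +0 :+ :2 :* ((:- ((Q :+ :1) :* i)) :* :1) :* h :+ :1 :* :1 :* Q :+ :1)
                := (:con +0 :- :1) :+ (:2 :* (Q :+ :1)) :* (:1 :- h :* i)) refl Q h (h ⁻¹) ⟩
        0# - 1# + ((1# + 1#) * (Q + 1#)) * (1# - h * h ⁻¹)
          ≈⟨ +-congˡ (trans (*-congˡ (trans (+-congˡ (-‿cong (*-inversePos 0<h))) (-‿inverseʳ 1#))) (zeroʳ _)) ⟩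
        0# - 1# + 0# ≈⟨ +-identityʳ _ ⟩
        0# - 1# ∎

-- The extremal Rayleigh quotient for a weighted inner product.

module WeightedForms (ℝ : CompleteOrderedField) where
  open OrderedField ℝ

  -- The generalised eigenvalue problem T f = t · w f, for a positive weight w.
  module WeightedSpectralBound {m}
    (w : Fin m → Carrier) (0≤w : ∀ u → 0# ≤ w u) (w≤1 : ∀ u → w u ≤ 1#) where
    open FiniteSums ℝ
    open SpectralBound ℝ

    W : (Fin m → Carrier) → Carrier
    W f = sum λ u → w u * (f u * f u)

    W-nonneg : ∀ f → 0# ≤ W f
    W-nonneg f = sum-nonneg λ u → *-nonneg (0≤w u) (square-nonneg (f u))

    W≤ : ∀ f → W f ≤ ⟨ f , f ⟩
    W≤ f = sum-mono λ u → ≤-diff (*-nonneg (square-nonneg (f u)) (diff-nonneg (w≤1 u)))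
      (solve 2 (λ f w → f :* f :* (:1 :- w) := f :* f :- w :* (f :* f)) refl (f u) (w u))

    module _ {T : Matrix m} (T-sym : Symmetric T) where

      pencil : Carrier → Matrix m
      pencil t u v = t * (δ u v * w u) - T u v

      pencil-sym : ∀ t → Symmetric (pencil t)
      pencil-sym t u v = +-cong (*-congˡ (trans (*-congʳ (δ-sym u v)) (δ-subst v u w))) (-‿cong (T-sym u v))

      pencil-· : ∀ t f u → (pencil t · f) u ≈ t * (w u * f u) - (T · f) u
      pencil-· t f u = begin
        sum (λ v → (t * (δ u v * w u) - T u v) * f v)
          ≈⟨ sum-cong (λ v → solve 5 (λ t d w T f → (t :* (d :* w) :- T) :* f := (t :* w) :* (d :* f) :+ (:- :1) :* (T :* f))
               refl t (δ u v) (w u) (T u v) (f v)) ⟩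
        sum (λ v → (t * w u) * (δ u v * f v) + (- 1#) * (T u v * f v))
          ≈⟨ sum-linear (t * w u) (- 1#) (λ v → δ u v * f v) (λ v → T u v * f v) ⟩
        (t * w u) * sum (λ v → δ u v * f v) + (- 1#) * (T · f) u
          ≈⟨ +-congʳ (*-congˡ (sum-δ u f)) ⟩
        (t * w u) * f u + (- 1#) * (T · f) u
          ≈⟨ solve 4 (λ t w f x → t :* w :* f :+ (:- :1) :* x := t :* (w :* f) :- x) refl t (w u) (f u) ((T · f) u) ⟩
        t * (w u * f u) - (T · f) u ∎
        where open ≈-Reasoning

      quad-pencil : ∀ t f → quad (pencil t) f ≈ t * W f - quad T f
      quad-pencil t f = begin
        sum (λ u → f u * (pencil t · f) u)
          ≈⟨ sum-cong (λ u → trans (*-congˡ (pencil-· t f u))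
               (solve 4 (λ t w f x → f :* (t :* (w :* f) :- x) := t :* (w :* (f :* f)) :- f :* x) refl t (w u) (f u) ((T · f) u))) ⟩
        sum (λ u → t * (w u * (f u * f u)) - f u * (T · f) u)
          ≈⟨ sum-diff (λ u → t * (w u * (f u * f u))) (λ u → f u * (T · f) u) ⟩
        sum (λ u → t * (w u * (f u * f u))) - quad T f
          ≈⟨ +-congʳ (*-distribˡ-sum t (λ u → w u * (f u * f u))) ⟨
        t * W f - quad T f ∎
        where open ≈-Reasoning

      -- The largest t for which t · w - T is not positive definite is an
      -- eigenvalue: there the pencil is semidefinite but, by maximality, not
      -- bounded below, so it has a null vector.
      rayleigh-bound : (∀ f → quad T f ≤ W f) → ∀ {ρ} → 0# ≤ ρ →
                       (∀ t f → Nonzero f → (∀ u → (T · f) u ≈ t * (w u * f u)) → t * t ≤ ρ * ρ) →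
                       ∀ f → quad T f ≤ ρ * W f
      rayleigh-bound T≤W {ρ} 0≤ρ eigen f₀ with quad T f₀ ≤? ρ * W f₀
      ... | yes p = p
      ... | no  p = ⊥-elim (conclude (definite? (pencil s) (pencil-sym s)))
        where
        Exceeded : Carrier → Set
        Exceeded t = ∃ λ f → t * W f < quad T f

        bounded : ∀ t → Exceeded t → t ≤ 1#
        bounded t (f , tW<T) with ≤-total t 1#
        ... | inj₁ t≤1 = t≤1
        ... | inj₂ 1≤t = contradiction (≤-trans (T≤W f) (≤-diff (*-nonneg (W-nonneg f) (diff-nonneg 1≤t))
          (solve 2 (λ W t → W :* (t :- :1) := t :* W :- W) refl (W f) t))) (<⇒≱ tW<T)

        -- Under the assumption to be refuted, ρ itself is exceeded, at `f₀`; the bound 1 comes from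
        -- `T≤W`.
        sup = supremum Exceeded (ρ , f₀ , ≰⇒> p) (1# , bounded)

        s : Carrier
        s = proj₁ sup

        upper : ∀ t → Exceeded t → t ≤ s
        upper = proj₁ (proj₂ sup)

        least : ∀ b → (∀ t → Exceeded t → t ≤ b) → s ≤ b
        least = proj₂ (proj₂ sup)

        psd : ∀ f → quad T f ≤ s * W f
        psd f with quad T f ≤? s * W f
        ... | yes q = q
        ... | no  q = ⊥-elim (<⇒≱ 0<η (≤-diff (diff-nonneg (upper (s + η) (f , beyond)))
                       (solve 2 (λ s η → s :- (s :+ η) := :con +0 :- η) refl s η)))
          where
          d = quad T f - s * W f
          0<W+1 : 0# < 1# + W f
          0<W+1 = +-pos 0<1 (W-nonneg f)
          -- The denominator 1 + W f is positive even if W f vanishes, and makes `quad T f` exceed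
          -- (s + η) W f by exactly η.
          η = d * (1# + W f) ⁻¹
          0<η : 0# < η
          0<η = *-pos (diff-pos (≰⇒> q)) (⁻¹-pos 0<W+1)
          eq : quad T f - (s + η) * W f ≈ η
          eq = begin
            quad T f - (s + η) * W f
              ≈⟨ solve 4 (λ T s W i → let d = T :- s :* W in
                   T :- (s :+ d :* i) :* W := d :* i :+ d :* (:1 :- (:1 :+ W) :* i)) refl (quad T f) s (W f) ((1# + W f) ⁻¹) ⟩
            η + d * (1# - (1# + W f) * (1# + W f) ⁻¹)
              ≈⟨ +-congˡ (trans (*-congˡ (trans (+-congˡ (-‿cong (*-inversePos 0<W+1))) (-‿inverseʳ 1#))) (zeroʳ d)) ⟩
            η + 0# ≈⟨ +-identityʳ η ⟩
            η ∎
            where open ≈-Reasoning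
          beyond : (s + η) * W f < quad T f
          beyond = ≰⇒> λ le → <⇒≱ 0<η (≤-diff (diff-nonneg le) (begin
            (s + η) * W f - quad T f     ≈⟨ solve 2 (λ a b → a :- b := :con +0 :- (b :- a)) refl ((s + η) * W f) (quad T f) ⟩
            0# - (quad T f - (s + η) * W f) ≈⟨ +-congˡ (-‿cong eq) ⟩
            0# - η ∎))
            where open ≈-Reasoning

        pencil-psd : ∀ f → 0# ≤ quad (pencil s) f
        pencil-psd f = ≤-respʳ (sym (quad-pencil s f)) (diff-nonneg (psd f))

        conclude : Definite (pencil s) → ⊥
        conclude (inj₁ (f , f≉0 , sf≤0)) = contradiction (≤-trans (psd f₀)
            (≤-diff (*-nonneg (W-nonneg f₀) (diff-nonneg s≤ρ))
              (solve 3 (λ W ρ s → W :* (ρ :- s) := ρ :* W :- s :* W) refl (W f₀) ρ s))) p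
          where
          eigenvector : ∀ u → (T · f) u ≈ s * (w u * f u)
          eigenvector u = begin
            (T · f) u ≈⟨ solve 2 (λ a b → b := a :- (a :- b)) refl (s * (w u * f u)) ((T · f) u) ⟩
            s * (w u * f u) - (s * (w u * f u) - (T · f) u) ≈⟨ +-congˡ (-‿cong (pencil-· s f u)) ⟨
            s * (w u * f u) - (pencil s · f) u ≈⟨ +-congˡ (-‿cong (null-vector (pencil-sym s) pencil-psd f sf≤0 u)) ⟩
            s * (w u * f u) - 0# ≈⟨ solve 1 (λ a → a :- :con +0 := a) refl (s * (w u * f u)) ⟩
            s * (w u * f u) ∎
            where open ≈-Reasoning
          s≤ρ : s ≤ ρ
          s≤ρ with s ≤? ρ
          ... | yes q = q
          ... | no  q = ⊥-elim (<⇒≱ (*-pos (diff-pos ρ<s) (+-pos (≤-<-trans 0≤ρ ρ<s) 0≤ρ))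
                (≤-diff (diff-nonneg (eigen s f f≉0 eigenvector))
                  (solve 2 (λ s ρ → ρ :* ρ :- s :* s := :con +0 :- (s :- ρ) :* (s :+ ρ)) refl s ρ)))
            where ρ<s = ≰⇒> q
        -- Coercivity and W f ≤ ⟨ f , f ⟩ give `quad T f` ≤ (s - c⁻¹) W f for every `f`, so s - c⁻¹
        -- would be a smaller upper bound than the supremum.
        conclude (inj₂ (c , 0<c , bound)) = <⇒≱ (⁻¹-pos 0<c) (≤-diff (diff-nonneg (least (s - c ⁻¹) smaller))
            (solve 2 (λ s i → s :- i :- s := :con +0 :- i) refl s (c ⁻¹)))
          where
          smaller : ∀ t → Exceeded t → t ≤ s - c ⁻¹
          smaller t (f , tW<T) = *-cancelˡ-≤ 0<c (*-cancelˡ-≤ 0<W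
            (≤-diff (+-nonneg (diff-nonneg (≤-trans (W≤ f) (bound f))) (*-nonneg (proj₁ 0<c) (diff-nonneg (proj₁ tW<T)))) (begin
              c * quad (pencil s) f - W f + c * (quad T f - t * W f)
                ≈⟨ +-congʳ (+-congʳ (*-congˡ (quad-pencil s f))) ⟩
              c * (s * W f - quad T f) - W f + c * (quad T f - t * W f)
                ≈⟨ solve 6 (λ c s W T t i → c :* (s :* W :- T) :- W :+ c :* (T :- t :* W)
                     := W :* (c :* (s :- i)) :- W :* (c :* t) :+ W :* (c :* i :- :1)) refl c s (W f) (quad T f) t (c ⁻¹) ⟩
              W f * (c * (s - c ⁻¹)) - W f * (c * t) + W f * (c * c ⁻¹ - 1#)
                ≈⟨ +-congˡ (trans (*-congˡ (trans (+-congʳ (*-inversePos 0<c)) (-‿inverseʳ 1#))) (zeroʳ (W f))) ⟩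
              W f * (c * (s - c ⁻¹)) - W f * (c * t) + 0#
                ≈⟨ +-identityʳ _ ⟩
              W f * (c * (s - c ⁻¹)) - W f * (c * t) ∎)))
            where
            open ≈-Reasoning
            0<W : 0# < W f
            0<W = ≰⇒> λ W≤0 → <⇒≱ tW<T (≤-trans (psd f)
              (≤-diff (*-nonneg (diff-nonneg (upper t (f , tW<T))) (neg-nonneg W≤0))
                (solve 3 (λ s t W → (s :- t) :* (:- W) := t :* W :- s :* W) refl s t (W f))))

-- Convex cones of forms generated by local squares.

module LocalCones (ℝ : CompleteOrderedField) where
  open OrderedField ℝ
  open FiniteSums ℝ

  SupportedOn : ∀ {m} → Subset m → (Fin m → Carrier) → Set
  SupportedOn S f = ∀ u → u ∉ S → f u ≈ 0#

  -- Kept abstract because two models are used: derivability from local squares, and positive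
  -- semidefiniteness of real forms. The same inequality between walk forms then serves as a line of
  -- a derivation and as an estimate in the spectral argument.
  record LocalCone (m R : ℕ) : Set₁ where
    field
      Holds  : Matrix m → Set
      resp-≈ : ∀ {A B} → (∀ y z → A y z ≈ B y z) → Holds A → Holds B
      combine : ∀ {l} (c : Fin l → Carrier) (A : Fin l → Matrix m) → (∀ i → 0# ≤ c i) →
                (∀ i → Holds (A i)) → Holds (λ y z → sum λ i → c i * A i y z)
      outer : ∀ S f → ∣ S ∣ ℕ.≤ R → SupportedOn S f → Holds (λ y z → f y * f z)

    scale : ∀ {A} c → 0# ≤ c → Holds A → Holds (λ y z → c * A y z)
    scale {A} c 0≤c HA = resp-≈ (λ y z → +-identityʳ _)
      (combine {1} (λ _ → c) (λ _ → A) (λ _ → 0≤c) (λ _ → HA))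

    add : ∀ {A B} → Holds A → Holds B → Holds (λ y z → A y z + B y z)
    add {A} {B} HA HB = resp-≈
      (λ y z → solve 2 (λ a b → :1 :* a :+ (:1 :* b :+ :con +0) := a :+ b) refl (A y z) (B y z))
      (combine {2} (λ _ → 1#) (λ { zero → A ; (suc _) → B }) (λ _ → 0≤1) (λ { zero → HA ; (suc _) → HB }))

    unscale : ∀ {A B} c → 0# < c → (∀ y z → A y z ≈ c * B y z) → Holds A → Holds B
    unscale {A} {B} c 0<c A≈cB HA = resp-≈ (λ y z → trans (*-congˡ (A≈cB y z))
        (trans (solve 3 (λ i c b → i :* (c :* b) := c :* i :* b) refl (c ⁻¹) c (B y z))
               (trans (*-congʳ (*-inversePos 0<c)) (*-identityˡ _))))
      (scale (c ⁻¹) (proj₁ (⁻¹-pos 0<c)) HA)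

  sum-linear₃ : ∀ {m} a b c (f g h : Fin m → Carrier) →
                sum (λ i → a * f i + b * g i + c * h i) ≈ a * sum f + b * sum g + c * sum h
  sum-linear₃ a b c f g h = trans (∑-distrib-+ (λ i → a * f i + b * g i) (λ i → c * h i))
    (+-cong (sum-linear a b f g) (sym (*-distribˡ-sum c h)))

  sum-linear₄ : ∀ {m} a b c d (f g h k : Fin m → Carrier) →
                sum (λ i → a * f i + b * g i + c * h i + d * k i) ≈ a * sum f + b * sum g + c * sum h + d * sum k
  sum-linear₄ a b c d f g h k = trans (∑-distrib-+ (λ i → a * f i + b * g i + c * h i) (λ i → d * k i))
    (+-cong (sum-linear₃ a b c f g h) (sym (*-distribˡ-sum d k)))

  0<2 : 0# < 1# + 1#
  0<2 = +-pos 0<1 0≤1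

  δ-nonneg : ∀ {m} (u v : Fin m) → 0# ≤ δ u v
  δ-nonneg zero    zero    = 0≤1
  δ-nonneg zero    (suc v) = ≤-refl
  δ-nonneg (suc u) zero    = ≤-refl
  δ-nonneg (suc u) (suc v) = δ-nonneg u v

  ∣p∪q∣≤ : ∀ {m} (p q : Subset m) → ∣ p ∪ q ∣ ℕ.≤ ∣ p ∣ ℕ.+ ∣ q ∣
  ∣p∪q∣≤ [] [] = ℕ.z≤n
  ∣p∪q∣≤ (Subset.inside  ∷ p) (Subset.inside  ∷ q) =
    ℕ.s≤s (ℕ.≤-trans (∣p∪q∣≤ p q) (ℕ.+-monoʳ-≤ ∣ p ∣ (ℕ.n≤1+n _)))
  ∣p∪q∣≤ (Subset.inside  ∷ p) (Subset.outside ∷ q) = ℕ.s≤s (∣p∪q∣≤ p q)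
  ∣p∪q∣≤ (Subset.outside ∷ p) (Subset.inside  ∷ q) =
    ℕ.≤-trans (ℕ.s≤s (∣p∪q∣≤ p q)) (ℕ.≤-reflexive (≡.sym (ℕ.+-suc ∣ p ∣ ∣ q ∣)))
  ∣p∪q∣≤ (Subset.outside ∷ p) (Subset.outside ∷ q) = ∣p∪q∣≤ p q

  ∣p∪⁅x⁆∣≤ : ∀ {m} (p : Subset m) x → ∣ p ∪ ⁅ x ⁆ ∣ ℕ.≤ suc ∣ p ∣
  ∣p∪⁅x⁆∣≤ p x = ℕ.≤-trans (∣p∪q∣≤ p ⁅ x ⁆)
    (ℕ.≤-reflexive (≡.trans (≡.cong (∣ p ∣ ℕ.+_) (Subset.∣⁅x⁆∣≡1 x)) (ℕ.+-comm ∣ p ∣ 1)))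

  δ-supported : ∀ {m} (v : Fin m) → SupportedOn ⁅ v ⁆ (δ v)
  δ-supported v u u∉ = δ-≢ {u = v} {u} λ { ≡.refl → u∉ (Subset.x∈⁅x⁆ v) }

  +-supported : ∀ {m} {S : Subset m} {f} → SupportedOn S f → ∀ c v →
                SupportedOn (S ∪ ⁅ v ⁆) (λ u → f u + c * δ v u)
  +-supported {S = S} f-supp c v u u∉ = trans
    (+-cong (f-supp u (u∉ ∘ Subset.p⊆p∪q ⁅ v ⁆))
            (trans (*-congˡ (δ-supported v u (u∉ ∘ Subset.q⊆p∪q S ⁅ v ⁆))) (zeroʳ c)))
    (+-identityˡ 0#)

  module ConeLemmas {m R : ℕ} (𝒞 : LocalCone m R) where
    open LocalCone 𝒞

    -- The sum over u, v of ¼ (W + S) (X u - X v)² + ¼ (W - S) (X u + X v)².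
    two-local : 2 ℕ.≤ R → {W S : Matrix m} → Symmetric W → Symmetric S →
                (∀ u v → 0# ≤ W u v + S u v) → (∀ u v → 0# ≤ W u v - S u v) →
                Holds (λ y z → δ y z * sum (W y) - S y z)
    two-local 2≤R {W} {S} W-sym S-sym 0≤W+S 0≤W-S =
      unscale ((1# + 1#) * (1# + 1#)) (*-pos 0<2 0<2) entry
        (combine (λ _ → 1#) (λ u y z → sum λ v → 1# * E u v y z) (λ _ → 0≤1) λ u →
          combine (λ _ → 1#) (λ v → E u v) (λ _ → 0≤1) λ v →
            add (scale _ (0≤W+S u v) (pair-square u v (- 1#))) (scale _ (0≤W-S u v) (pair-square u v 1#)))
      where
      pair-square : ∀ u v s → Holds (λ y z → (δ u y + s * δ v y) * (δ u z + s * δ v z))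
      pair-square u v s = outer (⁅ u ⁆ ∪ ⁅ v ⁆) _
        (ℕ.≤-trans (∣p∪⁅x⁆∣≤ ⁅ u ⁆ v) (ℕ.≤-trans (ℕ.s≤s (ℕ.≤-reflexive (Subset.∣⁅x⁆∣≡1 u))) 2≤R))
        (+-supported (δ-supported u) s v)

      E : Fin m → Fin m → Matrix m
      E u v y z = (W u v + S u v) * ((δ u y + - 1# * δ v y) * (δ u z + - 1# * δ v z)) +
                  (W u v - S u v) * ((δ u y + 1# * δ v y) * (δ u z + 1# * δ v z))

      two = 1# + 1#

      inner : ∀ u y z → sum (λ v → 1# * E u v y z) ≈
              two * (δ u y * (δ u z * sum (W u))) + (two * δ y z) * W u y + - two * (δ u y * S u z) + - two * (δ u z * S u y)
      inner u y z = begin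
        sum (λ v → 1# * E u v y z)
          ≈⟨ sum-cong (λ v → solve 6 (λ W S uy uz vy vz →
               :1 :* ((W :+ S) :* ((uy :+ (:- :1) :* vy) :* (uz :+ (:- :1) :* vz)) :+
                      (W :- S) :* ((uy :+ :1 :* vy) :* (uz :+ :1 :* vz)))
               := (:2 :* (uy :* uz)) :* W :+ :2 :* (vy :* (vz :* W)) :+ (:- :2 :* uy) :* (vz :* S) :+ (:- :2 :* uz) :* (vy :* S))
               refl (W u v) (S u v) (δ u y) (δ u z) (δ v y) (δ v z)) ⟩
        sum (λ v → (two * (δ u y * δ u z)) * W u v + two * (δ v y * (δ v z * W u v)) +
                   (- two * δ u y) * (δ v z * S u v) + (- two * δ u z) * (δ v y * S u v))
          ≈⟨ sum-linear₄ (two * (δ u y * δ u z)) two (- two * δ u y) (- two * δ u z)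
               (W u) (λ v → δ v y * (δ v z * W u v)) (λ v → δ v z * S u v) (λ v → δ v y * S u v) ⟩
        (two * (δ u y * δ u z)) * sum (W u) + two * sum (λ v → δ v y * (δ v z * W u v)) +
          (- two * δ u y) * sum (λ v → δ v z * S u v) + (- two * δ u z) * sum (λ v → δ v y * S u v)
          ≈⟨ +-cong (+-cong (+-congˡ (*-congˡ (sum-δˡ y (λ v → δ v z * W u v)))) (*-congˡ (sum-δˡ z (S u)))) (*-congˡ (sum-δˡ y (S u))) ⟩
        (two * (δ u y * δ u z)) * sum (W u) + two * (δ y z * W u y) + (- two * δ u y) * S u z + (- two * δ u z) * S u y
          ≈⟨ solve 8 (λ t uy uz r yz w s s′ → (t :* (uy :* uz)) :* r :+ t :* (yz :* w) :+ (:- t :* uy) :* s :+ (:- t :* uz) :* s′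
               := t :* (uy :* (uz :* r)) :+ (t :* yz) :* w :+ (:- t) :* (uy :* s) :+ (:- t) :* (uz :* s′))
               refl two (δ u y) (δ u z) (sum (W u)) (δ y z) (W u y) (S u z) (S u y) ⟩
        two * (δ u y * (δ u z * sum (W u))) + (two * δ y z) * W u y + - two * (δ u y * S u z) + - two * (δ u z * S u y) ∎
        where open ≈-Reasoning

      entry : ∀ y z → sum (λ u → 1# * sum (λ v → 1# * E u v y z)) ≈ (two * two) * (δ y z * sum (W y) - S y z)
      entry y z = begin
        sum (λ u → 1# * sum (λ v → 1# * E u v y z))
          ≈⟨ sum-cong (λ u → trans (*-identityˡ _) (inner u y z)) ⟩
        sum (λ u → two * (δ u y * (δ u z * sum (W u))) + (two * δ y z) * W u y + - two * (δ u y * S u z) + - two * (δ u z * S u y))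
          ≈⟨ sum-linear₄ two (two * δ y z) (- two) (- two) (λ u → δ u y * (δ u z * sum (W u))) (λ u → W u y)
               (λ u → δ u y * S u z) (λ u → δ u z * S u y) ⟩
        two * sum (λ u → δ u y * (δ u z * sum (W u))) + (two * δ y z) * sum (λ u → W u y) +
          - two * sum (λ u → δ u y * S u z) + - two * sum (λ u → δ u z * S u y)
          ≈⟨ +-cong (+-cong (+-cong (*-congˡ (sum-δˡ y (λ u → δ u z * sum (W u)))) (*-congˡ (sum-cong (λ u → W-sym u y))))
               (*-congˡ (sum-δˡ y (λ u → S u z)))) (*-congˡ (trans (sum-δˡ z (λ u → S u y)) (S-sym z y))) ⟩
        two * (δ y z * sum (W y)) + (two * δ y z) * sum (W y) + - two * S y z + - two * S y z
          ≈⟨ solve 3 (λ d r s → :2 :* (d :* r) :+ (:2 :* d) :* r :+ (:- :2) :* s :+ (:- :2) :* s := (:2 :* :2) :* (d :* r :- s))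
               refl (δ y z) (sum (W y)) (S y z) ⟩
        (two * two) * (δ y z * sum (W y) - S y z) ∎
        where open ≈-Reasoning

    diagonal : 2 ℕ.≤ R → (d : Fin m → Carrier) → (∀ u → 0# ≤ d u) → Holds (λ y z → δ y z * d y)
    diagonal 2≤R d 0≤d = resp-≈ (λ y z → trans (+-congˡ -0#≈0#) (trans (+-identityʳ _) (*-congˡ (sum-δ y d))))
      (two-local 2≤R {λ u v → δ u v * d v} {λ _ _ → 0#}
        (λ u v → trans (δ-subst u v d) (*-congʳ (δ-sym u v))) (λ _ _ → refl)
        (λ u v → ≤-respʳ (sym (+-identityʳ _)) (*-nonneg (δ-nonneg u v) (0≤d v)))
        (λ u v → ≤-respʳ (sym (trans (+-congˡ -0#≈0#) (+-identityʳ _))) (*-nonneg (δ-nonneg u v) (0≤d v))))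

    -- Invariant after q draws have been averaged out: `h` is their accumulated mean, `A` their
    -- accumulated covariance. The quantified `f` is the place for further draws: to average one
    -- more, it is instantiated at `f` plus a signed sample. The `q` in the size bound reserves one
    -- indeterminate for each draw already averaged out.
    Good : ℕ → Matrix m → (Fin m → Carrier) → Set
    Good q A h = ∀ S f → ∣ S ∣ ℕ.+ q ℕ.≤ R → SupportedOn S f →
                 Holds (λ y z → A y z + (f y + h y) * (f z + h z))

    good-resp : ∀ {q A B h g} → (∀ y z → A y z ≈ B y z) → (∀ y → h y ≈ g y) → Good q A h → Good q B g
    good-resp A≈B h≈g good S f ∣S∣ f-supp = resp-≈
      (λ y z → +-cong (A≈B y z) (*-cong (+-congˡ (h≈g y)) (+-congˡ (h≈g z)))) (good S f ∣S∣ f-supp)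

    good-zero : Good 0 (λ _ _ → 0#) (λ _ → 0#)
    good-zero S f ∣S∣ f-supp = resp-≈
      (λ y z → solve 2 (λ a b → a :* b := :con +0 :+ (a :+ :con +0) :* (b :+ :con +0)) refl (f y) (f z))
      (outer S f (ℕ.≤-trans (ℕ.≤-reflexive (≡.sym (ℕ.+-identityʳ _))) ∣S∣) f-supp)

    -- The covariance matrix of a random signed unit vector: its position has law `P`, its mean is
    -- `Q`, and a sign squares to 1, so the second moment is diagonal.
    covariance : (P Q : Fin m → Carrier) → Matrix m
    covariance P Q y z = δ y z * P y - Q y * Q z

    module Sampling {P Q : Fin m → Carrier} (0≤P+Q : ∀ v → 0# ≤ P v + Q v) (0≤P-Q : ∀ v → 0# ≤ P v - Q v)
      (ΣP≈1 : sum P ≈ 1#) where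

      -- Average over the signed samples ±c X v, drawn with probabilities ½ (P v ± Q v).
      sample : ∀ {q A h} c → Good q A h →
               Good (suc q) (λ y z → A y z + c * c * covariance P Q y z) (λ y → h y + c * Q y)
      sample {q} {A} {h} c good S f ∣S∣ f-supp =
        unscale (1# + 1#) 0<2 entry
          (combine (λ _ → 1#) E (λ _ → 0≤1) λ v →
            add (scale _ (0≤P+Q v) (at v c)) (scale _ (0≤P-Q v) (at v (- c))))
        where
        at : ∀ v s → Holds (λ y z → A y z + ((f y + s * δ v y) + h y) * ((f z + s * δ v z) + h z))
        at v s = good (S ∪ ⁅ v ⁆) (λ u → f u + s * δ v u)
          (ℕ.≤-trans (ℕ.+-monoˡ-≤ q (∣p∪⁅x⁆∣≤ S v)) (ℕ.≤-trans (ℕ.≤-reflexive (≡.sym (ℕ.+-suc ∣ S ∣ q))) ∣S∣))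
          (+-supported f-supp s v)

        E : Fin m → Matrix m
        E v y z = (P v + Q v) * (A y z + ((f y + c * δ v y) + h y) * ((f z + c * δ v z) + h z)) +
                  (P v - Q v) * (A y z + ((f y + - c * δ v y) + h y) * ((f z + - c * δ v z) + h z))

        two = 1# + 1#

        entry : ∀ y z → sum (λ v → 1# * E v y z) ≈
                two * (A y z + c * c * covariance P Q y z + (f y + (h y + c * Q y)) * (f z + (h z + c * Q z)))
        entry y z = begin
          sum (λ v → 1# * E v y z)
            ≈⟨ sum-cong (λ v → solve 10 (λ P Q A fy fz hy hz c vy vz →
                 :1 :* ((P :+ Q) :* (A :+ ((fy :+ c :* vy) :+ hy) :* ((fz :+ c :* vz) :+ hz)) :+
                        (P :- Q) :* (A :+ ((fy :+ (:- c) :* vy) :+ hy) :* ((fz :+ (:- c) :* vz) :+ hz)))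
                 := (:2 :* (A :+ (fy :+ hy) :* (fz :+ hz))) :* P :+ (:2 :* (c :* c)) :* (vy :* (vz :* P)) :+
                    (:2 :* c :* (fy :+ hy)) :* (vz :* Q) :+ (:2 :* c :* (fz :+ hz)) :* (vy :* Q))
                 refl (P v) (Q v) (A y z) (f y) (f z) (h y) (h z) c (δ v y) (δ v z)) ⟩
          sum (λ v → a₁ * P v + a₂ * (δ v y * (δ v z * P v)) + a₃ * (δ v z * Q v) + a₄ * (δ v y * Q v))
            ≈⟨ sum-linear₄ a₁ a₂ a₃ a₄ P (λ v → δ v y * (δ v z * P v)) (λ v → δ v z * Q v) (λ v → δ v y * Q v) ⟩
          a₁ * sum P + a₂ * sum (λ v → δ v y * (δ v z * P v)) + a₃ * sum (λ v → δ v z * Q v) + a₄ * sum (λ v → δ v y * Q v)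
            ≈⟨ +-cong (+-cong (+-cong (*-congˡ ΣP≈1) (*-congˡ (sum-δˡ y (λ v → δ v z * P v)))) (*-congˡ (sum-δˡ z Q))) (*-congˡ (sum-δˡ y Q)) ⟩
          a₁ * 1# + a₂ * (δ y z * P y) + a₃ * Q z + a₄ * Q y
            ≈⟨ solve 10 (λ A fy fz hy hz c d P Qy Qz →
                 (:2 :* (A :+ (fy :+ hy) :* (fz :+ hz))) :* :1 :+ (:2 :* (c :* c)) :* (d :* P) :+
                 (:2 :* c :* (fy :+ hy)) :* Qz :+ (:2 :* c :* (fz :+ hz)) :* Qy
                 := :2 :* (A :+ c :* c :* (d :* P :- Qy :* Qz) :+ (fy :+ (hy :+ c :* Qy)) :* (fz :+ (hz :+ c :* Qz))))
                 refl (A y z) (f y) (f z) (h y) (h z) c (δ y z) (P y) (Q y) (Q z) ⟩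
          two * (A y z + c * c * covariance P Q y z + (f y + (h y + c * Q y)) * (f z + (h z + c * Q z))) ∎
          where
          open ≈-Reasoning
          a₁ = two * (A y z + (f y + h y) * (f z + h z))
          a₂ = two * (c * c)
          a₃ = two * c * (f y + h y)
          a₄ = two * c * (f z + h z)

      samples : ∀ {q A h} p c → Good q A h →
                Good (p ℕ.+ q) (λ y z → A y z + fromℕ p * (c * c * covariance P Q y z)) (λ y → h y + fromℕ p * (c * Q y))
      samples zero c good = good-resp
        (λ y z → sym (trans (+-congˡ (zeroˡ _)) (+-identityʳ _))) (λ y → sym (trans (+-congˡ (zeroˡ _)) (+-identityʳ _))) good
      samples {A = A} {h} (suc p) c good = good-resp
        (λ y z → solve 3 (λ a p x → a :+ p :* x :+ x := a :+ (:1 :+ p) :* x) refl (A y z) (fromℕ p) (c * c * covariance P Q y z))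
        (λ y → solve 3 (λ a p x → a :+ p :* x :+ x := a :+ (:1 :+ p) :* x) refl (h y) (fromℕ p) (c * Q y))
        (sample c (samples p c good))

-- Matrix powers and signed reversible walks.

module MatrixPowers (ℝ : CompleteOrderedField) where
  open OrderedField ℝ
  open FiniteSums ℝ

  power : ∀ {m} → Matrix m → ℕ → Matrix m
  power A zero    u v = δ u v
  power A (suc i) u v = (A · λ w → power A i w v) u

  sum-assoc : ∀ {m} (a : Fin m → Carrier) (B : Matrix m) (c : Fin m → Carrier) →
              sum (λ r → sum (λ w → a w * B w r) * c r) ≈ sum (λ w → a w * sum (λ r → B w r * c r))
  sum-assoc a B c = begin
    sum (λ r → sum (λ w → a w * B w r) * c r)       ≈⟨ sum-cong (λ r → *-distribʳ-sum (c r) (λ w → a w * B w r)) ⟩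
    sum (λ r → sum (λ w → a w * B w r * c r))       ≈⟨ ∑-comm (λ r w → a w * B w r * c r) ⟩
    sum (λ w → sum (λ r → a w * B w r * c r))       ≈⟨ sum-cong (λ w → sum-cong (λ r → *-assoc (a w) (B w r) (c r))) ⟩
    sum (λ w → sum (λ r → a w * (B w r * c r)))     ≈⟨ sum-cong (λ w → *-distribˡ-sum (a w) (λ r → B w r * c r)) ⟨
    sum (λ w → a w * sum (λ r → B w r * c r))       ∎
    where open ≈-Reasoning

  power-+ : ∀ {m} (A : Matrix m) i j u v → sum (λ r → power A i u r * power A j r v) ≈ power A (i ℕ.+ j) u v
  power-+ A zero    j u v = sum-δ u (λ r → power A j r v)
  power-+ A (suc i) j u v = trans (sum-assoc (A u) (power A i) (λ r → power A j r v))
    (sum-cong (λ w → *-congˡ (power-+ A i j w v)))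

  power-1 : ∀ {m} (A : Matrix m) u v → power A 1 u v ≈ A u v
  power-1 A u v = trans (sum-cong (λ w → *-comm (A u w) (δ w v))) (sum-δˡ v (A u))

  power-suc : ∀ {m} (A : Matrix m) i u v → power A (suc i) u v ≈ sum (λ w → power A i u w * A w v)
  power-suc A i u v = trans (reflexive (≡.cong (λ j → power A j u v) (ℕ.+-comm 1 i)))
    (trans (sym (power-+ A i 1 u v)) (sum-cong (λ w → *-congˡ (power-1 A w v))))

  power-reversible : ∀ {m} (μ : Fin m → Carrier) (A : Matrix m) → (∀ u v → μ u * A u v ≈ μ v * A v u) →
                     ∀ i u v → μ u * power A i u v ≈ μ v * power A i v u
  power-reversible μ A rev zero    u v = trans (*-comm _ _) (trans (sym (δ-subst u v μ))
    (trans (*-congʳ (δ-sym u v)) (*-comm _ _)))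
  power-reversible μ A rev (suc i) u v = begin
    μ u * sum (λ w → A u w * power A i w v)     ≈⟨ *-distribˡ-sum (μ u) (λ w → A u w * power A i w v) ⟩
    sum (λ w → μ u * (A u w * power A i w v))   ≈⟨ sum-cong (λ w → step w) ⟩
    sum (λ w → μ v * (power A i v w * A w u))   ≈⟨ *-distribˡ-sum (μ v) (λ w → power A i v w * A w u) ⟨
    μ v * sum (λ w → power A i v w * A w u)     ≈⟨ *-congˡ (power-suc A i v u) ⟨
    μ v * power A (suc i) v u                   ∎
    where
    open ≈-Reasoning
    step : ∀ w → μ u * (A u w * power A i w v) ≈ μ v * (power A i v w * A w u)
    step w = begin
      μ u * (A u w * power A i w v)   ≈⟨ *-assoc _ _ _ ⟨
      μ u * A u w * power A i w v     ≈⟨ *-congʳ (rev u w) ⟩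
      μ w * A w u * power A i w v     ≈⟨ solve 3 (λ m a p → m :* a :* p := m :* p :* a) refl (μ w) (A w u) (power A i w v) ⟩
      μ w * power A i w v * A w u     ≈⟨ *-congʳ (power-reversible μ A rev i w v) ⟩
      μ v * power A i v w * A w u     ≈⟨ *-assoc _ _ _ ⟩
      μ v * (power A i v w * A w u)   ∎

  -- The last two fields say |Q| ≤ P entrywise without absolute values. They make ½ (P ± Q) the
  -- probabilities of arriving with sign ±.
  record SignedWalk (m : ℕ) : Set where
    field
      μ            : Fin m → Carrier
      P Q          : Matrix m
      0<μ          : ∀ u → 0# < μ u
      Σμ≈1         : sum μ ≈ 1#
      ΣP≈1         : ∀ u → sum (P u) ≈ 1#
      P-reversible : ∀ u v → μ u * P u v ≈ μ v * P v u
      Q-reversible : ∀ u v → μ u * Q u v ≈ μ v * Q v u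
      0≤P+Q        : ∀ u v → 0# ≤ P u v + Q u v
      0≤P-Q        : ∀ u v → 0# ≤ P u v - Q u v

-- Local inequalities between the forms of a signed walk.

module WalkForms (ℝ : CompleteOrderedField) where
  open MatrixPowers ℝ

  module Walks {m} (walk : SignedWalk m) where
    open OrderedField ℝ
    open FiniteSums ℝ
    open LocalCones ℝ
    open SpectralBound ℝ
    open SignedWalk walk

    0≤μ : ∀ u → 0# ≤ μ u
    0≤μ u = proj₁ (0<μ u)

    μ≤1 : ∀ u → μ u ≤ 1#
    μ≤1 u = ≤-respʳ Σμ≈1 (term≤sum 0≤μ u)

    Pⁱ Qⁱ T : ℕ → Matrix m
    Pⁱ = power P
    Qⁱ = power Q
    T i u v = μ u * Qⁱ i u v

    T-sym : ∀ i → Symmetric (T i)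
    T-sym = power-reversible μ Q Q-reversible

    T-0 : ∀ y z → T 0 y z ≈ δ y z * μ y
    T-0 y z = *-comm (μ y) (δ y z)

    -- A walk arrives with sign + if its first step and the rest agree in sign, with sign - if they
    -- disagree. Each case uses both halves of the induction hypothesis, hence the joint statement.
    dominated : ∀ i u v → 0# ≤ Pⁱ i u v + Qⁱ i u v × 0# ≤ Pⁱ i u v - Qⁱ i u v
    dominated zero    u v = +-nonneg (δ-nonneg u v) (δ-nonneg u v) , ≤-reflexive (sym (-‿inverseʳ (δ u v)))
    dominated (suc i) u v =
      *-cancelˡ-nonneg 0<2 (≤-respʳ (plus (λ w → Pⁱ i w v) (λ w → Qⁱ i w v))
        (sum-nonneg λ w → +-nonneg (*-nonneg (0≤P+Q u w) (proj₁ (dominated i w v))) (*-nonneg (0≤P-Q u w) (proj₂ (dominated i w v))))) ,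
      *-cancelˡ-nonneg 0<2 (≤-respʳ (minus (λ w → Pⁱ i w v) (λ w → Qⁱ i w v))
        (sum-nonneg λ w → +-nonneg (*-nonneg (0≤P+Q u w) (proj₂ (dominated i w v))) (*-nonneg (0≤P-Q u w) (proj₁ (dominated i w v)))))
      where
      two = 1# + 1#
      open ≈-Reasoning
      plus : ∀ p q → sum (λ w → (P u w + Q u w) * (p w + q w) + (P u w - Q u w) * (p w - q w)) ≈ two * ((P · p) u + (Q · q) u)
      plus p q = begin
        sum (λ w → (P u w + Q u w) * (p w + q w) + (P u w - Q u w) * (p w - q w))
          ≈⟨ sum-cong (λ w → solve 4 (λ P Q p q → (P :+ Q) :* (p :+ q) :+ (P :- Q) :* (p :- q) := :2 :* (P :* p) :+ :2 :* (Q :* q))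
               refl (P u w) (Q u w) (p w) (q w)) ⟩
        sum (λ w → two * (P u w * p w) + two * (Q u w * q w))   ≈⟨ sum-linear two two (λ w → P u w * p w) (λ w → Q u w * q w) ⟩
        two * (P · p) u + two * (Q · q) u                       ≈⟨ distribˡ two _ _ ⟨
        two * ((P · p) u + (Q · q) u)                           ∎
      minus : ∀ p q → sum (λ w → (P u w + Q u w) * (p w - q w) + (P u w - Q u w) * (p w + q w)) ≈ two * ((P · p) u - (Q · q) u)
      minus p q = begin
        sum (λ w → (P u w + Q u w) * (p w - q w) + (P u w - Q u w) * (p w + q w))
          ≈⟨ sum-cong (λ w → solve 4 (λ P Q p q → (P :+ Q) :* (p :- q) :+ (P :- Q) :* (p :+ q) := :2 :* (P :* p :- Q :* q))
               refl (P u w) (Q u w) (p w) (q w)) ⟩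
        sum (λ w → two * (P u w * p w - Q u w * q w))           ≈⟨ *-distribˡ-sum two (λ w → P u w * p w - Q u w * q w) ⟨
        two * sum (λ w → P u w * p w - Q u w * q w)             ≈⟨ *-congˡ (sum-diff (λ w → P u w * p w) (λ w → Q u w * q w)) ⟩
        two * ((P · p) u - (Q · q) u)                           ∎

    sum-Pⁱ : ∀ i u → sum (Pⁱ i u) ≈ 1#
    sum-Pⁱ zero    u = trans (sum-cong (λ v → sym (*-identityʳ (δ u v)))) (sum-δ u (λ _ → 1#))
    sum-Pⁱ (suc i) u = begin
      sum (λ v → sum (λ w → P u w * Pⁱ i w v))   ≈⟨ ∑-comm (λ v w → P u w * Pⁱ i w v) ⟩
      sum (λ w → sum (λ v → P u w * Pⁱ i w v))   ≈⟨ sum-cong (λ w → *-distribˡ-sum (P u w) (Pⁱ i w)) ⟨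
      sum (λ w → P u w * sum (Pⁱ i w))           ≈⟨ sum-cong (λ w → trans (*-congˡ (sum-Pⁱ i w)) (*-identityʳ _)) ⟩
      sum (P u)                                  ≈⟨ ΣP≈1 u ⟩
      1#                                         ∎
      where open ≈-Reasoning

    sum-μPⁱ : ∀ i u → sum (λ v → μ u * Pⁱ i u v) ≈ μ u
    sum-μPⁱ i u = trans (sym (*-distribˡ-sum (μ u) (Pⁱ i u))) (trans (*-congˡ (sum-Pⁱ i u)) (*-identityʳ _))

    stationary : ∀ i u → sum (λ r → μ r * Pⁱ i r u) ≈ μ u
    stationary i u = trans (sum-cong (λ r → power-reversible μ P P-reversible i r u)) (sum-μPⁱ i u)

    -- By reversibility the first walk can be run backwards, from `y` to `r`. Followed by the second
    -- it is one walk of length i + j, and summing over `r` composes the powers.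
    meet : ∀ i j y z → sum (λ r → μ r * (Qⁱ i r y * Qⁱ j r z)) ≈ T (i ℕ.+ j) y z
    meet i j y z = begin
      sum (λ r → μ r * (Qⁱ i r y * Qⁱ j r z))   ≈⟨ sum-cong (λ r → trans (sym (*-assoc _ _ _)) (trans (*-congʳ (T-sym i r y)) (*-assoc _ _ _))) ⟩
      sum (λ r → μ y * (Qⁱ i y r * Qⁱ j r z))   ≈⟨ *-distribˡ-sum (μ y) (λ r → Qⁱ i y r * Qⁱ j r z) ⟨
      μ y * sum (λ r → Qⁱ i y r * Qⁱ j r z)     ≈⟨ *-congˡ (power-+ Q i j y z) ⟩
      T (i ℕ.+ j) y z                           ∎
      where open ≈-Reasoning

    module LocalProofs {R} (𝒞 : LocalCone m R) where
      open LocalCone 𝒞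
      open ConeLemmas 𝒞

      identity-nonneg : 2 ℕ.≤ R → Holds (T 0)
      identity-nonneg 2≤R = resp-≈ (λ y z → sym (T-0 y z)) (diagonal 2≤R μ 0≤μ)

      -- Take for `W` the joint law of the two ends of a stationary walk of length i: it dominates
      -- `T i` entrywise, and its row sums are the marginal `μ`, so the diagonal part of `two-local`
      -- is exactly `T 0`.
      T≼I : 2 ℕ.≤ R → ∀ i → Holds (λ y z → T 0 y z - T i y z)
      T≼I 2≤R i = resp-≈ (λ y z → +-congʳ (trans (*-congˡ (sum-μPⁱ i y)) (sym (T-0 y z))))
        (two-local 2≤R {λ u v → μ u * Pⁱ i u v} {T i} (power-reversible μ P P-reversible i) (T-sym i)
          (λ u v → ≤-respʳ (distribˡ _ _ _) (*-nonneg (0≤μ u) (proj₁ (dominated i u v))))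
          (λ u v → ≤-respʳ (solve 3 (λ m p q → m :* (p :- q) := m :* p :- m :* q) refl (μ u) (Pⁱ i u v) (Qⁱ i u v))
            (*-nonneg (0≤μ u) (proj₂ (dominated i u v)))))

      -T≼I : 2 ℕ.≤ R → ∀ i → Holds (λ y z → T 0 y z + T i y z)
      -T≼I 2≤R i = resp-≈ (λ y z → +-cong (trans (*-congˡ (sum-μPⁱ i y)) (sym (T-0 y z)))
          (solve 1 (λ t → :- (:- t) := t) refl (T i y z)))
        (two-local 2≤R {λ u v → μ u * Pⁱ i u v} {λ u v → - T i u v} (power-reversible μ P P-reversible i) (λ u v → -‿cong (T-sym i u v))
          (λ u v → ≤-respʳ (solve 3 (λ m p q → m :* (p :- q) := m :* p :- m :* q) refl (μ u) (Pⁱ i u v) (Qⁱ i u v))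
            (*-nonneg (0≤μ u) (proj₂ (dominated i u v))))
          (λ u v → ≤-respʳ (solve 3 (λ m p q → m :* (p :+ q) := m :* p :- :- (m :* q)) refl (μ u) (Pⁱ i u v) (Qⁱ i u v))
            (*-nonneg (0≤μ u) (proj₁ (dominated i u v)))))

      large-bound : 2 ℕ.≤ R → ∀ {h} → 1# ≤ h → ∀ {σ} → σ ≡ 1# ⊎ σ ≡ - 1# → Holds (λ u v → h * T 0 u v - σ * T 1 u v)
      large-bound 2≤R {h} 1≤h = λ where
          (inj₁ ≡.refl) → resp-≈ (λ u v → solve 3 (λ h t t₁ → (h :- :1) :* t :+ (t :- t₁) := h :* t :- :1 :* t₁) refl h (T 0 u v) (T 1 u v))
            (add excess (T≼I 2≤R 1))
          (inj₂ ≡.refl) → resp-≈ (λ u v → solve 3 (λ h t t₁ → (h :- :1) :* t :+ (t :+ t₁) := h :* t :- (:- :1) :* t₁) refl h (T 0 u v) (T 1 u v))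
            (add excess (-T≼I 2≤R 1))
        where
        excess : Holds (λ u v → (h - 1#) * T 0 u v)
        excess = scale (h - 1#) (diff-nonneg 1≤h) (identity-nonneg 2≤R)

      -- Averaged over a stationary root, the end of the walk has law `μ` again, which gives `T 0`;
      -- the products of means are joined by `meet`.
      sum-covariance : ∀ i y z → sum (λ r → μ r * covariance (Pⁱ i r) (Qⁱ i r) y z) ≈ T 0 y z - T (i ℕ.+ i) y z
      sum-covariance i y z = begin
        sum (λ r → μ r * (δ y z * Pⁱ i r y - Qⁱ i r y * Qⁱ i r z))
          ≈⟨ sum-cong (λ r → solve 4 (λ m d p q → m :* (d :* p :- q) := d :* (m :* p) :+ (:- :1) :* (m :* q))
               refl (μ r) (δ y z) (Pⁱ i r y) (Qⁱ i r y * Qⁱ i r z)) ⟩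
        sum (λ r → δ y z * (μ r * Pⁱ i r y) + (- 1#) * (μ r * (Qⁱ i r y * Qⁱ i r z)))
          ≈⟨ sum-linear (δ y z) (- 1#) (λ r → μ r * Pⁱ i r y) (λ r → μ r * (Qⁱ i r y * Qⁱ i r z)) ⟩
        δ y z * sum (λ r → μ r * Pⁱ i r y) + (- 1#) * sum (λ r → μ r * (Qⁱ i r y * Qⁱ i r z))
          ≈⟨ +-cong (*-congˡ (stationary i y)) (*-congˡ (meet i i y z)) ⟩
        δ y z * μ y + (- 1#) * T (i ℕ.+ i) y z
          ≈⟨ +-cong (sym (T-0 y z)) (solve 1 (λ t → (:- :1) :* t := :- t) refl (T (i ℕ.+ i) y z)) ⟩
        T 0 y z - T (i ℕ.+ i) y z ∎
        where open ≈-Reasoning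

      -- The expectation of (c X r + a ∑ₛ ± X vₛ + b ∑ₜ ± X wₜ)², where r has law μ,
      -- and v₁, …, vₚ and w₁, …, w_q are the ends of independent walks from r of
      -- lengths i and j respectively, signed so that ± X vₛ has mean (Qⁱ X) r.
      branching : ∀ i j p q a b c → suc (p ℕ.+ q) ℕ.≤ R → Holds λ y z →
        (fromℕ p * (a * a) * (T 0 y z - T (i ℕ.+ i) y z) + fromℕ q * (b * b) * (T 0 y z - T (j ℕ.+ j) y z)) +
        (c * c * T 0 y z + (fromℕ p * a) * (fromℕ p * a) * T (i ℕ.+ i) y z + (fromℕ q * b) * (fromℕ q * b) * T (j ℕ.+ j) y z +
         (1# + 1#) * (c * (fromℕ p * a) * T i y z + c * (fromℕ q * b) * T j y z + (fromℕ p * a) * (fromℕ q * b) * T (i ℕ.+ j) y z))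
      branching i j p q a b c size = resp-≈ entry (combine μ rooted 0≤μ (λ r →
          Sampling.samples (λ v → proj₁ (dominated i r v)) (λ v → proj₂ (dominated i r v)) (sum-Pⁱ i r) p a
            (Sampling.samples (λ v → proj₁ (dominated j r v)) (λ v → proj₂ (dominated j r v)) (sum-Pⁱ j r) q b good-zero)
          ⁅ r ⁆ (λ u → c * δ r u)
          (ℕ.≤-trans (ℕ.≤-reflexive (≡.cong₂ (λ k l → k ℕ.+ (p ℕ.+ l)) (Subset.∣⁅x⁆∣≡1 r) (ℕ.+-identityʳ q))) size)
          (λ u u∉ → trans (*-congˡ (δ-supported r u u∉)) (zeroʳ c))))
        where
        p′ q′ : Carrier
        p′ = fromℕ p
        q′ = fromℕ q

        rooted : Fin m → Matrix m
        rooted r y z = (0# + q′ * (b * b * covariance (Pⁱ j r) (Qⁱ j r) y z) + p′ * (a * a * covariance (Pⁱ i r) (Qⁱ i r) y z)) +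
          (c * δ r y + (0# + q′ * (b * Qⁱ j r y) + p′ * (a * Qⁱ i r y))) * (c * δ r z + (0# + q′ * (b * Qⁱ j r z) + p′ * (a * Qⁱ i r z)))

        -- The root is written as the end of a walk of length 0, so that `meet` evaluates all nine
        -- products in the square of the mean.
        mean : Fin m → Fin m → Carrier
        mean r y = c * Qⁱ 0 r y + p′ * a * Qⁱ i r y + q′ * b * Qⁱ j r y

        entry : ∀ y z → sum (λ r → μ r * rooted r y z) ≈ _
        entry y z = begin
          sum (λ r → μ r * rooted r y z)
            ≈⟨ sum-cong (λ r → split (μ r) p′ q′ a b c (covariance (Pⁱ i r) (Qⁱ i r) y z) (covariance (Pⁱ j r) (Qⁱ j r) y z)
                 (δ r y) (δ r z) (Qⁱ i r y) (Qⁱ i r z) (Qⁱ j r y) (Qⁱ j r z)) ⟩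
          sum (λ r → p′ * (a * a) * (μ r * covariance (Pⁱ i r) (Qⁱ i r) y z) + q′ * (b * b) * (μ r * covariance (Pⁱ j r) (Qⁱ j r) y z) +
                     1# * (μ r * (mean r y * mean r z)))
            ≈⟨ sum-linear₃ (p′ * (a * a)) (q′ * (b * b)) 1# (λ r → μ r * covariance (Pⁱ i r) (Qⁱ i r) y z)
                 (λ r → μ r * covariance (Pⁱ j r) (Qⁱ j r) y z) (λ r → μ r * (mean r y * mean r z)) ⟩
          p′ * (a * a) * sum (λ r → μ r * covariance (Pⁱ i r) (Qⁱ i r) y z) + q′ * (b * b) * sum (λ r → μ r * covariance (Pⁱ j r) (Qⁱ j r) y z) +
            1# * sum (λ r → μ r * (mean r y * mean r z))
            ≈⟨ +-cong (+-cong (*-congˡ (sum-covariance i y z)) (*-congˡ (sum-covariance j y z))) (*-congˡ (mean-square y z)) ⟩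
          p′ * (a * a) * (T 0 y z - T (i ℕ.+ i) y z) + q′ * (b * b) * (T 0 y z - T (j ℕ.+ j) y z) +
            1# * (c * (c * T 0 y z + p′ * a * T i y z + q′ * b * T j y z) +
                  p′ * a * (c * T i y z + p′ * a * T (i ℕ.+ i) y z + q′ * b * T (i ℕ.+ j) y z) +
                  q′ * b * (c * T j y z + p′ * a * T (i ℕ.+ j) y z + q′ * b * T (j ℕ.+ j) y z))
            ≈⟨ +-congˡ (solve 9 (λ c α β t ti tj tii tij tjj →
                 :1 :* (c :* (c :* t :+ α :* ti :+ β :* tj) :+ α :* (c :* ti :+ α :* tii :+ β :* tij) :+ β :* (c :* tj :+ α :* tij :+ β :* tjj))
                 := c :* c :* t :+ α :* α :* tii :+ β :* β :* tjj :+ :2 :* (c :* α :* ti :+ c :* β :* tj :+ α :* β :* tij))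
                 refl c (p′ * a) (q′ * b) (T 0 y z) (T i y z) (T j y z) (T (i ℕ.+ i) y z) (T (i ℕ.+ j) y z) (T (j ℕ.+ j) y z)) ⟩
          (p′ * (a * a) * (T 0 y z - T (i ℕ.+ i) y z) + q′ * (b * b) * (T 0 y z - T (j ℕ.+ j) y z)) +
            (c * c * T 0 y z + (p′ * a) * (p′ * a) * T (i ℕ.+ i) y z + (q′ * b) * (q′ * b) * T (j ℕ.+ j) y z +
             (1# + 1#) * (c * (p′ * a) * T i y z + c * (q′ * b) * T j y z + (p′ * a) * (q′ * b) * T (i ℕ.+ j) y z)) ∎
          where
          open ≈-Reasoning
          split : ∀ m p q a b c Ci Cj dy dz iy iz jy jz →
            m * ((0# + q * (b * b * Cj) + p * (a * a * Ci)) +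
                 (c * dy + (0# + q * (b * jy) + p * (a * iy))) * (c * dz + (0# + q * (b * jz) + p * (a * iz)))) ≈
            p * (a * a) * (m * Ci) + q * (b * b) * (m * Cj) + 1# * (m * ((c * dy + p * a * iy + q * b * jy) * (c * dz + p * a * iz + q * b * jz)))
          split m p q a b c Ci Cj dy dz iy iz jy jz = trans
            (solve 6 (λ m q p b² a² L → m :* ((:con +0 :+ q :* b² :+ p :* a²) :+ L) := p :* (m :* a²) :+ q :* (m :* b²) :+ :1 :* (m :* L))
              refl m q p (b * b * Cj) (a * a * Ci) _)
            (+-cong (+-cong (solve 4 (λ m p a C → p :* (m :* (a :* C)) := p :* a :* (m :* C)) refl m p (a * a) Ci)
                            (solve 4 (λ m p a C → p :* (m :* (a :* C)) := p :* a :* (m :* C)) refl m q (b * b) Cj))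
                    (*-congˡ (*-congˡ (*-cong (line dy iy jy) (line dz iz jz)))))
            where
            line : ∀ d i j → c * d + (0# + q * (b * j) + p * (a * i)) ≈ c * d + p * a * i + q * b * j
            line d i j = solve 8 (λ c d p a i q b j → c :* d :+ (:con +0 :+ q :* (b :* j) :+ p :* (a :* i)) := c :* d :+ p :* a :* i :+ q :* b :* j)
              refl c d p a i q b j

          meets : ∀ e y z → sum (λ r → μ r * (Qⁱ e r y * mean r z)) ≈ c * T (e ℕ.+ 0) y z + p′ * a * T (e ℕ.+ i) y z + q′ * b * T (e ℕ.+ j) y z
          meets e y z = begin
            sum (λ r → μ r * (Qⁱ e r y * mean r z))
              ≈⟨ sum-cong (λ r → solve 8 (λ m x c α β u v w → m :* (x :* (c :* u :+ α :* v :+ β :* w)) :=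
                   c :* (m :* (x :* u)) :+ α :* (m :* (x :* v)) :+ β :* (m :* (x :* w)))
                   refl (μ r) (Qⁱ e r y) c (p′ * a) (q′ * b) (Qⁱ 0 r z) (Qⁱ i r z) (Qⁱ j r z)) ⟩
            sum (λ r → c * (μ r * (Qⁱ e r y * Qⁱ 0 r z)) + p′ * a * (μ r * (Qⁱ e r y * Qⁱ i r z)) + q′ * b * (μ r * (Qⁱ e r y * Qⁱ j r z)))
              ≈⟨ sum-linear₃ c (p′ * a) (q′ * b) (λ r → μ r * (Qⁱ e r y * Qⁱ 0 r z)) (λ r → μ r * (Qⁱ e r y * Qⁱ i r z)) (λ r → μ r * (Qⁱ e r y * Qⁱ j r z)) ⟩
            c * sum (λ r → μ r * (Qⁱ e r y * Qⁱ 0 r z)) + p′ * a * sum (λ r → μ r * (Qⁱ e r y * Qⁱ i r z)) + q′ * b * sum (λ r → μ r * (Qⁱ e r y * Qⁱ j r z))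
              ≈⟨ +-cong (+-cong (*-congˡ (meet e 0 y z)) (*-congˡ (meet e i y z))) (*-congˡ (meet e j y z)) ⟩
            c * T (e ℕ.+ 0) y z + p′ * a * T (e ℕ.+ i) y z + q′ * b * T (e ℕ.+ j) y z ∎

          mean-square : ∀ y z → sum (λ r → μ r * (mean r y * mean r z)) ≈
            c * (c * T 0 y z + p′ * a * T i y z + q′ * b * T j y z) +
            p′ * a * (c * T i y z + p′ * a * T (i ℕ.+ i) y z + q′ * b * T (i ℕ.+ j) y z) +
            q′ * b * (c * T j y z + p′ * a * T (i ℕ.+ j) y z + q′ * b * T (j ℕ.+ j) y z)
          mean-square y z = begin
            sum (λ r → μ r * (mean r y * mean r z))
              ≈⟨ sum-cong (λ r → solve 8 (λ m x c α β u v w → m :* ((c :* u :+ α :* v :+ β :* w) :* x) :=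
                   c :* (m :* (u :* x)) :+ α :* (m :* (v :* x)) :+ β :* (m :* (w :* x)))
                   refl (μ r) (mean r z) c (p′ * a) (q′ * b) (Qⁱ 0 r y) (Qⁱ i r y) (Qⁱ j r y)) ⟩
            sum (λ r → c * (μ r * (Qⁱ 0 r y * mean r z)) + p′ * a * (μ r * (Qⁱ i r y * mean r z)) + q′ * b * (μ r * (Qⁱ j r y * mean r z)))
              ≈⟨ sum-linear₃ c (p′ * a) (q′ * b) (λ r → μ r * (Qⁱ 0 r y * mean r z)) (λ r → μ r * (Qⁱ i r y * mean r z)) (λ r → μ r * (Qⁱ j r y * mean r z)) ⟩
            c * sum (λ r → μ r * (Qⁱ 0 r y * mean r z)) + p′ * a * sum (λ r → μ r * (Qⁱ i r y * mean r z)) + q′ * b * sum (λ r → μ r * (Qⁱ j r y * mean r z))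
              ≈⟨ +-cong (+-cong (*-congˡ (meets 0 y z)) (*-congˡ (meets i y z))) (*-congˡ (meets j y z)) ⟩
            c * (c * T 0 y z + p′ * a * T i y z + q′ * b * T j y z) +
            p′ * a * (c * T (i ℕ.+ 0) y z + p′ * a * T (i ℕ.+ i) y z + q′ * b * T (i ℕ.+ j) y z) +
            q′ * b * (c * T (j ℕ.+ 0) y z + p′ * a * T (j ℕ.+ i) y z + q′ * b * T (j ℕ.+ j) y z)
              ≡⟨ ≡.cong₂ (λ s t → c * (c * T 0 y z + p′ * a * T i y z + q′ * b * T j y z) +
                   p′ * a * (c * T s y z + p′ * a * T (i ℕ.+ i) y z + q′ * b * T (i ℕ.+ j) y z) +
                   q′ * b * (c * T (proj₁ t) y z + p′ * a * T (proj₂ t) y z + q′ * b * T (j ℕ.+ j) y z))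
                   (ℕ.+-identityʳ i) (≡.cong₂ _,_ (ℕ.+-identityʳ j) (ℕ.+-comm j i)) ⟩
            c * (c * T 0 y z + p′ * a * T i y z + q′ * b * T j y z) +
            p′ * a * (c * T i y z + p′ * a * T (i ℕ.+ i) y z + q′ * b * T (i ℕ.+ j) y z) +
            q′ * b * (c * T j y z + p′ * a * T (i ℕ.+ j) y z + q′ * b * T (j ℕ.+ j) y z) ∎

-- Spectral decay of the powers of a signed walk.

module WalkSpectra (ℝ : CompleteOrderedField) where
  open MatrixPowers ℝ

  module SpectralDecay {m} (walk : SignedWalk m) where
    open OrderedField ℝ
    open FiniteSums ℝ
    open LocalCones ℝ
    open SpectralBound ℝ
    open SignedWalk walk
    open WalkForms.Walks ℝ walk
    open WeightedForms.WeightedSpectralBound ℝ μ 0≤μ μ≤1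

    quad-combination : ∀ {n} c (A B : Matrix n) f → quad (λ y z → c * A y z + B y z) f ≈ c * quad A f + quad B f
    quad-combination c A B f = begin
      ⟨ f , (λ y → sum λ z → (c * A y z + B y z) * f z) ⟩
        ≈⟨ ⟨⟩-cong {f = f} (λ _ → refl) (λ y → trans
             (sum-cong (λ z → solve 4 (λ c a b f → (c :* a :+ b) :* f := c :* (a :* f) :+ :1 :* (b :* f)) refl c (A y z) (B y z) (f z)))
             (sum-linear c 1# (λ z → A y z * f z) (λ z → B y z * f z))) ⟩
      ⟨ f , (λ y → c * (A · f) y + 1# * (B · f) y) ⟩   ≈⟨ ⟨⟩-linearʳ c 1# f (A · f) (B · f) ⟩
      c * quad A f + 1# * quad B f                     ≈⟨ +-congˡ (*-identityˡ _) ⟩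
      c * quad A f + quad B f                          ∎
      where open ≈-Reasoning

    -- The semantic model. In it `T≼I` and `-T≼I` become true inequalities between quadratic forms,
    -- which bound the supremum behind `rayleigh-bound`; the index 2 is the locality of the squares
    -- they use.
    psdCone : LocalCone m 2
    psdCone = record
      { Holds   = λ A → ∀ f → 0# ≤ quad A f
      ; resp-≈  = λ A≈B HA f → ≤-respʳ (⟨⟩-cong {f = f} (λ _ → refl) (λ y → sum-cong (λ z → *-congʳ (A≈B y z)))) (HA f)
      ; combine = λ c A 0≤c HA f → mixture c A 0≤c HA f
      ; outer   = λ _ g _ _ f → ≤-respʳ (sym (outer-square g f)) (square-nonneg ⟨ g , f ⟩)
      }
      where
      mixture : ∀ {l} (c : Fin l → Carrier) (A : Fin l → Matrix m) → (∀ i → 0# ≤ c i) → (∀ i f → 0# ≤ quad (A i) f) →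
                    ∀ f → 0# ≤ quad (λ y z → sum λ i → c i * A i y z) f
      mixture {zero}  c A 0≤c HA f = ≤-reflexive (sym (sum-0 λ y →
        trans (*-congˡ (sum-0 λ z → zeroˡ (f z))) (zeroʳ (f y))))
      mixture {suc l} c A 0≤c HA f = ≤-respʳ (sym (quad-combination (c zero) (A zero) (λ y z → sum λ i → c (suc i) * A (suc i) y z) f))
        (+-nonneg (*-nonneg (0≤c zero) (HA zero f)) (mixture (c ∘ suc) (A ∘ suc) (0≤c ∘ suc) (HA ∘ suc) f))

      outer-square : ∀ g f → quad (λ y z → g y * g z) f ≈ ⟨ g , f ⟩ * ⟨ g , f ⟩
      outer-square g f = begin
        ⟨ f , (λ y → sum λ z → (g y * g z) * f z) ⟩
          ≈⟨ sum-cong (λ y → trans (*-congˡ (trans (sum-cong (λ z → *-assoc (g y) (g z) (f z))) (sym (*-distribˡ-sum (g y) (λ z → g z * f z)))))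
               (solve 3 (λ f g s → f :* (g :* s) := s :* (g :* f)) refl (f y) (g y) ⟨ g , f ⟩)) ⟩
        sum (λ y → ⟨ g , f ⟩ * (g y * f y))   ≈⟨ *-distribˡ-sum ⟨ g , f ⟩ (λ y → g y * f y) ⟨
        ⟨ g , f ⟩ * ⟨ g , f ⟩                 ∎
        where open ≈-Reasoning

    T₁ : Matrix m
    T₁ u v = μ u * Q u v

    T-1 : ∀ u v → T 1 u v ≈ T₁ u v
    T-1 u v = *-congˡ (power-1 Q u v)

    T₁-sym : Symmetric T₁
    T₁-sym = Q-reversible

    T₁-· : ∀ f u → (T₁ · f) u ≈ μ u * (Q · f) u
    T₁-· f u = trans (sum-cong (λ v → *-assoc (μ u) (Q u v) (f v))) (sym (*-distribˡ-sum (μ u) (λ v → Q u v * f v)))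

    quad-neg : ∀ (A : Matrix m) f → quad (λ u v → - A u v) f ≈ - quad A f
    quad-neg A f = trans (⟨⟩-cong {f = f} (λ _ → refl) (λ u → sum-cong (λ v →
        solve 2 (λ a f → (:- a) :* f := (:- :1) :* (a :* f) :+ :con +0 :* (a :* f)) refl (A u v) (f v))))
      (trans (⟨⟩-cong {f = f} (λ _ → refl) (λ u → sum-linear (- 1#) 0# (λ v → A u v * f v) (λ v → A u v * f v)))
        (trans (⟨⟩-linearʳ (- 1#) 0# f (A · f) (A · f))
          (solve 1 (λ q → (:- :1) :* q :+ :con +0 :* q := :- q) refl (quad A f))))

    quad-I : ∀ f → quad (T 0) f ≈ W f
    quad-I f = sum-cong λ u → trans (*-congˡ (trans (sum-cong (λ v → *-assoc (μ u) (δ u v) (f v)))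
        (trans (sym (*-distribˡ-sum (μ u) (λ v → δ u v * f v))) (*-congˡ (sum-δ u f)))))
      (solve 2 (λ m f → f :* (m :* f) := m :* (f :* f)) refl (μ u) (f u))

    open LocalProofs psdCone using () renaming (T≼I to quad-I-T; -T≼I to quad-I+T)

    T₁≤W : ∀ f → quad T₁ f ≤ W f
    T₁≤W f = ≤-diff (quad-I-T ℕ.≤-refl 1 f) (begin
      quad (λ y z → T 0 y z - T 1 y z) f
        ≈⟨ ⟨⟩-cong {f = f} (λ _ → refl) (λ y → sum-cong (λ z → *-congʳ
             (trans (+-congˡ (-‿cong (T-1 y z))) (solve 2 (λ a b → a :- b := :1 :* a :+ :- b) refl (T 0 y z) (T₁ y z))))) ⟩
      quad (λ y z → 1# * T 0 y z + - T₁ y z) f   ≈⟨ quad-combination 1# (T 0) (λ y z → - T₁ y z) f ⟩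
      1# * quad (T 0) f + quad (λ y z → - T₁ y z) f ≈⟨ +-cong (trans (*-identityˡ _) (quad-I f)) (quad-neg T₁ f) ⟩
      W f - quad T₁ f ∎)
      where open ≈-Reasoning

    -T₁≤W : ∀ f → quad (λ u v → - T₁ u v) f ≤ W f
    -T₁≤W f = ≤-diff (quad-I+T ℕ.≤-refl 1 f) (begin
      quad (λ y z → T 0 y z + T 1 y z) f
        ≈⟨ ⟨⟩-cong {f = f} (λ _ → refl) (λ y → sum-cong (λ z → *-congʳ
             (+-cong (sym (*-identityˡ (T 0 y z))) (T-1 y z)))) ⟩
      quad (λ y z → 1# * T 0 y z + T₁ y z) f   ≈⟨ quad-combination 1# (T 0) T₁ f ⟩
      1# * quad (T 0) f + quad T₁ f            ≈⟨ +-cong (trans (*-identityˡ _) (quad-I f)) (solve 1 (λ a → a := :- (:- a)) refl _) ⟩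
      W f - (- quad T₁ f)                      ≈⟨ +-congˡ (-‿cong (quad-neg T₁ f)) ⟨
      W f - quad (λ u v → - T₁ u v) f ∎)
      where open ≈-Reasoning

    W-combination : ∀ ρ s g → W (λ u → ρ * g u + s * (Q · g) u) ≈
                    ρ * ρ * W g + (1# + 1#) * (ρ * s) * quad T₁ g + s * s * W (Q · g)
    W-combination ρ s g = begin
      sum (λ u → μ u * ((ρ * g u + s * (Q · g) u) * (ρ * g u + s * (Q · g) u)))
        ≈⟨ sum-cong (λ u → trans
             (solve 5 (λ m ρ s g q → m :* ((ρ :* g :+ s :* q) :* (ρ :* g :+ s :* q))
               := ρ :* ρ :* (m :* (g :* g)) :+ :2 :* (ρ :* s) :* (g :* (m :* q)) :+ s :* s :* (m :* (q :* q))) refl (μ u) ρ s (g u) ((Q · g) u))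
             (+-congʳ (+-congˡ (*-congˡ (*-congˡ (sym (T₁-· g u))))))) ⟩
      sum (λ u → ρ * ρ * (μ u * (g u * g u)) + (1# + 1#) * (ρ * s) * (g u * (T₁ · g) u) + s * s * (μ u * ((Q · g) u * (Q · g) u)))
        ≈⟨ sum-linear₃ (ρ * ρ) ((1# + 1#) * (ρ * s)) (s * s) (λ u → μ u * (g u * g u)) (λ u → g u * (T₁ · g) u) (λ u → μ u * ((Q · g) u * (Q · g) u)) ⟩
      ρ * ρ * W g + (1# + 1#) * (ρ * s) * quad T₁ g + s * s * W (Q · g) ∎
      where open ≈-Reasoning

    quad-T₁-combination : ∀ ρ s g → quad T₁ (λ u → ρ * g u + s * (Q · g) u) ≈
                          ρ * ρ * quad T₁ g + (1# + 1#) * (ρ * s) * W (Q · g) + s * s * quad T₁ (Q · g)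
    quad-T₁-combination ρ s g = trans (quad-linear T₁-sym ρ s g (Q · g)) (+-congʳ (+-congˡ (*-congˡ
      (sum-cong (λ u → trans (*-congˡ (T₁-· g u)) (solve 2 (λ m q → q :* (m :* q) := m :* (q :* q)) refl (μ u) ((Q · g) u)))))))

    module _ {ρ} (0≤ρ : 0# ≤ ρ)
      (eigen : ∀ t f → Nonzero f → (∀ u → (Q · f) u ≈ t * f u) → t * t ≤ ρ * ρ) where

      -- Dividing row `u` by `μ u` turns the generalised eigenvalue problem for `T₁` with weight `μ`
      -- into the ordinary one for `Q`, to which `eigen` applies.
      T₁≤ρW : ∀ f → quad T₁ f ≤ ρ * W f
      T₁≤ρW = rayleigh-bound T₁-sym T₁≤W 0≤ρ λ t f f≉0 Tf≈ → eigen t f f≉0 λ u →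
        μ-cancel u (trans (sym (T₁-· f u)) (trans (Tf≈ u) (solve 3 (λ t m f → t :* (m :* f) := m :* (t :* f)) refl t (μ u) (f u))))
        where
        μ-cancel : ∀ u {x y} → μ u * x ≈ μ u * y → x ≈ y
        μ-cancel u eq = ≤-antisym (*-cancelˡ-≤ (0<μ u) (≤-reflexive eq)) (*-cancelˡ-≤ (0<μ u) (≤-reflexive (sym eq)))

      -- An eigenvalue t of the negated problem is the eigenvalue - t of `Q`, and `eigen` only sees
      -- the square.
      -T₁≤ρW : ∀ f → - quad T₁ f ≤ ρ * W f
      -T₁≤ρW f = ≤-respˡ (quad-neg T₁ f) (rayleigh-bound (λ u v → -‿cong (T₁-sym u v)) -T₁≤W 0≤ρ (λ t f f≉0 Tf≈ →
        ≤-respˡ (solve 1 (λ t → (:- t) :* (:- t) := t :* t) refl t) (eigen (- t) f f≉0 λ u →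
          ≤-antisym (*-cancelˡ-≤ (0<μ u) (≤-reflexive (eq t f Tf≈ u))) (*-cancelˡ-≤ (0<μ u) (≤-reflexive (sym (eq t f Tf≈ u)))))) f)
        where
        eq : ∀ t f → (∀ u → ((λ u v → - T₁ u v) · f) u ≈ t * (μ u * f u)) → ∀ u → μ u * (Q · f) u ≈ μ u * (- t * f u)
        eq t f Tf≈ u = begin
          μ u * (Q · f) u        ≈⟨ T₁-· f u ⟨
          (T₁ · f) u             ≈⟨ solve 1 (λ a → a := :con +0 :- (:con +0 :- a)) refl _ ⟩
          0# - (0# - (T₁ · f) u) ≈⟨ +-congˡ (-‿cong (+-congʳ (sum-0 {m} {λ _ → 0#} (λ _ → refl)))) ⟨
          0# - (sum {m} (λ _ → 0#) - (T₁ · f) u) ≈⟨ +-congˡ (-‿cong (sum-diff (λ _ → 0#) (λ v → T₁ u v * f v))) ⟨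
          0# - sum (λ v → 0# - T₁ u v * f v)
            ≈⟨ +-congˡ (-‿cong (sum-cong (λ v → solve 2 (λ a f → :con +0 :- a :* f := (:- a) :* f) refl (T₁ u v) (f v)))) ⟩
          0# - ((λ u v → - T₁ u v) · f) u ≈⟨ +-congˡ (-‿cong (Tf≈ u)) ⟩
          0# - t * (μ u * f u)   ≈⟨ solve 3 (λ t m f → :con +0 :- t :* (m :* f) := m :* ((:- t) :* f)) refl t (μ u) (f u) ⟩
          μ u * (- t * f u)      ∎
          where open ≈-Reasoning

      -- At ρ = 0 the form of T₁ vanishes identically, and polarising it at g and Q g gives W (Q g) = 0.
      ρ-pos : ¬ (∀ u v → Q u v ≈ 0#) → 0# < ρ
      ρ-pos Q≉0 = ≰⇒> λ ρ≤0 → Q≉0 λ u v → trans (sym (trans (sum-cong (λ w → *-congˡ (δ-sym v w))) (power-1 Q u v)))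
        (square-zero (*-cancelˡ-≤ (0<μ u) (≤-trans (term≤sum (λ r → *-nonneg (0≤μ r) (square-nonneg ((Q · δ v) r))) u)
          (≤-trans (WQ≤0 ρ≤0 (δ v)) (≤-reflexive (sym (zeroʳ _)))))))
        where
        quad≈0 : ρ ≤ 0# → ∀ f → quad T₁ f ≈ 0#
        quad≈0 ρ≤0 f = ≤-antisym (≤-trans (T₁≤ρW f) ρW≤0)
          (≤-diff (diff-nonneg (≤-trans (-T₁≤ρW f) ρW≤0)) (solve 1 (λ a → :con +0 :- (:- a) := a :- :con +0) refl (quad T₁ f)))
          where
          ρW≤0 : ρ * W f ≤ 0#
          ρW≤0 = ≤-diff (*-nonneg (neg-nonneg ρ≤0) (W-nonneg f)) (solve 2 (λ ρ W → (:- ρ) :* W := :con +0 :- ρ :* W) refl ρ (W f))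
        WQ≤0 : ρ ≤ 0# → ∀ g → W (Q · g) ≤ 0#
        WQ≤0 ρ≤0 g = *-cancelˡ-≤ 0<2 (≤-reflexive (begin
          two * W (Q · g)
            ≈⟨ solve 3 (λ w a b → :2 :* w := (:1 :* :1 :* a :+ :2 :* (:1 :* :1) :* w :+ :1 :* :1 :* b) :- a :- b) refl (W (Q · g)) (quad T₁ g) (quad T₁ (Q · g)) ⟩
          (1# * 1# * quad T₁ g + two * (1# * 1#) * W (Q · g) + 1# * 1# * quad T₁ (Q · g)) - quad T₁ g - quad T₁ (Q · g)
            ≈⟨ +-congʳ (+-congʳ (quad-T₁-combination 1# 1# g)) ⟨
          quad T₁ (λ u → 1# * g u + 1# * (Q · g) u) - quad T₁ g - quad T₁ (Q · g)
            ≈⟨ +-cong (+-cong (quad≈0 ρ≤0 _) (-‿cong (quad≈0 ρ≤0 g))) (-‿cong (quad≈0 ρ≤0 (Q · g))) ⟩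
          0# - 0# - 0#   ≈⟨ solve 1 (λ t → :con +0 :- :con +0 :- :con +0 := t :* :con +0) refl two ⟩
          two * 0#       ∎))
          where
          open ≈-Reasoning
          two = 1# + 1#

      -- With h± = ρ g ± Q g, the bounds ± T₁ ≤ ρ W at h± add up to 2 ρ (ρ² W g - W (Q g)) ≥ 0.
      contraction : 0# < ρ → ∀ g → W (Q · g) ≤ ρ * ρ * W g
      contraction 0<ρ g = *-cancelˡ-≤ (*-pos 0<2 0<ρ) (≤-diff
        (+-nonneg (diff-nonneg (T₁≤ρW (λ u → ρ * g u + 1# * (Q · g) u))) (diff-nonneg (-T₁≤ρW (λ u → ρ * g u + - 1# * (Q · g) u))))
        (begin
          (ρ * W (h 1#) - quad T₁ (h 1#)) + (ρ * W (h (- 1#)) - - quad T₁ (h (- 1#)))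
            ≈⟨ +-cong (+-cong (*-congˡ (W-combination ρ 1# g)) (-‿cong (quad-T₁-combination ρ 1# g)))
                      (+-cong (*-congˡ (W-combination ρ (- 1#) g)) (-‿cong (-‿cong (quad-T₁-combination ρ (- 1#) g)))) ⟩
          _ ≈⟨ solve 5 (λ ρ w wq t tq →
                 (ρ :* (ρ :* ρ :* w :+ :2 :* (ρ :* :1) :* t :+ :1 :* :1 :* wq) :- (ρ :* ρ :* t :+ :2 :* (ρ :* :1) :* wq :+ :1 :* :1 :* tq)) :+
                 (ρ :* (ρ :* ρ :* w :+ :2 :* (ρ :* (:- :1)) :* t :+ (:- :1) :* (:- :1) :* wq) :-
                   (:- (ρ :* ρ :* t :+ :2 :* (ρ :* (:- :1)) :* wq :+ (:- :1) :* (:- :1) :* tq)))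
                 := :2 :* ρ :* (ρ :* ρ :* w) :- :2 :* ρ :* wq) refl ρ (W g) (W (Q · g)) (quad T₁ g) (quad T₁ (Q · g)) ⟩
          (1# + 1#) * ρ * (ρ * ρ * W g) - (1# + 1#) * ρ * W (Q · g) ∎))
        where
        open ≈-Reasoning
        h : Carrier → Fin m → Carrier
        h s u = ρ * g u + s * (Q · g) u

      -- A column of `Qⁱ t` is `Q` applied t times to an indicator function, whose weighted square
      -- norm is `μ u`; each application contracts.
      decay : 0# < ρ → ∀ t u → W (λ v → Qⁱ t v u) ≤ (ρ * ρ) ^ t * μ u
      decay 0<ρ zero    u = ≤-reflexive (begin
        sum (λ v → μ v * (δ v u * δ v u))   ≈⟨ sum-cong (λ v → solve 2 (λ m d → m :* (d :* d) := d :* (d :* m)) refl (μ v) (δ v u)) ⟩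
        sum (λ v → δ v u * (δ v u * μ v))   ≈⟨ sum-δˡ u (λ v → δ v u * μ v) ⟩
        δ u u * μ u                         ≈⟨ *-congʳ (δ-refl u) ⟩
        1# * μ u                            ∎)
        where open ≈-Reasoning
      decay 0<ρ (suc t) u = ≤-trans (contraction 0<ρ (λ v → Qⁱ t v u))
        (≤-trans (*-monoʳ-≤ (square-nonneg ρ) (decay 0<ρ t u)) (≤-reflexive (sym (*-assoc _ _ _))))

      -- Each entry of T t is bounded by AM-GM against c μ u μ v; the squares of
      -- the entries in one row of T t are then summed with decay.
      module _ {R} (𝒞 : LocalCone m R) where
        open LocalCone 𝒞
        open ConeLemmas 𝒞

        high-power : 2 ℕ.≤ R → 0# < ρ → ∀ t c → 0# < c → (∀ u → (ρ * ρ) ^ t ≤ c * c * μ u) →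
                     Holds (λ y z → c * T 0 y z - T t y z)
        high-power 2≤R 0<ρ t c 0<c small = unscale two 0<2 entry
            (add (two-local 2≤R {V} {λ u v → two * T t u v} V-sym (λ u v → *-congˡ (T-sym t u v))
                    (λ u v → ≤-respʳ (trans (V± u v 1# (*-identityˡ 1#)) (+-congˡ (*-congˡ (*-identityˡ (T t u v))))) (*-nonneg (0≤i u v) (square-nonneg _)))
                    (λ u v → ≤-respʳ (trans (V± u v (- 1#) (solve 0 ((:- :1) :* (:- :1) := :1) refl)) (solve 2 (λ a t → a :+ :2 :* ((:- :1) :* t) := a :- :2 :* t) refl (V u v) (T t u v)))
                               (*-nonneg (0≤i u v) (square-nonneg _))))
                 (diagonal 2≤R (λ y → two * (c * μ y) - sum (V y)) (λ y → diff-nonneg (row y))))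
          where
          two = 1# + 1#
          i : Matrix m
          i u v = μ u ⁻¹ * μ v ⁻¹ * c ⁻¹
          0≤i : ∀ u v → 0# ≤ i u v
          0≤i u v = proj₁ (*-pos (*-pos (⁻¹-pos (0<μ u)) (⁻¹-pos (0<μ v))) (⁻¹-pos 0<c))
          b : Matrix m
          b u v = c * (μ u * μ v)
          i*b : ∀ u v → i u v * b u v ≈ 1#
          i*b u v = begin
            i u v * b u v ≈⟨ solve 6 (λ u v c u′ v′ c′ → (u′ :* v′ :* c′) :* (c :* (u :* v)) := (u :* u′) :* (v :* v′) :* (c :* c′)) refl
                               (μ u) (μ v) c (μ u ⁻¹) (μ v ⁻¹) (c ⁻¹) ⟩
            (μ u * μ u ⁻¹) * (μ v * μ v ⁻¹) * (c * c ⁻¹)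
              ≈⟨ *-cong (*-cong (*-inversePos (0<μ u)) (*-inversePos (0<μ v))) (*-inversePos 0<c) ⟩
            1# * 1# * 1# ≈⟨ trans (*-congʳ (*-identityˡ 1#)) (*-identityˡ 1#) ⟩
            1# ∎
            where open ≈-Reasoning
          -- With `i` the inverse of `b`, this is T²/b + b, so that V ± 2 T = (T ± b)²/b is
          -- nonnegative: AM-GM with the equality case written out.
          V : Matrix m
          V u v = i u v * (T t u v * T t u v) + b u v
          V-sym : Symmetric V
          V-sym u v = +-cong (*-cong (*-congʳ (*-comm _ _)) (*-cong (T-sym t u v) (T-sym t u v))) (*-congˡ (*-comm _ _))
          V± : ∀ u v s → s * s ≈ 1# → i u v * ((T t u v + s * b u v) * (T t u v + s * b u v)) ≈ V u v + two * (s * T t u v)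
          V± u v s ss≈1 = begin
            i u v * ((T t u v + s * b u v) * (T t u v + s * b u v))
              ≈⟨ solve 4 (λ i t s b → i :* ((t :+ s :* b) :* (t :+ s :* b)) :=
                   i :* (t :* t) :+ (s :* s) :* ((i :* b) :* b) :+ :2 :* (s :* ((i :* b) :* t))) refl (i u v) (T t u v) s (b u v) ⟩
            i u v * (T t u v * T t u v) + (s * s) * ((i u v * b u v) * b u v) + two * (s * ((i u v * b u v) * T t u v))
              ≈⟨ +-cong (+-congˡ (*-cong ss≈1 (*-congʳ (i*b u v)))) (*-congˡ (*-congˡ (*-congʳ (i*b u v)))) ⟩
            i u v * (T t u v * T t u v) + 1# * (1# * b u v) + two * (s * (1# * T t u v))
              ≈⟨ +-cong (+-congˡ (trans (*-identityˡ _) (*-identityˡ _))) (*-congˡ (*-congˡ (*-identityˡ _))) ⟩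
            V u v + two * (s * T t u v) ∎
            where open ≈-Reasoning
          -- The b part of the row contributes c μ y exactly, since `μ` sums to 1; by `decay` and
          -- `small` the T²/b part contributes at most as much again. The remaining deficit is
          -- diagonal and nonnegative.
          row : ∀ y → sum (V y) ≤ two * (c * μ y)
          row y = ≤-respˡ (sym rowsum) (≤-diff (*-nonneg (proj₁ (*-pos (⁻¹-pos (0<μ y)) (⁻¹-pos 0<c)))
                    (diff-nonneg (≤-trans (decay 0<ρ t y) (*-monoˡ-≤ (0≤μ y) (small y))))) eq)
            where
            open ≈-Reasoning
            rowsum : sum (V y) ≈ μ y ⁻¹ * c ⁻¹ * W (λ v → Qⁱ t v y) + c * μ y
            rowsum = begin
              sum (V y)
                ≈⟨ sum-cong (λ v → +-cong (trans (*-congˡ (*-cong (T-sym t y v) (T-sym t y v)))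
                     (trans (solve 5 (λ y′ v′ v c′ q → (y′ :* v′ :* c′) :* ((v :* q) :* (v :* q)) := (y′ :* c′) :* ((v :* v′) :* (v :* (q :* q))))
                              refl (μ y ⁻¹) (μ v ⁻¹) (μ v) (c ⁻¹) (Qⁱ t v y))
                            (*-congˡ (trans (*-congʳ (*-inversePos (0<μ v))) (*-identityˡ _)))))
                     (sym (*-assoc c (μ y) (μ v)))) ⟩
              sum (λ v → (μ y ⁻¹ * c ⁻¹) * (μ v * (Qⁱ t v y * Qⁱ t v y)) + (c * μ y) * μ v)
                ≈⟨ sum-linear (μ y ⁻¹ * c ⁻¹) (c * μ y) (λ v → μ v * (Qⁱ t v y * Qⁱ t v y)) μ ⟩
              μ y ⁻¹ * c ⁻¹ * W (λ v → Qⁱ t v y) + c * μ y * sum μ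
                ≈⟨ +-congˡ (trans (*-congˡ Σμ≈1) (*-identityʳ _)) ⟩
              μ y ⁻¹ * c ⁻¹ * W (λ v → Qⁱ t v y) + c * μ y ∎
            eq : μ y ⁻¹ * c ⁻¹ * (c * c * μ y * μ y - W (λ v → Qⁱ t v y)) ≈ two * (c * μ y) - (μ y ⁻¹ * c ⁻¹ * W (λ v → Qⁱ t v y) + c * μ y)
            eq = begin
              μ y ⁻¹ * c ⁻¹ * (c * c * μ y * μ y - W (λ v → Qⁱ t v y))
                ≈⟨ solve 5 (λ y′ c′ c y w → y′ :* c′ :* (c :* c :* y :* y :- w) := (y :* y′) :* (c :* c′) :* (c :* y) :- y′ :* c′ :* w)
                     refl (μ y ⁻¹) (c ⁻¹) c (μ y) (W (λ v → Qⁱ t v y)) ⟩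
              (μ y * μ y ⁻¹) * (c * c ⁻¹) * (c * μ y) - μ y ⁻¹ * c ⁻¹ * W (λ v → Qⁱ t v y)
                ≈⟨ +-congʳ (*-congʳ (*-cong (*-inversePos (0<μ y)) (*-inversePos 0<c))) ⟩
              1# * 1# * (c * μ y) - μ y ⁻¹ * c ⁻¹ * W (λ v → Qⁱ t v y)
                ≈⟨ solve 2 (λ x w → :1 :* :1 :* x :- w := :2 :* x :- (w :+ x)) refl (c * μ y) (μ y ⁻¹ * c ⁻¹ * W (λ v → Qⁱ t v y)) ⟩
              two * (c * μ y) - (μ y ⁻¹ * c ⁻¹ * W (λ v → Qⁱ t v y) + c * μ y) ∎
          entry : ∀ y z → (δ y z * sum (V y) - two * T t y z) + δ y z * (two * (c * μ y) - sum (V y)) ≈ two * (c * T 0 y z - T t y z)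
          entry y z = solve 5 (λ d s t c m → (d :* s :- :2 :* t) :+ d :* (:2 :* (c :* m) :- s) := :2 :* (c :* (m :* d) :- t))
            refl (δ y z) (sum (V y)) (T t y z) c (μ y)

-- The approximately convex sequence of even walk forms.

module Chains (ℝ : CompleteOrderedField) where
  open OrderedField ℝ
  open MatrixPowers ℝ
  open LocalCones ℝ

  -- k is written `suc κ` since of the k² ordered pairs among k samples, k κ are pairs of distinct
  -- ones. After division by k, `κ` is the coefficient of the wanted form and the diagonal leaves a
  -- single `T 0`, up to the weights.
  module ConvexityChain {m} (walk : SignedWalk m) {R} (𝒞 : LocalCone m R) (κ : ℕ) (ℓ : ℕ) (size : suc κ ℕ.* ℓ ℕ.+ 1 ℕ.≤ R) (1≤ℓ : 1 ℕ.≤ ℓ)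
    {ε y : Carrier} (0<ε : 0# < ε) (ε-small : (1# + 1# + 1# + 1# + 1#) * ε ≤ 1# + 1#) (ε²y≈1 : ε * ε * y ≈ 1#)
    (k-lower : y ^ ℓ ≤ fromℕ (suc κ)) (k-upper : fromℕ κ ≤ y ^ ℓ) where
    open FiniteSums ℝ
    open SignedWalk walk
    open WalkForms.Walks ℝ walk
    open LocalCone 𝒞
    open ConeLemmas 𝒞
    open LocalProofs 𝒞

    private
      two three five x k κ′ : Carrier
      two   = 1# + 1#
      three = 1# + 1# + 1#
      five  = 1# + 1# + 1# + 1# + 1#
      x  = ε * ε
      k  = fromℕ (suc κ)
      κ′ = fromℕ κ

      :3 :5 : ∀ {n} → Polynomial n
      :3 = :1 :+ :1 :+ :1
      :5 = :1 :+ :1 :+ :1 :+ :1 :+ :1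

      0<k : 0# < k
      0<k = fromℕ-pos κ

      0<x : 0# < x
      0<x = *-pos 0<ε 0<ε

      0<y : 0# < y
      0<y = ≰⇒> λ y≤0 → <⇒≱ 0<1 (≤-respˡ ε²y≈1 (≤-diff (*-nonneg (proj₁ 0<x) (neg-nonneg y≤0))
        (solve 2 (λ x y → x :* (:- y) := :con +0 :- x :* y) refl x y)))

      k≤kℓ : suc κ ℕ.≤ suc κ ℕ.* ℓ
      k≤kℓ = ℕ.≤-trans (ℕ.≤-reflexive (≡.sym (ℕ.*-identityʳ (suc κ)))) (ℕ.*-monoʳ-≤ (suc κ) 1≤ℓ)

      size₁ : suc (suc κ ℕ.+ 0) ℕ.≤ R
      size₁ = ℕ.≤-trans (ℕ.≤-reflexive (≡.trans (≡.cong suc (ℕ.+-identityʳ (suc κ))) (ℕ.+-comm 1 (suc κ))))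
        (ℕ.≤-trans (ℕ.+-monoˡ-≤ 1 k≤kℓ) size)

      -- `convexity` draws two bunches of k walks. For ℓ = 1 the budget holds only one, and there
      -- `chain` consists of its base case.
      size₂ : 2 ℕ.≤ ℓ → suc (suc κ ℕ.+ suc κ) ℕ.≤ R
      size₂ 2≤ℓ = ℕ.≤-trans (ℕ.≤-reflexive (≡.trans (≡.cong (λ n → suc (suc κ ℕ.+ n)) (≡.sym (ℕ.+-identityʳ (suc κ))))
          (≡.trans (ℕ.+-comm 1 _) (≡.cong (ℕ._+ 1) (ℕ.*-comm 2 (suc κ))))))
        (ℕ.≤-trans (ℕ.+-monoˡ-≤ 1 (ℕ.*-monoʳ-≤ (suc κ) 2≤ℓ)) size)

      2≤R : 2 ℕ.≤ R
      2≤R = ℕ.≤-trans (ℕ.s≤s (ℕ.s≤s ℕ.z≤n)) size₁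

      scaled-identity : ∀ {c} → 0# ≤ c → Holds (λ u v → c * T 0 u v)
      scaled-identity {c} 0≤c = scale c 0≤c (identity-nonneg 2≤R)

      slack : 0# ≤ (two + two) - five * five * x
      slack = ≤-respʳ (solve 1 (λ e → (:2 :- :5 :* e) :* (:2 :+ :5 :* e) := (:2 :+ :2) :- :5 :* :5 :* (e :* e)) refl ε)
        (*-nonneg (diff-nonneg ε-small) (+-nonneg (proj₁ 0<2) (*-nonneg 0≤5 (proj₁ 0<ε))))
        where
        0≤5 : 0# ≤ five
        0≤5 = +-nonneg (+-nonneg (+-nonneg (+-nonneg 0≤1 0≤1) 0≤1) 0≤1) 0≤1

      0<5 : 0# < five
      0<5 = +-pos (+-pos (+-pos (+-pos 0<1 0≤1) 0≤1) 0≤1) 0≤1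

      -- Room for the base case of `chain`: of the error 1, ε goes to the last form and x to the
      -- lower bound on the form before it.
      base-slack : 0# ≤ 1# - ε - x
      base-slack = *-cancelˡ-nonneg (*-pos 0<5 0<5) (≤-respʳ
        (solve 1 (λ e → :5 :* (:2 :- :5 :* e) :+ ((:2 :+ :2) :- :5 :* :5 :* (e :* e)) :+ (:5 :+ :5 :+ :1) := :5 :* :5 :* (:1 :- e :- e :* e)) refl ε)
        (+-nonneg (+-nonneg (*-nonneg (proj₁ 0<5) (diff-nonneg ε-small)) slack)
          (+-nonneg (+-nonneg (proj₁ 0<5) (proj₁ 0<5)) 0≤1)))

      -- Room for the inductive step of `chain`: (1 + x)² is the error of one use of convexity, and
      -- 2 - 2 x is the excess of x (3 y^(j+1) - 2) over 3 y^j - 2.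
      step-slack : 0# ≤ two - two * x - (1# + x) * (1# + x)
      step-slack = *-cancelˡ-nonneg (*-pos 0<5 0<5) (≤-respʳ
        (solve 1 (λ x → let s = (:2 :+ :2) :- :5 :* :5 :* x in
          x :* s :+ :5 :* s :+ (:5 :+ (:5 :* (:2 :+ :2) :+ :1) :* x) := :5 :* :5 :* (:2 :- :2 :* x :- (:1 :+ x) :* (:1 :+ x))) refl x)
        (+-nonneg (+-nonneg (*-nonneg (proj₁ 0<x) slack) (*-nonneg (proj₁ 0<5) slack))
          (+-nonneg (proj₁ 0<5) (*-nonneg (+-nonneg (*-nonneg (proj₁ 0<5) (+-nonneg (proj₁ 0<2) (proj₁ 0<2))) 0≤1) (proj₁ 0<x)))))

    -- The local stand-in for nonnegativity of `T (i + i)`: the square of the sum of one bunch of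
    -- samples, the root having weight 0.
    even-nonneg : ∀ i → Holds (λ u v → T 0 u v + κ′ * T (i ℕ.+ i) u v)
    even-nonneg i = unscale k 0<k
      (λ u v → solve 5 (λ κ t ti t₀ tii → let k = :1 :+ κ in
        (k :* (:1 :* :1) :* (t :- tii) :+ :con +0 :* (:con +0 :* :con +0) :* (t :- t)) :+
        (:con +0 :* :con +0 :* t :+ (k :* :1) :* (k :* :1) :* tii :+ (:con +0 :* :con +0) :* (:con +0 :* :con +0) :* t :+
          :2 :* (:con +0 :* (k :* :1) :* ti :+ :con +0 :* (:con +0 :* :con +0) :* t :+ (k :* :1) :* (:con +0 :* :con +0) :* t₀))
        := k :* (t :+ κ :* tii)) refl κ′ (T 0 u v) (T i u v) (T (i ℕ.+ 0) u v) (T (i ℕ.+ i) u v))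
      (branching i 0 (suc κ) 0 1# 0# 0# size₁)

    -- The sampled square of x (Qⁱ X) - Qⁱ⁺² X at a random root. The cross term joins walks of
    -- lengths i and i + 2 into one of length 2 (i + 1), and 1 + x² is the cost of the two
    -- diagonals.
    convexity : 2 ℕ.≤ ℓ → ∀ i → Holds (λ u v →
      (1# + x * x) * T 0 u v + κ′ * (x * x) * T (i ℕ.+ i) u v + κ′ * T (suc (suc i) ℕ.+ suc (suc i)) u v - two * k * x * T (suc i ℕ.+ suc i) u v)
    convexity 2≤ℓ i = unscale k 0<k
      (λ u v → trans (+-congˡ (+-congˡ (*-congˡ (+-congˡ (*-congˡ (reflexive (≡.cong (λ n → T n u v) (ℕ.+-suc i (suc i)))))))))
        (solve 8 (λ κ x t a d ti tj mid → let k = :1 :+ κ ; o = :- :1 in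
        (k :* (x :* x) :* (t :- a) :+ k :* (o :* o) :* (t :- d)) :+
        (:con +0 :* :con +0 :* t :+ (k :* x) :* (k :* x) :* a :+ (k :* o) :* (k :* o) :* d :+
          :2 :* (:con +0 :* (k :* x) :* ti :+ :con +0 :* (k :* o) :* tj :+ (k :* x) :* (k :* o) :* mid))
        := k :* ((:1 :+ x :* x) :* t :+ κ :* (x :* x) :* a :+ κ :* d :- :2 :* k :* x :* mid))
        refl κ′ x (T 0 u v) (T (i ℕ.+ i) u v) (T (suc (suc i) ℕ.+ suc (suc i)) u v) (T i u v) (T (suc (suc i)) u v) (T (suc i ℕ.+ suc i) u v)))
      (branching i (suc (suc i)) (suc κ) (suc κ) x (- 1#) 0# (size₂ 2≤ℓ))

    -- A sampled form of 2 ε (s T 1) ≼ ε² T 0 + T 2: the root weight - k ε sets ε X r against the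
    -- mean of k signed neighbours. Taking `s` as the sample weight treats both signs of `T 1` at
    -- once.
    first-step : ∀ s → s * s ≈ 1# → Holds (λ u v → (1# + k * x) * T 0 u v + κ′ * T 2 u v - two * k * ε * (s * T 1 u v))
    first-step s ss≈1 = unscale k 0<k
      (λ u v → trans (+-cong (+-congʳ (*-congʳ (trans (*-congˡ ss≈1) (*-identityʳ k)))) (+-congʳ (+-congʳ (+-congˡ (*-congʳ (ks u v))))))
        (solve 6 (λ κ e s t t₁ t₂ → let k = :1 :+ κ ; c = :- (k :* e) in
        (k :* (t :- t₂) :+ :con +0 :* (:con +0 :* :con +0) :* (t :- t)) :+
        (c :* c :* t :+ k :* k :* t₂ :+ (:con +0 :* :con +0) :* (:con +0 :* :con +0) :* t :+
          :2 :* (c :* (k :* s) :* t₁ :+ c :* (:con +0 :* :con +0) :* t :+ (k :* s) :* (:con +0 :* :con +0) :* t₁))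
        := k :* ((:1 :+ k :* (e :* e)) :* t :+ κ :* t₂ :- :2 :* k :* e :* (s :* t₁)))
        refl κ′ ε s (T 0 u v) (T 1 u v) (T 2 u v)))
      (branching 1 0 (suc κ) 0 s 0# (- (k * ε)) size₁)
      where
      ks : ∀ u v → (k * s) * (k * s) ≈ k * k
      ks u v = trans (solve 2 (λ k s → (k :* s) :* (k :* s) := k :* k :* (s :* s)) refl k s) (trans (*-congˡ ss≈1) (*-identityʳ _))

    module _ (high : Holds (λ u v → ε * x ^ ℓ * T 0 u v - T (ℓ ℕ.+ ℓ) u v)) where

      -- Up to a factor, T (2i+2) - x T (2i) is a first difference of the rescaled sequence.
      -- Convexity bounds it by the next difference divided by x, so the errors E must satisfy E j +
      -- (1 + x)² ≤ x E (j+1). As x y = 1, E j = 3 y^j - 2 does, and E 0 = 1 suffices for the last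
      -- difference.
      chain : ∀ j i → suc i ℕ.+ j ≡ ℓ → Holds (λ u v →
        κ′ * x * T (i ℕ.+ i) u v + (three * y ^ j - two) * T 0 u v - κ′ * T (suc i ℕ.+ suc i) u v)
      chain zero i eq = resp-≈
        (λ u v → solve 6 (λ κ x c t a d → κ :* (c :* t :- d) :+ x :* (t :+ κ :* a) :+ (:1 :- κ :* c :- x) :* t
            := κ :* x :* a :+ (:3 :* :1 :- :2) :* t :- κ :* d) refl κ′ x c (T 0 u v) (T (i ℕ.+ i) u v) (T (suc i ℕ.+ suc i) u v))
        (add (add (scale κ′ (fromℕ-nonneg κ) high′) (scale x (proj₁ 0<x) (even-nonneg i))) (scaled-identity enough))
        where
        c = ε * x ^ ℓ
        high′ : Holds (λ u v → c * T 0 u v - T (suc i ℕ.+ suc i) u v)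
        high′ = ≡.subst (λ n → Holds (λ u v → c * T 0 u v - T (n ℕ.+ n) u v)) (≡.trans (≡.sym eq) (ℕ.+-identityʳ (suc i))) high
        -- Here k must not overshoot: `κ` multiplies the bound on the last form, and minimality of
        -- the ceiling gives κ ≤ y^ℓ.
        κxℓ≤1 : κ′ * x ^ ℓ ≤ 1#
        κxℓ≤1 = ≤-respʳ (trans (*-comm _ _) (trans (sym (*-^ x y ℓ)) (trans (^-congˡ ℓ ε²y≈1) (1^ ℓ))))
          (*-monoˡ-≤ (^-nonneg ℓ (proj₁ 0<x)) k-upper)
        enough : 0# ≤ 1# - κ′ * c - x
        enough = ≤-respʳ (solve 4 (λ κ e p x → (:1 :- e :- x) :+ e :* (:1 :- κ :* p) := :1 :- κ :* (e :* p) :- x) refl κ′ ε (x ^ ℓ) x)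
          (+-nonneg base-slack (*-nonneg (proj₁ 0<ε) (diff-nonneg κxℓ≤1)))
      chain (suc j) i eq = unscale x 0<x
        (λ u v → begin
          _ ≈⟨ solve 8 (λ κ x y yj t a mid d → let k = :1 :+ κ in
                 ((:1 :+ x :* x) :* t :+ κ :* (x :* x) :* a :+ κ :* d :- :2 :* k :* x :* mid) :+
                 (κ :* x :* mid :+ (:3 :* yj :- :2) :* t :- κ :* d) :+ (:2 :* x) :* (t :+ mid) :+
                 (:2 :- :2 :* x :- (:1 :+ x) :* (:1 :+ x)) :* t
                 := x :* (κ :* x :* a :+ (:3 :* (y :* yj) :- :2) :* t :- κ :* mid) :+ (:3 :* yj :* t) :* (:1 :- x :* y))
                 refl κ′ x y (y ^ j) (T 0 u v) (T (i ℕ.+ i) u v) (T (suc i ℕ.+ suc i) u v) (T (suc (suc i) ℕ.+ suc (suc i)) u v) ⟩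
          x * (κ′ * x * T (i ℕ.+ i) u v + (three * y ^ suc j - two) * T 0 u v - κ′ * T (suc i ℕ.+ suc i) u v) +
            (three * y ^ j * T 0 u v) * (1# - x * y)
            ≈⟨ +-congˡ (trans (*-congˡ (trans (+-congˡ (-‿cong ε²y≈1)) (-‿inverseʳ 1#))) (zeroʳ _)) ⟩
          x * (κ′ * x * T (i ℕ.+ i) u v + (three * y ^ suc j - two) * T 0 u v - κ′ * T (suc i ℕ.+ suc i) u v) + 0#
            ≈⟨ +-identityʳ _ ⟩
          x * (κ′ * x * T (i ℕ.+ i) u v + (three * y ^ suc j - two) * T 0 u v - κ′ * T (suc i ℕ.+ suc i) u v) ∎)
        (add (add (add (convexity 2≤ℓ i) (chain j (suc i) (≡.trans (≡.sym (ℕ.+-suc (suc i) j)) eq)))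
          -- `convexity` contains the middle form 2 k x times where 2 κ x is wanted; the excess 2 x
          -- is paid by `T 0`, which completes the error 1 + x² to (1 + x)².
          (scale (two * x) (*-nonneg (proj₁ 0<2) (proj₁ 0<x)) (-T≼I 2≤R (suc i ℕ.+ suc i))))
          (scaled-identity step-slack))
        where
        open ≈-Reasoning
        2≤ℓ : 2 ℕ.≤ ℓ
        2≤ℓ = ℕ.≤-trans (ℕ.s≤s (ℕ.≤-trans (ℕ.s≤s ℕ.z≤n) (ℕ.m≤n+m (suc j) i))) (ℕ.≤-reflexive eq)

      -- In units of k x the coefficient of `T 0` is 5: one from the root in `first-step`, one from
      -- x T 0 at the start of `chain`, and three from its error, since y^(ℓ-1) ≤ k x.
      conclusion : ∀ {h} → two * h ≈ five * ε → ∀ s → s * s ≈ 1# → Holds (λ u v → h * T 0 u v - s * T 1 u v)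
      conclusion {h} 2h≈5ε s ss≈1 = conclude ℓ ≡.refl
        where
        conclude : ∀ n → n ≡ ℓ → Holds (λ u v → h * T 0 u v - s * T 1 u v)
        conclude zero    eq = contradiction (≡.subst (1 ℕ.≤_) (≡.sym eq) 1≤ℓ) λ ()
        conclude (suc j) eq = unscale (two * k * ε) (*-pos (*-pos 0<2 0<k) 0<ε)
          (λ u v → begin
            _ ≈⟨ solve 7 (λ κ e yj t t₁ t₂ s → let k = :1 :+ κ ; x = e :* e in
                   ((:1 :+ k :* x) :* t :+ κ :* t₂ :- :2 :* k :* e :* (s :* t₁)) :+
                   (κ :* x :* t :+ (:3 :* yj :- :2) :* t :- κ :* t₂) :+
                   (:3 :* (k :* x :- yj) :+ (x :+ :1)) :* t
                   := k :* e :* (:5 :* e) :* t :- :2 :* k :* e :* (s :* t₁)) refl κ′ ε (y ^ j) (T 0 u v) (T 1 u v) (T 2 u v) s ⟩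
            k * ε * (five * ε) * T 0 u v - two * k * ε * (s * T 1 u v) ≈⟨ +-congʳ (*-congʳ (*-congˡ 2h≈5ε)) ⟨
            k * ε * (two * h) * T 0 u v - two * k * ε * (s * T 1 u v)
              ≈⟨ solve 5 (λ k e h t st → k :* e :* (:2 :* h) :* t :- :2 :* k :* e :* st := :2 :* k :* e :* (h :* t :- st)) refl k ε h (T 0 u v) (s * T 1 u v) ⟩
            two * k * ε * (h * T 0 u v - s * T 1 u v) ∎)
          (add (add (first-step s ss≈1) (chain j 0 eq)) (scaled-identity
            (+-nonneg (*-nonneg (+-nonneg (proj₁ 0<2) 0≤1) (diff-nonneg yj≤kx)) (+-nonneg (proj₁ 0<x) 0≤1))))
          where
          open ≈-Reasoning
          yj≤kx : y ^ j ≤ k * x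
          yj≤kx = ≤-respˡ (trans (solve 3 (λ p x y → (y :* p) :* x := (x :* y) :* p) refl (y ^ j) x y) (trans (*-congʳ ε²y≈1) (*-identityˡ _)))
            (*-monoˡ-≤ (proj₁ 0<x) (≡.subst (λ n → y ^ n ≤ k) (≡.sym eq) k-lower))

-- From real matrices to derivations of polynomial inequalities.

module Derivations (ℝ : CompleteOrderedField) (n : ℕ) where
  open OrderedField ℝ hiding (Polynomial; solve; _:=_; _:+_; _:*_; _:-_; :-_; :con; :1; :2)
  open FiniteSums ℝ
  open LocalCones ℝ

  private
    module PolyRing = CommutativeRing (polyCommutativeRing n)
    module PolySum = SemiringSum PolyRing.semiring
    open RingSolver (polyCommutativeRing n)
    open import Relation.Binary.Reasoning.Setoid PolyRing.setoid

  module _ {Axiom : Poly n → Set} where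

    derivable-resp : ∀ {p q} → p ≋ q → Derivable Axiom p → Derivable Axiom q
    derivable-resp {p} {q} p≋q d = combination 1 (λ _ → 1#) (λ _ → p) (λ _ → 0≤1) (λ _ → d)
      (≋-trans (≋-sym p≋q) (≋-sym (≋-trans (PolyRing.+-identityʳ _) (⊗-identityˡ p))))

    derivable-sum : ∀ {l} (c : Fin l → Carrier) (p : Fin l → Poly n) → (∀ i → 0# ≤ c i) →
                    (∀ i → Derivable Axiom (p i)) → Derivable Axiom (sumPoly λ i → con (c i) ⊗ p i)
    derivable-sum c p 0≤c d = combination _ c p 0≤c d ≋-refl

    derivable-scale : ∀ {p} c → 0# ≤ c → Derivable Axiom p → Derivable Axiom (con c ⊗ p)
    derivable-scale {p} c 0≤c d = derivable-resp (PolyRing.+-identityʳ _) (derivable-sum {1} (λ _ → c) (λ _ → p) (λ _ → 0≤c) (λ _ → d))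

    derivable-add : ∀ {p q} → Derivable Axiom p → Derivable Axiom q → Derivable Axiom (p ⊕ q)
    derivable-add {p} {q} d e = derivable-resp
      (PolyRing.+-cong (⊗-identityˡ p) (≋-trans (PolyRing.+-identityʳ _) (⊗-identityˡ q)))
      (derivable-sum {2} (λ _ → 1#) (λ { zero → p ; (suc _) → q }) (λ _ → 0≤1) (λ { zero → d ; (suc _) → e }))

  derivable-map : ∀ {A B : Poly n → Set} → (∀ {p} → A p → B p) → ∀ {p} → Derivable A p → Derivable B p
  derivable-map A⇒B (axiom a)                     = axiom (A⇒B a)
  derivable-map A⇒B (combination m c q 0≤c d eq) = combination m c q 0≤c (λ i → derivable-map A⇒B (d i)) eq

  form : Matrix n → Poly n
  form A = sumPoly λ u → sumPoly λ v → con (A u v) ⊗ (X u ⊗ X v)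

  form-cong : ∀ {A B} → (∀ u v → A u v ≈ B u v) → form A ≋ form B
  form-cong A≈B = PolySum.sum-cong-≋ λ u → PolySum.sum-cong-≋ λ v → ⊗-cong (con-cong (A≈B u v)) ≋-refl

  form-linear : ∀ c A B → form (λ u v → c * A u v + B u v) ≋ con c ⊗ form A ⊕ form B
  form-linear c A B = begin
    form (λ u v → c * A u v + B u v)
      ≈⟨ PolySum.sum-cong-≋ (λ u → PolySum.sum-cong-≋ (λ v → entry u v)) ⟩
    sumPoly (λ u → sumPoly λ v → con c ⊗ (con (A u v) ⊗ (X u ⊗ X v)) ⊕ con (B u v) ⊗ (X u ⊗ X v))
      ≈⟨ PolySum.sum-cong-≋ (λ u → ≋-trans (PolySum.∑-distrib-+ (λ v → con c ⊗ (con (A u v) ⊗ (X u ⊗ X v))) (λ v → con (B u v) ⊗ (X u ⊗ X v)))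
           (⊕-cong (≋-sym (PolySum.*-distribˡ-sum (con c) (λ v → con (A u v) ⊗ (X u ⊗ X v)))) ≋-refl)) ⟩
    sumPoly (λ u → con c ⊗ sumPoly (λ v → con (A u v) ⊗ (X u ⊗ X v)) ⊕ sumPoly (λ v → con (B u v) ⊗ (X u ⊗ X v)))
      ≈⟨ ≋-trans (PolySum.∑-distrib-+ (λ u → con c ⊗ sumPoly (λ v → con (A u v) ⊗ (X u ⊗ X v))) (λ u → sumPoly (λ v → con (B u v) ⊗ (X u ⊗ X v))))
           (⊕-cong (≋-sym (PolySum.*-distribˡ-sum (con c) (λ u → sumPoly (λ v → con (A u v) ⊗ (X u ⊗ X v))))) ≋-refl) ⟩
    con c ⊗ form A ⊕ form B ∎
    where
    entry : ∀ u v → con (c * A u v + B u v) ⊗ (X u ⊗ X v) ≋ con c ⊗ (con (A u v) ⊗ (X u ⊗ X v)) ⊕ con (B u v) ⊗ (X u ⊗ X v)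
    entry u v = ≋-trans (⊗-cong (≋-trans (con-+ _ _) (⊕-cong (con-* _ _) ≋-refl)) ≋-refl)
      (≋-trans (⊗-distribʳ-⊕ _ _ _) (⊕-cong (⊗-assoc _ _ _) ≋-refl))

  form-0 : form (λ _ _ → 0#) ≋ con 0#
  form-0 = zeros λ u → zeros λ v → ⊗-zeroˡ (X u ⊗ X v)
    where
    zeros : ∀ {l} {f : Fin l → Poly n} → (∀ i → f i ≋ con 0#) → sumPoly f ≋ con 0#
    zeros {l} f≋0 = ≋-trans (PolySum.sum-cong-≋ f≋0) (PolySum.sum-replicate-zero l)

  sumPoly-δ : ∀ {l} (u : Fin l) (q : Fin l → Poly n) → sumPoly (λ v → con (δ u v) ⊗ q v) ≋ q u
  sumPoly-δ {suc l} zero    q = ≋-trans (⊕-cong (⊗-identityˡ _)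
      (≋-trans (PolySum.sum-cong-≋ (λ v → ⊗-zeroˡ (q (suc v)))) (PolySum.sum-replicate-zero l)))
    (PolyRing.+-identityʳ _)
  sumPoly-δ (suc u) q = ≋-trans (⊕-cong (⊗-zeroˡ _) (sumPoly-δ u (q ∘ suc))) (⊕-identityˡ _)

  form-diagonal : ∀ (d : Fin n → Carrier) → form (λ u v → δ u v * d u) ≋ sumPoly λ u → con (d u) ⊗ (X u ⊗ X u)
  form-diagonal d = PolySum.sum-cong-≋ λ u → ≋-trans
    (PolySum.sum-cong-≋ λ v → ≋-trans (⊗-cong (con-* (δ u v) (d u)) ≋-refl) (⊗-assoc _ _ _))
    (sumPoly-δ u (λ v → con (d u) ⊗ (X u ⊗ X v)))

  linear : (Fin n → Carrier) → Poly n
  linear f = sumPoly λ u → con (f u) ⊗ X u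

  linear-square : ∀ f → linear f ⊗ linear f ≋ form (λ u v → f u * f v)
  linear-square f = begin
    linear f ⊗ linear f
      ≈⟨ PolySum.*-distribʳ-sum (linear f) (λ u → con (f u) ⊗ X u) ⟩
    sumPoly (λ u → con (f u) ⊗ X u ⊗ linear f)
      ≈⟨ PolySum.sum-cong-≋ (λ u → PolySum.*-distribˡ-sum (con (f u) ⊗ X u) (λ v → con (f v) ⊗ X v)) ⟩
    sumPoly (λ u → sumPoly λ v → (con (f u) ⊗ X u) ⊗ (con (f v) ⊗ X v))
      ≈⟨ PolySum.sum-cong-≋ (λ u → PolySum.sum-cong-≋ (λ v → ≋-trans
           (solve 4 (λ a x b y → (a :* x) :* (b :* y) :=
             (a :* b) :* (x :* y)) ≋-refl (con (f u)) (X u) (con (f v)) (X v))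
           (⊗-cong (≋-sym (con-* (f u) (f v))) ≋-refl))) ⟩
    form (λ u v → f u * f v) ∎

  linear-degree : ∀ f → Degree≤ 1 (linear f)
  linear-degree f = go (λ u → con (f u) ⊗ X u) (λ u → _⊗_ {d = 0} (con (f u)) (X u))
    where
    go : ∀ {l} (p : Fin l → Poly n) → (∀ i → Degree≤ 1 (p i)) → Degree≤ 1 (sumPoly p)
    go {zero}  p d = con 0#
    go {suc l} p d = d zero ⊕ go (p ∘ suc) (d ∘ suc)

  linear-depends : ∀ {S f} → SupportedOn S f → DependsOnlyOn S (linear f)
  linear-depends {S} {f} f-supp = go (λ u → con (f u) ⊗ X u) term
    where
    go : ∀ {l} (p : Fin l → Poly n) → (∀ i → DependsOnlyOn S (p i)) → DependsOnlyOn S (sumPoly p)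
    go {zero}  p d = con 0#
    go {suc l} p d = d zero ⊕ go (p ∘ suc) (d ∘ suc)
    term : ∀ u → DependsOnlyOn S (con (f u) ⊗ X u)
    term u with u Subset.∈? S
    ... | yes u∈S = con (f u) ⊗ X u∈S
    -- Outside the support the expression still mentions `X u`; closure of `DependsOnlyOn` under `≋`
    -- removes it.
    ... | no  u∉S = resp (≋-trans (≋-sym (⊗-zeroˡ (X u))) (⊗-cong (con-cong (sym (f-supp u u∉S))) ≋-refl)) (con 0#)

  localSOSCone : ∀ R → LocalCone n R
  localSOSCone R = record
    { Holds   = λ A → Derivable (LocalSOS₂ R) (form A)
    ; resp-≈  = λ A≈B → derivable-resp (form-cong A≈B)
    ; combine = mixture
    ; outer   = λ S f ∣S∣≤R f-supp → derivable-resp (linear-square f)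
                  (axiom (square (linear f) (linear-degree f) (S , ∣S∣≤R , linear-depends f-supp)))
    }
    where
    mixture : ∀ {l} (c : Fin l → Carrier) (A : Fin l → Matrix n) → (∀ i → 0# ≤ c i) →
              (∀ i → Derivable (LocalSOS₂ R) (form (A i))) → Derivable (LocalSOS₂ R) (form λ u v → sum λ i → c i * A i u v)
    mixture c A 0≤c d = combination _ c (form ∘ A) 0≤c d (expand c A)
      where
      expand : ∀ {l} (c : Fin l → Carrier) (A : Fin l → Matrix n) →
               form (λ u v → sum λ i → c i * A i u v) ≋ sumPoly (λ i → con (c i) ⊗ form (A i))
      expand {zero}  c A = form-0
      expand {suc l} c A = ≋-trans (form-linear (c zero) (A zero) _) (⊕-cong ≋-refl (expand (c ∘ suc) (A ∘ suc)))

  localSOS⇒SheraliAdams : ∀ {R} {p : Poly n} → LocalSOS₂ R p → SheraliAdams R p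
  localSOS⇒SheraliAdams (square p _ dep) = square p dep

  -- An average of the Boolean axioms `X u ⊗ X u` ≤ 1 with weights `d`. It converts the homogeneous
  -- bound into a constant one.
  normalisation : ∀ {R} → 1 ℕ.≤ R → (d : Fin n → Carrier) → (∀ u → 0# ≤ d u) → sum d ≈ 1# →
                  Derivable (SheraliAdams R) (con 1# ⊖ sumPoly λ u → con (d u) ⊗ (X u ⊗ X u))
  normalisation {R} 1≤R d 0≤d Σd≈1 = derivable-resp eq
    (derivable-sum d (λ u → ⊝ ((X u ⊗ X u ⊖ con 1#) ⊗ con 1#)) 0≤d λ u →
      axiom (bool≤0 u (con 1#) (⁅ u ⁆ , ℕ.≤-trans (ℕ.≤-reflexive (Subset.∣⁅x⁆∣≡1 u)) 1≤R , depends u)))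
    where
    depends : ∀ u → DependsOnlyOn ⁅ u ⁆ ((X u ⊗ X u ⊖ con 1#) ⊗ con 1#)
    depends u = (x ⊗ x ⊕ con (- 1#) ⊗ con 1#) ⊗ con 1#
      where
      x : DependsOnlyOn ⁅ u ⁆ (X u)
      x = X (Subset.x∈⁅x⁆ u)
    con-sum : ∀ {l} (f : Fin l → Carrier) → con (sum f) ≋ sumPoly {n} (λ i → con (f i))
    con-sum {zero}  f = ≋-refl
    con-sum {suc l} f = ≋-trans (con-+ _ _) (⊕-cong ≋-refl (con-sum (f ∘ suc)))
    eq : sumPoly (λ u → con (d u) ⊗ ⊝ ((X u ⊗ X u ⊖ con 1#) ⊗ con 1#)) ≋ con 1# ⊖ sumPoly (λ u → con (d u) ⊗ (X u ⊗ X u))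
    eq = begin
      sumPoly (λ u → con (d u) ⊗ ⊝ ((X u ⊗ X u ⊖ con 1#) ⊗ con 1#))
        ≈⟨ PolySum.sum-cong-≋ (λ u → solve 2 (λ d x → d :* (:- ((x :- :1) :* :1)) := d :+ (:- :1) :* (d :* x)) ≋-refl (con (d u)) (X u ⊗ X u)) ⟩
      sumPoly (λ u → con (d u) ⊕ (⊝ con 1#) ⊗ (con (d u) ⊗ (X u ⊗ X u)))
        ≈⟨ PolySum.∑-distrib-+ (λ u → con (d u)) (λ u → (⊝ con 1#) ⊗ (con (d u) ⊗ (X u ⊗ X u))) ⟩
      sumPoly (λ u → con (d u)) ⊕ sumPoly (λ u → (⊝ con 1#) ⊗ (con (d u) ⊗ (X u ⊗ X u)))
        ≈⟨ ⊕-cong (≋-trans (≋-sym (con-sum d)) (con-cong Σd≈1)) (≋-sym (PolySum.*-distribˡ-sum (⊝ con 1#) (λ u → con (d u) ⊗ (X u ⊗ X u)))) ⟩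
      con 1# ⊕ (⊝ con 1#) ⊗ sumPoly (λ u → con (d u) ⊗ (X u ⊗ X u))
        ≈⟨ ⊕-cong ≋-refl (solve 1 (λ s → (:- :1) :* s := :- s) ≋-refl _) ⟩
      con 1# ⊖ sumPoly (λ u → con (d u) ⊗ (X u ⊗ X u)) ∎

  move-right : ∀ (o h a b : Poly n) → (o ⊗ h) ⊗ a ⊕ con 1# ⊗ b ≋ b ⊕ o ⊗ (h ⊗ a)
  move-right = solve 4 (λ o h a b → (o :* h) :* a :+ :1 :* b := b :+ o :* (h :* a)) ≋-refl

  mix-normalisation : ∀ (d h a b : Poly n) → d ⊗ (h ⊗ a ⊖ b) ⊕ (d ⊗ h) ⊗ (con 1# ⊖ a) ≋ (d ⊕ d ⊗ h) ⊖ (d ⊕ d ⊗ b)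
  mix-normalisation = solve 4 (λ d h a b → d :* (h :* a :- b) :+ (d :* h) :* (:1 :- a) := (d :+ d :* h) :- (d :+ d :* b)) ≋-refl

-- The random walk of a signed multigraph.

module GraphWalk (ℝ : CompleteOrderedField) {n} (G : Multigraph (suc n)) (ξ : Signing G) (noIsolated : Multigraph.NoIsolatedVertices G) where
  open OrderedField ℝ
  open FiniteSums ℝ
  open MatrixPowers ℝ
  open Multigraph G
  open Signing ξ

  private
    module Σℕ = RawMonoidDefs +-0-rawMonoid

  fromℕ-sum : ∀ {l} (f : Fin l → ℕ) → fromℕ (Σℕ.sum f) ≈ sum (fromℕ ∘ f)
  fromℕ-sum {zero}  f = refl
  fromℕ-sum {suc l} f = trans (fromℕ-+ (f zero) _) (+-congˡ (fromℕ-sum (f ∘ suc)))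

  positive : ∀ {a} → 0 ℕ.< a → 0# < fromℕ a
  positive {suc a} _ = fromℕ-pos a

  0<deg : ∀ u → 0# < fromℕ (deg u)
  0<deg u = positive (noIsolated u)

  2E : Carrier
  2E = fromℕ twice∣E∣

  2E≈ : 2E ≈ sum (λ u → fromℕ (deg u))
  2E≈ = fromℕ-sum deg

  0<2E : 0# < 2E
  0<2E = <-≤-trans (0<deg zero) (≤-respʳ (sym 2E≈) (term≤sum (λ u → proj₁ (0<deg u)) zero))

  sum-π : sum (π G) ≈ 1#
  sum-π = trans (sym (*-distribʳ-sum (2E ⁻¹) (λ u → fromℕ (deg u)))) (trans (*-congʳ (sym 2E≈)) (*-inversePos 0<2E))

  sum-K : ∀ u → sum (K G u) ≈ 1#
  sum-K u = trans (sym (*-distribʳ-sum (fromℕ (deg u) ⁻¹) (λ v → fromℕ (mult u v))))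
    (trans (*-congʳ (sym (fromℕ-sum (mult u)))) (*-inversePos (0<deg u)))

  0≤K : ∀ u v → 0# ≤ K G u v
  0≤K u v = *-nonneg (fromℕ-nonneg (mult u v)) (proj₁ (⁻¹-pos (0<deg u)))

  -- The degree cancels, leaving the uniform measure on oriented edges, which is visibly symmetric.
  πK : ∀ u v → π G u * K G u v ≈ fromℕ (mult u v) * 2E ⁻¹
  πK u v = trans (solve 4 (λ d e m i → d :* e :* (m :* i) := (d :* i) :* (m :* e)) refl (fromℕ (deg u)) (2E ⁻¹) (fromℕ (mult u v)) (fromℕ (deg u) ⁻¹))
    (trans (*-congʳ (*-inversePos (0<deg u))) (*-identityˡ _))

  K-reversible : ∀ u v → π G u * K G u v ≈ π G v * K G v u
  K-reversible u v = trans (πK u v) (trans (*-congʳ (fromℕ-cong (mult-sym u v))) (sym (πK v u)))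

  -- A `Signing` is symmetric on edges only; elsewhere both entries are 0 whatever the signs.
  Ξ-sym : ∀ u v → Ξ G ξ u v ≈ Ξ G ξ v u
  Ξ-sym u v = entries (mult u v) (mult v u) (sign u v) (sign v u) (mult-sym u v) (sign-sym u v)
    where
    entries : ∀ a b s t → a ≡ b → (0 ℕ.< a → s ≡ t) → signEntry a s ≈ signEntry b t
    entries zero    _ s t ≡.refl s≡t = refl
    entries (suc a) _ s t ≡.refl s≡t = reflexive (≡.cong ⟦_⟧ (s≡t (ℕ.s≤s ℕ.z≤n)))

  K̄-reversible : ∀ u v → π G u * K̄ G ξ u v ≈ π G v * K̄ G ξ v u
  K̄-reversible u v = trans (pull (Ξ G ξ u v) _ _) (trans (*-cong (Ξ-sym u v) (K-reversible u v)) (sym (pull (Ξ G ξ v u) _ _)))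
    where
    pull : ∀ s p k → p * (s * k) ≈ s * (p * k)
    pull = solve 3 (λ s p k → p :* (s :* k) := s :* (p :* k)) refl

  0≤1±entry : ∀ a s → 0# ≤ 1# + signEntry a s × 0# ≤ 1# - signEntry a s
  0≤1±entry zero    s      = ≤-respʳ (sym (+-identityʳ 1#)) 0≤1 , ≤-respʳ (solve 0 (:1 := :1 :- :con +0) refl) 0≤1
  0≤1±entry (suc a) Sign.+ = +-nonneg 0≤1 0≤1 , ≤-reflexive (sym (-‿inverseʳ 1#))
  0≤1±entry (suc a) Sign.- = ≤-reflexive (sym (-‿inverseʳ 1#)) ,
    ≤-respʳ (solve 0 (:2 := :1 :- :- :1) refl) (+-nonneg 0≤1 0≤1)

  walk : SignedWalk (suc n)
  walk = record
    { μ = π G ; P = K G ; Q = K̄ G ξ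
    ; 0<μ = λ u → *-pos (0<deg u) (⁻¹-pos 0<2E)
    ; Σμ≈1 = sum-π ; ΣP≈1 = sum-K
    ; P-reversible = K-reversible ; Q-reversible = K̄-reversible
    ; 0≤P+Q = λ u v → ≤-respʳ (solve 2 (λ k s → (:1 :+ s) :* k := k :+ s :* k) refl (K G u v) (Ξ G ξ u v))
        (*-nonneg (proj₁ (0≤1±entry (mult u v) (sign u v))) (0≤K u v))
    ; 0≤P-Q = λ u v → ≤-respʳ (solve 2 (λ k s → (:1 :- s) :* k := k :- s :* k) refl (K G u v) (Ξ G ξ u v))
        (*-nonneg (proj₂ (0≤1±entry (mult u v) (sign u v))) (0≤K u v))
    }

  -- Signs of edges square to 1, so signing `K̄` once more returns `K`, whose rows sum to 1. Through
  -- `ρ-pos` this makes ρ / ε positive, where the laws of `log` hold.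
  K̄≉0 : ¬ (∀ u v → K̄ G ξ u v ≈ 0#)
  K̄≉0 K̄≈0 = 1≉0 (trans (sym (sum-K zero)) (sum-0 λ v →
    trans (sym (involution (mult zero v) (sign zero v) (fromℕ (deg zero) ⁻¹))) (trans (*-congˡ (K̄≈0 zero v)) (zeroʳ _))))
    where
    involution : ∀ a s i → signEntry a s * (signEntry a s * (fromℕ a * i)) ≈ fromℕ a * i
    involution zero    s      i = trans (zeroˡ _) (sym (zeroˡ i))
    involution (suc a) Sign.+ i = trans (*-identityˡ _) (*-identityˡ _)
    involution (suc a) Sign.- i = solve 1 (λ x → (:- :1) :* ((:- :1) :* x) := x) refl _

  open SpectralBound ℝ using (Nonzero)

  -- The Rayleigh argument produces real eigenvectors, while the spectral radius speaks of complex
  -- ones.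
  real-eigenvalue : ∀ {t f} → Nonzero f → (∀ u → (K̄ G ξ · f) u ≈ t * f u) → IsEigenvalue (K̄ G ξ) t 0#
  real-eigenvalue {t} {f} (v , fv≉0) eig = f , (λ _ → 0#) , (v , fv≉0 ∘ proj₁) ,
    (λ u → trans (eig u) (solve 2 (λ t f → t :* f := t :* f :- :con +0 :* :con +0) refl t (f u))) ,
    (λ u → trans (sum-0 λ v → zeroʳ (K̄ G ξ u v)) (solve 2 (λ t f → :con +0 := :con +0 :* f :+ t :* :con +0) refl t (f u)))

  eigenvalue-bound : ∀ {ρ} → IsSpectralRadius (K̄ G ξ) ρ →
                     ∀ t f → Nonzero f → (∀ u → (K̄ G ξ · f) u ≈ t * f u) → t * t ≤ ρ * ρ
  eigenvalue-bound rad t f f≉0 eig = ≤-respˡ (trans (+-congˡ (zeroˡ 0#)) (+-identityʳ _))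
    (IsSpectralRadius.bound rad t 0# (real-eigenvalue f≉0 eig))

-- Logarithms, and the inequality encoded in the choice of ℓ.

module RealLogarithms (ℝ : CompleteOrderedField) where
  open OrderedField ℝ

  module Logarithms {log : Carrier → Carrier} (isLog : IsLogarithm log) where
    open IsLogarithm isLog

    log-1 : log 1# ≈ 0#
    log-1 = begin
      log 1#                        ≈⟨ solve 1 (λ l → l := l :+ l :- l) refl (log 1#) ⟩
      log 1# + log 1# - log 1#      ≈⟨ +-congʳ (log-* 0<1 0<1) ⟨
      log (1# * 1#) - log 1#        ≈⟨ +-congʳ (log-cong (*-pos 0<1 0<1) (*-identityˡ 1#)) ⟩
      log 1# - log 1#               ≈⟨ -‿inverseʳ _ ⟩
      0#                            ∎
      where open ≈-Reasoning

    log-^ : ∀ {x} → 0# < x → ∀ t → log (x ^ t) ≈ fromℕ t * log x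
    log-^ 0<x zero    = trans log-1 (sym (zeroˡ _))
    log-^ {x} 0<x (suc t) = trans (log-* 0<x (^-pos t 0<x)) (trans (+-congˡ (log-^ 0<x t))
      (solve 2 (λ l t → l :+ t :* l := (:1 :+ t) :* l) refl (log x) (fromℕ t)))

    log-reflects-≤ : ∀ {x y} → 0# < y → log x ≤ log y → x ≤ y
    log-reflects-≤ {x} {y} 0<y lx≤ly with x ≤? y
    ... | yes x≤y = x≤y
    ... | no  x≰y = contradiction lx≤ly (<⇒≱ (log-mono 0<y (≰⇒> x≰y)))

    -- Clearing the denominator log r < 0 in ¼ log a / log r ≤ ℓ.
    quarter-log-ratio : ∀ {a r} → 0# < a → 0# < r → r < 1# → ∀ ℓ →
      (1# / fromℕ 4) * (log a / log r) ≤ fromℕ ℓ → (r * r) ^ (ℓ ℕ.+ ℓ) ≤ a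
    quarter-log-ratio {a} {r} 0<a 0<r r<1 ℓ ratio≤ℓ = log-reflects-≤ 0<a
      (≤-diff (*-nonneg (*-nonneg (fromℕ-nonneg 4) (proj₁ 0<-L)) (diff-nonneg ratio≤ℓ)) eq)
      where
      L = log r
      L<0 : L < 0#
      L<0 = <-≤-trans (log-mono 0<r r<1) (≤-reflexive log-1)
      0<-L : 0# < - L
      0<-L = ≰⇒> λ -L≤0 → <⇒≱ L<0 (≤-diff (neg-nonneg -L≤0) (solve 1 (λ l → :- (:- l) := l :- :con +0) refl L))
      L*L⁻¹ : L * L ⁻¹ ≈ 1#
      L*L⁻¹ = *-inverseʳ (proj₂ L<0)
      open ≈-Reasoning
      eq : fromℕ 4 * - L * (fromℕ ℓ - (1# / fromℕ 4) * (log a / L)) ≈ log a - log ((r * r) ^ (ℓ ℕ.+ ℓ))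
      eq = begin
        fromℕ 4 * - L * (fromℕ ℓ - (1# * fromℕ 4 ⁻¹) * (log a * L ⁻¹))
          ≈⟨ solve 6 (λ f i L j ℓ A → f :* (:- L) :* (ℓ :- (:1 :* i) :* (A :* j)) := (f :* i) :* (L :* j) :* A :- f :* ℓ :* L)
               refl (fromℕ 4) (fromℕ 4 ⁻¹) L (L ⁻¹) (fromℕ ℓ) (log a) ⟩
        (fromℕ 4 * fromℕ 4 ⁻¹) * (L * L ⁻¹) * log a - fromℕ 4 * fromℕ ℓ * L
          ≈⟨ +-congʳ (*-congʳ (*-cong (*-inversePos (fromℕ-pos 3)) L*L⁻¹)) ⟩
        1# * 1# * log a - fromℕ 4 * fromℕ ℓ * L
          ≈⟨ solve 3 (λ A ℓ L → :1 :* :1 :* A :- (:1 :+ (:1 :+ (:1 :+ (:1 :+ :con +0)))) :* ℓ :* L := A :- (ℓ :+ ℓ) :* (L :+ L)) refl (log a) (fromℕ ℓ) L ⟩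
        log a - (fromℕ ℓ + fromℕ ℓ) * (L + L)
          ≈⟨ +-congˡ (-‿cong (*-cong (fromℕ-+ ℓ ℓ) (log-* 0<r 0<r))) ⟨
        log a - fromℕ (ℓ ℕ.+ ℓ) * log (r * r)
          ≈⟨ +-congˡ (-‿cong (log-^ (*-pos 0<r 0<r) (ℓ ℕ.+ ℓ))) ⟨
        log a - log ((r * r) ^ (ℓ ℕ.+ ℓ)) ∎

-- Certificates for signed graphs.

module GraphCertificates (ℝ : CompleteOrderedField) where
  open OrderedField ℝ

  module Certificates {n} (G : Multigraph (suc n)) (ξ : Signing G)
    (noIsolated : Multigraph.NoIsolatedVertices G) where
    open FiniteSums ℝ
    open LocalCones ℝ
    open MatrixPowers ℝ
    open Derivations ℝ (suc n)
    open GraphWalk ℝ G ξ noIsolated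
    open WalkForms.Walks ℝ walk
    open WalkSpectra.SpectralDecay ℝ walk using (T-1; ρ-pos; high-power)

    π⋆≤π : ∀ u → π⋆ G ≤ π G u
    π⋆≤π u = All.lookup (Extrema.min≤xs (CompleteOrderedField.totalOrder ℝ) (π G zero) (List.map (π G) (List.allFin (suc n))))
      (∈-map⁺ (π G) (∈-allFin u))

    module _ {R : ℕ} where
      open LocalCone (localSOSCone R) public
      open LocalProofs (localSOSCone R) public

    ⟨X,X⟩≋ : form (T 0) ≋ ⟨X,X⟩π G
    ⟨X,X⟩≋ = ≋-trans (form-cong λ u v → *-comm (π G u) (δ u v)) (form-diagonal (π G))

    ⟨X,K̄X⟩≋ : form (T 1) ≋ ⟨X,_X⟩π G (K̄ G ξ)
    ⟨X,K̄X⟩≋ = form-cong T-1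

    combination≋ : ∀ h s → form (λ u v → h * T 0 u v - s * T 1 u v) ≋ con h ⊗ ⟨X,X⟩π G ⊕ con (- s) ⊗ ⟨X,_X⟩π G (K̄ G ξ)
    combination≋ h s = ≋-trans (form-cong λ u v → solve 4 (λ h s a b → h :* a :- s :* b := h :* a :+ ((:- s) :* b :+ :con +0)) refl h s (T 0 u v) (T 1 u v))
      (≋-trans (form-linear h (T 0) (λ u v → - s * T 1 u v + 0#))
        (⊕-cong (⊗-cong ≋-refl ⟨X,X⟩≋)
          (≋-trans (form-linear (- s) (T 1) (λ _ _ → 0#))
            (≋-trans (⊕-cong (⊗-cong ≋-refl ⟨X,K̄X⟩≋) form-0) (CommutativeRing.+-identityʳ (polyCommutativeRing (suc n)) _)))))

    lower : ∀ {R h} → Holds {R} (λ u v → h * T 0 u v - - 1# * T 1 u v) → LocalSOS₂ R ⊢ con (- h) ⊗ ⟨X,X⟩π G ≼ ⟨X,_X⟩π G (K̄ G ξ)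
    lower {h = h} d = derivable-resp (≋-trans (combination≋ h (- 1#))
      (≋-trans (⊕-cong (⊗-cong (≋-trans (con-cong (solve 1 (λ h → h := (:- :1) :* (:- h)) refl h)) (con-* _ _)) ≋-refl)
                       (⊗-cong (con-cong (solve 0 (:- (:- :1) := :1) refl)) ≋-refl))
        (move-right (con (- 1#)) (con (- h)) (⟨X,X⟩π G) (⟨X,_X⟩π G (K̄ G ξ))))) d

    upper : ∀ {R h} → Holds {R} (λ u v → h * T 0 u v - 1# * T 1 u v) → LocalSOS₂ R ⊢ ⟨X,_X⟩π G (K̄ G ξ) ≼ con h ⊗ ⟨X,X⟩π G
    upper {h = h} d = derivable-resp (combination≋ h 1#) d

    -- Half of the local bound leaves ½ h ⟨X,X⟩π on the right; ½ h times `normalisation` replaces it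
    -- by the constant ½ h.
    objective : ∀ {R h c} → 1 ℕ.≤ R → 0# ≤ h → (1# / fromℕ 2) * h ≈ c → LocalSOS₂ R ⊢ ⟨X,_X⟩π G (K̄ G ξ) ≼ con h ⊗ ⟨X,X⟩π G →
                SheraliAdams R ⊢ OBJ G ξ ≼ con (1# / fromℕ 2 + c)
    objective {h = h} {c} 1≤R 0≤h ½h≈c d = derivable-resp eq
      (derivable-add (derivable-scale ½ 0≤½ (derivable-map localSOS⇒SheraliAdams d))
        (derivable-scale (½ * h) (*-nonneg 0≤½ 0≤h) (normalisation 1≤R (π G) 0≤μ sum-π)))
      where
      ½ : Carrier
      ½ = 1# / fromℕ 2
      0≤½ : 0# ≤ ½
      0≤½ = *-nonneg 0≤1 (proj₁ (⁻¹-pos (fromℕ-pos 1)))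
      eq : con ½ ⊗ (con h ⊗ ⟨X,X⟩π G ⊖ ⟨X,_X⟩π G (K̄ G ξ)) ⊕ con (½ * h) ⊗ (con 1# ⊖ ⟨X,X⟩π G) ≋ con (½ + c) ⊖ OBJ G ξ
      eq = ≋-trans (⊕-cong ≋-refl (⊗-cong (con-* ½ h) ≋-refl))
        (≋-trans (mix-normalisation (con ½) (con h) (⟨X,X⟩π G) (⟨X,_X⟩π G (K̄ G ξ)))
          (⊕-cong (≋-sym (≋-trans (con-+ ½ c) (⊕-cong ≋-refl (≋-trans (con-cong (sym ½h≈c)) (con-* ½ h))))) ≋-refl))

    module _ {ρ s ε : Carrier} (rad : IsSpectralRadius (K̄ G ξ) ρ) (s-def : IsInverseSqrt (π⋆ G) s) (ρ<ε : ρ < ε) (ε<s : ε < s)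
      {log : Carrier → Carrier} (isLog : IsLogarithm log) (ℓ : ℕ)
      (ℓ-bound : (1# / fromℕ 4) * (log (ε ^ 2 * π⋆ G) / log (ρ / ε)) ≤ fromℕ ℓ) where

      private
        0≤ρ : 0# ≤ ρ
        0≤ρ = IsSpectralRadius.nonneg rad

        0<ρ : 0# < ρ
        0<ρ = ρ-pos 0≤ρ (eigenvalue-bound rad) K̄≉0

      0<ε : 0# < ε
      0<ε = ≤-<-trans 0≤ρ ρ<ε

      private
        r a : Carrier
        r = ρ / ε
        a = ε ^ 2 * π⋆ G

        rε≈ρ : r * ε ≈ ρ
        rε≈ρ = trans (solve 3 (λ ρ i e → ρ :* i :* e := ρ :* (e :* i)) refl ρ (ε ⁻¹) ε) (trans (*-congˡ (*-inversePos 0<ε)) (*-identityʳ ρ))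

        0<r : 0# < r
        0<r = *-pos 0<ρ (⁻¹-pos 0<ε)

        r<1 : r < 1#
        r<1 = ≰⇒> λ 1≤r → <⇒≱ ρ<ε (≤-respˡ (*-identityˡ ε) (≤-respʳ rε≈ρ (*-monoˡ-≤ (proj₁ 0<ε) 1≤r)))

        0<s : 0# < s
        0<s = proj₁ s-def

        0<π⋆ : 0# < π⋆ G
        0<π⋆ = ≰⇒> λ π⋆≤0 → <⇒≱ 0<1 (≤-respˡ (proj₂ s-def) (≤-diff (*-nonneg (square-nonneg s) (neg-nonneg π⋆≤0))
          (solve 2 (λ s p → s :* (:- p) := :con +0 :- s :* p) refl (s * s) (π⋆ G))))

        0<a : 0# < a
        0<a = *-pos (^-pos 2 0<ε) 0<π⋆

        a<1 : a < 1#
        a<1 = ≰⇒> λ 1≤a → <⇒≱ (*-pos (*-pos (diff-pos ε<s) (+-pos 0<s (proj₁ 0<ε))) 0<π⋆)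
          (≤-diff (diff-nonneg 1≤a) (trans (+-congˡ (-‿cong (sym (proj₂ s-def))))
            (solve 3 (λ e s p → (e :* (e :* :1)) :* p :- s :* s :* p := :con +0 :- (s :- e) :* (s :+ e) :* p) refl ε s (π⋆ G))))

        powers : (r * r) ^ (ℓ ℕ.+ ℓ) ≤ a
        powers = RealLogarithms.Logarithms.quarter-log-ratio ℝ isLog 0<a 0<r r<1 ℓ ℓ-bound

      -- At ℓ = 0 `powers` would read 1 ≤ ε² π⋆, against ε < π⋆^(-½).
      1≤ℓ : 1 ℕ.≤ ℓ
      1≤ℓ = positive-exponent ℓ powers
        where
        positive-exponent : ∀ t → (r * r) ^ (t ℕ.+ t) ≤ a → 1 ℕ.≤ t
        positive-exponent zero    1≤a = contradiction 1≤a (<⇒≱ a<1)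
        positive-exponent (suc t) _   = ℕ.s≤s ℕ.z≤n

      -- Multiplying `powers` by ε^(4ℓ) gives ρ^(4ℓ) ≤ c² π⋆ with c = ε^(2ℓ+1), the hypothesis of
      -- `high-power` at exponent 2ℓ. This is the origin of the ¼ and of the ε² under the logarithm
      -- in ℓ.
      high : ∀ {R} → 2 ℕ.≤ R → Holds {R} (λ u v → ε * (ε * ε) ^ ℓ * T 0 u v - T (ℓ ℕ.+ ℓ) u v)
      high {R} 2≤R = high-power 0≤ρ (eigenvalue-bound rad) (localSOSCone R) 2≤R 0<ρ (ℓ ℕ.+ ℓ) c (*-pos 0<ε (^-pos ℓ (*-pos 0<ε 0<ε))) small
        where
        x = ε * ε
        c = ε * x ^ ℓ
        open ≈-Reasoning
        small : ∀ u → (ρ * ρ) ^ (ℓ ℕ.+ ℓ) ≤ c * c * π G u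
        small u = ≤-trans (≤-respˡ lhs (≤-respʳ rhs (*-monoˡ-≤ (^-nonneg (ℓ ℕ.+ ℓ) (square-nonneg ε)) powers)))
                          (*-monoʳ-≤ (square-nonneg c) (π⋆≤π u))
          where
          lhs : (r * r) ^ (ℓ ℕ.+ ℓ) * x ^ (ℓ ℕ.+ ℓ) ≈ (ρ * ρ) ^ (ℓ ℕ.+ ℓ)
          lhs = trans (sym (*-^ (r * r) x (ℓ ℕ.+ ℓ))) (^-congˡ (ℓ ℕ.+ ℓ)
            (trans (solve 2 (λ r e → (r :* r) :* (e :* e) := (r :* e) :* (r :* e)) refl r ε) (*-cong rε≈ρ rε≈ρ)))
          rhs : a * x ^ (ℓ ℕ.+ ℓ) ≈ c * c * π⋆ G
          rhs = trans (*-congˡ (^-+ x ℓ ℓ)) (solve 3 (λ e p q → (e :* (e :* :1)) :* p :* (q :* q) := (e :* q) :* (e :* q) :* p) refl ε (π⋆ G) (x ^ ℓ))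

      module _ (k : ℕ) (k-ceiling : IsCeiling ((1# / ε) ^ (2 ℕ.* ℓ)) k) where

        two-sided : ∀ {h} → (1# + 1#) * h ≈ (1# + 1# + 1# + 1# + 1#) * ε → ∀ σ → σ ≡ 1# ⊎ σ ≡ - 1# →
                    Holds {k ℕ.* ℓ ℕ.+ 1} (λ u v → h * T 0 u v - σ * T 1 u v)
        two-sided {h} 2h≈5ε σ σ≡ = by-size k k-ceiling
          where
          five = 1# + 1# + 1# + 1# + 1#

          y : Carrier
          y = (1# / ε) * (1# / ε)

          y^ℓ≈ : (1# / ε) ^ (2 ℕ.* ℓ) ≈ y ^ ℓ
          y^ℓ≈ = ^-double (1# / ε) ℓ

          ε²y≈1 : ε * ε * y ≈ 1#
          ε²y≈1 = trans (solve 2 (λ e i → e :* e :* ((:1 :* i) :* (:1 :* i)) := (e :* i) :* (e :* i)) refl ε (ε ⁻¹))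
            (trans (*-cong (*-inversePos 0<ε) (*-inversePos 0<ε)) (*-identityˡ 1#))

          0<y : 0# < y
          0<y = *-pos (*-pos 0<1 (⁻¹-pos 0<ε)) (*-pos 0<1 (⁻¹-pos 0<ε))

          σσ≈1 : ∀ {σ} → σ ≡ 1# ⊎ σ ≡ - 1# → σ * σ ≈ 1#
          σσ≈1 (inj₁ ≡.refl) = *-identityˡ 1#
          σσ≈1 (inj₂ ≡.refl) = solve 0 ((:- :1) :* (:- :1) := :1) refl

          by-size : ∀ k → IsCeiling ((1# / ε) ^ (2 ℕ.* ℓ)) k → Holds {k ℕ.* ℓ ℕ.+ 1} (λ u v → h * T 0 u v - σ * T 1 u v)
          -- A positive real has a positive ceiling, so k is of the form `suc κ`.
          by-size zero    (y^ℓ≤k , _) = contradiction (≤-respˡ y^ℓ≈ y^ℓ≤k) (<⇒≱ (^-pos ℓ 0<y))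
          by-size (suc κ) (y^ℓ≤k , k<) with ≤-total (five * ε) (1# + 1#)
          ... | inj₁ 5ε≤2 = Chains.ConvexityChain.conclusion ℝ walk (localSOSCone _) κ ℓ ℕ.≤-refl 1≤ℓ 0<ε 5ε≤2 ε²y≈1
                              (≤-respˡ y^ℓ≈ y^ℓ≤k)
                              (≤-diff (diff-nonneg (proj₁ k<)) (trans (solve 2 (λ κ p → (p :+ :1) :- (:1 :+ κ) := p :- κ) refl (fromℕ κ) _) (+-congʳ y^ℓ≈)))
                              (high 2≤R) 2h≈5ε σ (σσ≈1 σ≡)
            where
            2≤R : 2 ℕ.≤ suc κ ℕ.* ℓ ℕ.+ 1
            2≤R = ℕ.+-monoˡ-≤ 1 (ℕ.≤-trans 1≤ℓ (ℕ.m≤m+n ℓ (κ ℕ.* ℓ)))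
          ... | inj₂ 2≤5ε = large-bound (ℕ.+-monoˡ-≤ 1 (ℕ.≤-trans 1≤ℓ (ℕ.m≤m+n ℓ (κ ℕ.* ℓ))))
                              (*-cancelˡ-≤ 0<2 (≤-respˡ (sym (*-identityʳ _)) (≤-respʳ (sym 2h≈5ε) 2≤5ε))) σ≡

corollary3p7 :
    (ℝ : CompleteOrderedField) →
    let open CompleteOrderedField ℝ
        open OverReals ℝ
    in
    ∀ {n} (G : Multigraph (ℕ.suc n)) (ξ : Signing G) →
    Multigraph.NoIsolatedVertices G →
    ∀ (log : Carrier → Carrier) → IsLogarithm log →
    ∀ (ρ : Carrier) → IsSpectralRadius (K̄ G ξ) ρ →
    ∀ (π⋆^-½ : Carrier) → IsInverseSqrt (π⋆ G) π⋆^-½ →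
    ∀ (ε : Carrier) → ρ < ε → ε < π⋆^-½ →
    ∀ (ℓ : ℕ) →
    IsCeiling ((1# / fromℕ 4) * (log (ε ^ 2 * π⋆ G) / log (ρ / ε))) ℓ →
    ∀ (k : ℕ) → IsCeiling ((1# / ε) ^ (2 ℕ.* ℓ)) k →
    let R = k ℕ.* ℓ ℕ.+ 1 in
    (LocalSOS₂ R ⊢ con (- (fromℕ 5 / fromℕ 2 * ε)) ⊗ ⟨X,X⟩π G ≼ ⟨X,_X⟩π G (K̄ G ξ)) ×
    (LocalSOS₂ R ⊢ ⟨X,_X⟩π G (K̄ G ξ) ≼ con (fromℕ 5 / fromℕ 2 * ε) ⊗ ⟨X,X⟩π G) ×
    (SheraliAdams R ⊢ OBJ G ξ ≼ con (1# / fromℕ 2 + fromℕ 5 / fromℕ 4 * ε))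
corollary3p7 ℝ {n} G ξ noIsolated log isLog ρ rad s s-def ε ρ<ε ε<s ℓ ℓ-ceiling k k-ceiling =
  lower (bound (- 1#) (inj₂ ≡.refl)) , upper-bound ,
  objective (ℕ.m≤n+m 1 (k ℕ.* ℓ)) 0≤h ½h≈ upper-bound
  where
  open OrderedField ℝ
  open GraphCertificates.Certificates ℝ G ξ noIsolated
  open WalkForms.Walks ℝ (GraphWalk.walk ℝ G ξ noIsolated) using (T)
  h i₂ i₄ : Carrier
  h = fromℕ 5 / fromℕ 2 * ε
  i₂ = fromℕ 2 ⁻¹
  i₄ = fromℕ 4 ⁻¹
  open ≈-Reasoning
  2i₂≈1 : fromℕ 2 * i₂ ≈ 1#
  2i₂≈1 = *-inversePos (fromℕ-pos 1)
  2h≈5ε : (1# + 1#) * h ≈ (1# + 1# + 1# + 1# + 1#) * ε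
  2h≈5ε = begin
    (1# + 1#) * h
      ≈⟨ solve 2 (λ i e → :2 :* ((:1 :+ (:1 :+ (:1 :+ (:1 :+ (:1 :+ :con +0))))) :* i :* e) :=
           (:1 :+ (:1 :+ :con +0)) :* i :* ((:1 :+ :1 :+ :1 :+ :1 :+ :1) :* e)) refl i₂ ε ⟩
    fromℕ 2 * i₂ * ((1# + 1# + 1# + 1# + 1#) * ε)   ≈⟨ *-congʳ 2i₂≈1 ⟩
    1# * ((1# + 1# + 1# + 1# + 1#) * ε)             ≈⟨ *-identityˡ _ ⟩
    (1# + 1# + 1# + 1# + 1#) * ε                    ∎
  0≤h : 0# ≤ h
  0≤h = *-nonneg (*-nonneg (fromℕ-nonneg 5) (proj₁ (⁻¹-pos (fromℕ-pos 1)))) (≤-trans (IsSpectralRadius.nonneg rad) (proj₁ ρ<ε))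
  ½h≈ : (1# / fromℕ 2) * h ≈ fromℕ 5 / fromℕ 4 * ε
  ½h≈ = begin
    (1# * i₂) * (fromℕ 5 * i₂ * ε)              ≈⟨ *-identityʳ _ ⟨
    (1# * i₂) * (fromℕ 5 * i₂ * ε) * 1#         ≈⟨ *-congˡ (*-inversePos (fromℕ-pos 3)) ⟨
    (1# * i₂) * (fromℕ 5 * i₂ * ε) * (fromℕ 4 * i₄)
      ≈⟨ solve 4 (λ i j e f → (:1 :* i) :* (f :* i :* e) :* ((:1 :+ (:1 :+ (:1 :+ (:1 :+ :con +0)))) :* j) :=
           ((:1 :+ (:1 :+ :con +0)) :* i) :* ((:1 :+ (:1 :+ :con +0)) :* i) :* (f :* j :* e)) refl i₂ i₄ ε (fromℕ 5) ⟩
    (fromℕ 2 * i₂) * (fromℕ 2 * i₂) * (fromℕ 5 * i₄ * ε)   ≈⟨ *-congʳ (*-cong 2i₂≈1 2i₂≈1) ⟩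
    1# * 1# * (fromℕ 5 * i₄ * ε)                ≈⟨ trans (*-congʳ (*-identityˡ 1#)) (*-identityˡ _) ⟩
    fromℕ 5 * i₄ * ε                            ∎
  bound : ∀ σ → σ ≡ 1# ⊎ σ ≡ - 1# → Holds {k ℕ.* ℓ ℕ.+ 1} (λ u v → h * T 0 u v - σ * T 1 u v)
  bound = two-sided rad s-def ρ<ε ε<s isLog ℓ (proj₁ ℓ-ceiling) k k-ceiling 2h≈5ε
  upper-bound = upper (bound 1# (inj₁ ≡.refl))
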